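{- For any $n\ge1$, $$\sum_{\pi\in\mathfrak{S}_n(231)}(-1)^{\mathsf{des}\,\pi}q^{(31\text{ - }2)\pi}=\sum_{\pi\in\mathfrak{S}_n(231)}(-1)^{\mathsf{des}\,\pi}q^{(13\text{ - }2)\pi}=\begin{cases}0,&n\text{ even},\\(-q)^{(n-1)/2}C_{(n-1)/2}(q^2),&n\text{ odd},\end{cases}$$ $$\sum_{\pi\in\mathfrak{D}^*_n(231)}(-q)^{\mathsf{des}\,\pi}q^{(31\text{ - }2)\pi}=\begin{cases}(-q)^{n/2}C_{n/2}(q^2),&n\text{ even},\\0,&n\text{ odd},\end{cases}\qquad \sum_{\pi\in\mathfrak{D}^*_n(231)}(-1)^{\mathsf{des}\,\pi}q^{(13\text{ - }2)\pi}=\begin{cases}(-1)^{n/2}C^*_{n/2}(q),&n\text{ even},\\0,&n\text{ odd},\end{cases}$$ where $C^*_m(q):=\sum_{\pi\in\mathfrak{A}_{2m}(132)}q^{(2\text{ - }31)\pi}$.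
   Context: $C_n(q):=C_n(q,q^2)$, where $C_n(t,q)$ is defined by $\sum_{n\ge0}C_n(t,q)z^n=1/(1-c_1z/(1-c_2z/(1-c_3z/\cdots)))$ with $c_{2k-1}=q^{k-1}$, $c_{2k}=tq^{k-1}$. $\mathfrak{S}_n(\tau)$: permutations of $[n]$ avoiding classical pattern $\tau$. For $\pi\in\mathfrak{S}_n$ set $\pi(n+1)=n+1$; $\pi(i)$ is a foremaximum if $\pi(i)<\pi(i+1)$ and $\pi(i)=\max\{\pi(1),\dots,\pi(i)\}$; a coderangement has no foremaximum; $\mathfrak{D}^*_n(\tau)$ is the set of coderangements in $\mathfrak{S}_n(\tau)$. $\mathfrak{A}_n(\tau)$ is the set of alternating (up-down) permutations $\pi(1)<\pi(2)>\pi(3)<\cdots$ in $\mathfrak{S}_n(\tau)$. $\mathsf{des}\,\pi=\#\{i\in[n-1]:\pi(i)>\pi(i+1)\}$; $(31\text{ - }2)\pi=\#\{(i,j):i+1<j\le n,\pi(i+1)<\pi(j)<\pi(i)\}$, $(2\text{ - }31)\pi=\#\{(i,j):j<i<n,\pi(i+1)<\pi(j)<\pi(i)\}$, $(13\text{ - }2)\pi=\#\{(i,j):i+1<j\le n,\pi(i)<\pi(j)<\pi(i+1)\}$. -}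

module Defs where

open import Algebra.Bundles using (CommutativeRing)
import Algebra.Properties.Semiring.Exp
open import Data.Bool.Base using (if_then_else_)
open import Data.Fin.Base using (Fin; toℕ; fromℕ; inject₁; _<_; _≤_; _>_) renaming (suc to fsuc)
open import Data.Fin.Properties using (all?; any?; _<?_; _≤?_) renaming (_≟_ to _≟ᶠ_)
open import Data.List.Base using (List; []; _∷_; allFin; cartesianProduct; cartesianProductWith; filter; foldr; length; map)
open import Data.Nat.Base as ℕ using (ℕ; zero; suc; _∸_)
open import Data.Nat.Divisibility using (_∣_; _∣?_)
open import Data.Nat.DivMod using (_/_)
open import Data.Nat.Properties using (_≟_; ≤-refl; ≤-trans; m≤n⇒m≤1+n)
open import Data.Product.Base using (_×_; _,_; ∃)
open import Data.Vec.Base as Vec using (Vec; lookup; _∷ʳ_)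
open import Function.Base using (_∘_)
open import Relation.Binary.PropositionalEquality.Core using (_≡_)
open import Relation.Nullary.Decidable.Core using (Dec; does; ¬?; _×-dec_; _→-dec_)
open import Relation.Nullary.Negation.Core using (¬_)

-- One-line notation.  Positions and values are 0-based (elements of Fin n),
-- so position i : Fin n stands for position toℕ i + 1 of the word.
Word : ℕ → Set
Word n = Vec (Fin n) n

words : ∀ n k → List (Vec (Fin n) k)
words n zero    = Vec.[] ∷ []
words n (suc k) = cartesianProductWith Vec._∷_ (allFin n) (words n k)

IsPermutation : ∀ {n} → Word n → Set
IsPermutation π = ∀ i j → lookup π i ≡ lookup π j → i ≡ j

isPermutation? : ∀ {n} (π : Word n) → Dec (IsPermutation π)
isPermutation? π = all? λ i → all? λ j → (lookup π i ≟ᶠ lookup π j) →-dec (i ≟ᶠ j)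

𝔖 : ∀ n → List (Word n)
𝔖 n = filter isPermutation? (words n n)

Avoids231 : ∀ {n} → Word n → Set
Avoids231 π = ∀ i j k → i < j → j < k →
  ¬ (lookup π k < lookup π i × lookup π i < lookup π j)

avoids231? : ∀ {n} (π : Word n) → Dec (Avoids231 π)
avoids231? π = all? λ i → all? λ j → all? λ k → (i <? j) →-dec ((j <? k) →-dec
  ¬? ((lookup π k <? lookup π i) ×-dec (lookup π i <? lookup π j)))

Avoids132 : ∀ {n} → Word n → Set
Avoids132 π = ∀ i j k → i < j → j < k →
  ¬ (lookup π i < lookup π k × lookup π k < lookup π j)

avoids132? : ∀ {n} (π : Word n) → Dec (Avoids132 π)
avoids132? π = all? λ i → all? λ j → all? λ k → (i <? j) →-dec ((j <? k) →-dec
  ¬? ((lookup π i <? lookup π k) ×-dec (lookup π k <? lookup π j)))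

𝔖231 : ∀ n → List (Word n)
𝔖231 n = filter avoids231? (𝔖 n)

-- The convention π(n+1) = n+1.
extend : ∀ {n} → Word n → Word (suc n)
extend {n} π = Vec.map inject₁ π ∷ʳ fromℕ n

Foremaximum : ∀ {n} → Word n → Fin n → Set
Foremaximum π i =
  lookup (extend π) (inject₁ i) < lookup (extend π) (fsuc i)
  × (∀ j → j ≤ i → lookup π j ≤ lookup π i)

foremaximum? : ∀ {n} (π : Word n) i → Dec (Foremaximum π i)
foremaximum? π i =
  (lookup (extend π) (inject₁ i) <? lookup (extend π) (fsuc i))
  ×-dec all? λ j → (j ≤? i) →-dec (lookup π j ≤? lookup π i)

Coderangement : ∀ {n} → Word n → Set
Coderangement π = ¬ ∃ (Foremaximum π)

coderangement? : ∀ {n} (π : Word n) → Dec (Coderangement π)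
coderangement? π = ¬? (any? (foremaximum? π))

𝔇*231 : ∀ n → List (Word n)
𝔇*231 n = filter coderangement? (𝔖231 n)

-- i′ is the position i + 1.
_⋖_ : ∀ {n} → Fin n → Fin n → Set
i ⋖ i′ = toℕ i′ ≡ suc (toℕ i)

_⋖?_ : ∀ {n} (i i′ : Fin n) → Dec (i ⋖ i′)
i ⋖? i′ = toℕ i′ ≟ suc (toℕ i)

-- π(1) < π(2) > π(3) < ⋯ ; the 1-based odd positions are those with toℕ i even.
Alternating : ∀ {n} → Word n → Set
Alternating π = ∀ i i′ → i ⋖ i′ →
  (2 ∣ toℕ i → lookup π i < lookup π i′) × (¬ (2 ∣ toℕ i) → lookup π i > lookup π i′)

alternating? : ∀ {n} (π : Word n) → Dec (Alternating π)
alternating? π = all? λ i → all? λ i′ → (i ⋖? i′) →-dec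
  (((2 ∣? toℕ i) →-dec (lookup π i <? lookup π i′))
   ×-dec (¬? (2 ∣? toℕ i) →-dec (lookup π i′ <? lookup π i)))

𝔄132 : ∀ n → List (Word n)
𝔄132 n = filter alternating? (filter avoids132? (𝔖 n))

-- In the statistics below a pair (i , j) of the usual definition is recorded
-- as (i , i′ , j) with i′ = i + 1; this also enforces i < n.
positions² : ∀ n → List (Fin n × Fin n)
positions² n = cartesianProduct (allFin n) (allFin n)

positions³ : ∀ n → List (Fin n × Fin n × Fin n)
positions³ n = cartesianProduct (allFin n) (positions² n)

des : ∀ {n} → Word n → ℕ
des {n} π = length (filter
  (λ (i , i′) → (i ⋖? i′) ×-dec (lookup π i′ <? lookup π i))
  (positions² n))

⟨31-2⟩ : ∀ {n} → Word n → ℕ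
⟨31-2⟩ {n} π = length (filter
  (λ (i , i′ , j) → (i ⋖? i′) ×-dec (i′ <? j)
    ×-dec (lookup π i′ <? lookup π j) ×-dec (lookup π j <? lookup π i))
  (positions³ n))

⟨2-31⟩ : ∀ {n} → Word n → ℕ
⟨2-31⟩ {n} π = length (filter
  (λ (i , i′ , j) → (i ⋖? i′) ×-dec (j <? i)
    ×-dec (lookup π i′ <? lookup π j) ×-dec (lookup π j <? lookup π i))
  (positions³ n))

⟨13-2⟩ : ∀ {n} → Word n → ℕ
⟨13-2⟩ {n} π = length (filter
  (λ (i , i′ , j) → (i ⋖? i′) ×-dec (i′ <? j)
    ×-dec (lookup π i <? lookup π j) ×-dec (lookup π j <? lookup π i′))
  (positions³ n))

infix 0 ifEven_then_else_
ifEven_then_else_ : ∀ {a} {A : Set a} → ℕ → A → A → A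
ifEven n then x else y = if does (2 ∣? n) then x else y

-- The indeterminates t and q are arbitrary elements of an arbitrary commutative
-- ring R; identities of integer polynomials are the generic case R = ℤ[t,q].
module InRing {c ℓ} (R : CommutativeRing c ℓ) where
  open CommutativeRing R hiding (zero)
  open Algebra.Properties.Semiring.Exp semiring public using (_^_)

  ∑ : ∀ {a} {A : Set a} → List A → (A → Carrier) → Carrier
  ∑ xs f = foldr _+_ 0# (map f xs)

  -- Formal power series in z, as coefficient sequences.
  Series : Set c
  Series = ℕ → Carrier

  one : Series
  one zero    = 1#
  one (suc _) = 0#

  -- dot f (bₙ ∷ ⋯ ∷ b₀) = f₀ bₙ + ⋯ + fₙ b₀, the coefficient of zⁿ in f · b.
  dot : ∀ {k} → Series → Vec Carrier k → Carrier
  dot f Vec.[]       = 0#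
  dot f (b Vec.∷ bs) = f zero * b + dot (f ∘ suc) bs

  -- The coefficients bₙ, …, b₀ of b = 1/f for a series f with f₀ = 1,
  -- obtained by solving f · b = 1 (see recip-inverse).
  recipCoeffs : Series → ∀ n → Vec Carrier (suc n)
  recipCoeffs f zero    = 1# Vec.∷ Vec.[]
  recipCoeffs f (suc n) = (- dot (f ∘ suc) (recipCoeffs f n)) Vec.∷ recipCoeffs f n

  recip : Series → Series
  recip f n = Vec.head (recipCoeffs f n)

  recip-inverse : ∀ f → f zero ≈ 1# → ∀ n → dot f (recipCoeffs f n) ≈ one n
  recip-inverse f f₀≈1 zero =
    trans (+-identityʳ _) (trans (*-identityʳ _) f₀≈1)
  recip-inverse f f₀≈1 (suc n) =
    trans (+-congʳ (trans (*-congʳ f₀≈1) (*-identityˡ _))) (-‿inverseˡ _)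

  -- 1 - a z F
  1-_z·_ : Carrier → Series → Series
  (1- a z· F) zero    = 1#
  (1- a z· F) (suc n) = - (a * F n)

  -- convergent c N j = 1/(1 - cⱼz/(1 - cⱼ₊₁z/(⋯/(1 - cⱼ₊N₋₁z)))), with N levels.
  convergent : (ℕ → Carrier) → ℕ → ℕ → Series
  convergent c zero    j = one
  convergent c (suc N) j = recip (1- c j z· convergent c N (suc j))

  -- The infinite fraction 1/(1 - c₁z/(1 - c₂z/⋯)) is the z-adic limit of its
  -- convergents; the coefficient of zⁿ is constant from level n on
  -- (see convergent-stable).
  continuedFraction : (ℕ → Carrier) → Series
  continuedFraction c n = convergent c n 1 n

  private
    recip-cong : ∀ {f g : Series} n → (∀ m → m ℕ.≤ n → f m ≈ g m) →
      recip f n ≈ recip g n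

    dot-cong : ∀ {f g : Series} n → (∀ m → m ℕ.≤ n → f m ≈ g m) →
      ∀ h k → (∀ m → m ℕ.≤ n → h m ≈ k m) →
      dot h (recipCoeffs f n) ≈ dot k (recipCoeffs g n)

    recip-cong zero    p = refl
    recip-cong (suc n) p = -‿cong
      (dot-cong n (λ m le → p m (m≤n⇒m≤1+n le)) _ _ (λ m le → p (suc m) (ℕ.s≤s le)))

    dot-cong zero    p h k s = +-congʳ (*-congʳ (s 0 ℕ.z≤n))
    dot-cong (suc n) p h k s = +-cong (*-cong (s 0 ℕ.z≤n) (recip-cong (suc n) p))
      (dot-cong n (λ m le → p m (m≤n⇒m≤1+n le)) _ _ (λ m le → s (suc m) (ℕ.s≤s le)))

    agree : ∀ c n M N → n ℕ.≤ M → n ℕ.≤ N → ∀ j →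
      convergent c M j n ≈ convergent c N j n
    agree c zero zero    zero    _ _ j = refl
    agree c zero zero    (suc N) _ _ j = refl
    agree c zero (suc M) zero    _ _ j = refl
    agree c zero (suc M) (suc N) _ _ j = refl
    agree c (suc n) (suc M) (suc N) (ℕ.s≤s n≤M) (ℕ.s≤s n≤N) j =
      recip-cong (suc n) λ where
        zero    _           → refl
        (suc m) (ℕ.s≤s m≤n) → -‿cong (*-congˡ
          (agree c m M N (≤-trans m≤n n≤M) (≤-trans m≤n n≤N) (suc j)))

  convergent-stable : ∀ c n N → n ℕ.≤ N →
    convergent c N 1 n ≈ continuedFraction c n
  convergent-stable c n N n≤N = agree c n N n n≤N ≤-refl 1

  -- c₂ₖ₋₁ = qᵏ⁻¹ and c₂ₖ = t qᵏ⁻¹; in both cases k - 1 = ⌊(j - 1)/2⌋.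
  -- The value at j = 0 is never used.
  cfCoeff : Carrier → Carrier → ℕ → Carrier
  cfCoeff t q j = ifEven j then (t * q ^ ((j ∸ 1) / 2)) else (q ^ ((j ∸ 1) / 2))

  -- C₂ n t q = Cₙ(t,q)
  C₂ : ℕ → Carrier → Carrier → Carrier
  C₂ n t q = continuedFraction (cfCoeff t q) n

  -- C n q = Cₙ(q) = Cₙ(q,q²)
  C : ℕ → Carrier → Carrier
  C n q = C₂ n q (q ^ 2)

  C* : ℕ → Carrier → Carrier
  C* m q = ∑ (𝔄132 (2 ℕ.* m)) λ π → q ^ ⟨2-31⟩ π

{-# OPTIONS --safe #-}

-- Cut a permutation at its maximum, π = L n R: it avoids 231 iff L < R and both
-- parts avoid 231.  Weighting descents by t, and with σ f(z) = f(q z), this gives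
--   for 13-2:  A = 1 + A⁺,  A⁺ = z (Ã + A⁺ σÃ),  Ã = 1 + t A⁺,
--   for 31-2:  G = 1 + z G H̃,  H̃ = 1 + t H⁺,  H⁺ = z (H̃ + q H⁺ σH̃),
-- where H also counts the letters exceeding the first one; hence H⁺ = z H̃ σG.
-- A coderangement has L a coderangement and R nonempty, which gives
-- D = 1 + t z D H⁺ for 31-2 and D*⁺ = t z (A⁺ + D*⁺ σA⁺) for 13-2.
--
-- For t = -1 both A⁺/z and (G - 1)/z, and for t = -q also D, solve
-- E = 1 - q z² E σE.  Since the coefficients of the continued fraction of
-- Cₙ(q) are cⱼ = qʲ⁻¹, the unique solution is E = Σ (-q)ᵐ Cₘ(q²) z²ᵐ.
-- For t = -1 moreover D*⁺ = -z² E².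
--
-- For 132 the cut has L > R, and an up-down word of length > 1 has L of odd
-- length.  With z o(z²) and 1 + u⁺(z²) the odd and even parts of the series of
-- up-down words by 2-31, this yields o = 1 + q z o(z) o(q² z) and u⁺ = z o², so that
-- E = o(-z²) and D*⁺ = u⁺(-z²).
module Submission where

open import Defs
open import Algebra.Bundles using (CommutativeRing)
import Algebra.Properties.Ring
import Algebra.Properties.Semiring.Exp
import Algebra.Solver.Ring.NaturalCoefficients.Default
open import Data.Bool.Base using (Bool; true; false; T; not; _∧_; if_then_else_)
open import Data.Bool.Properties using (T-∧; T?; ∧-identityʳ; ∧-assoc)
open import Data.Fin.Base as Fin using (Fin; zero; suc; toℕ; fromℕ; fromℕ<; inject₁)
import Data.Fin.Properties as Finₚ
open import Data.List.Base using (List; []; _∷_; _++_; map; concatMap; length; upTo; applyUpTo; tabulate; allFin; filter; cartesianProduct)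
open import Data.List.Membership.Propositional using (_∈_; _∉_; find; lose)
open import Data.List.Membership.Propositional.Properties using (∈-++⁺ˡ; ∈-++⁺ʳ; ∈-++⁻; ∈-∃++; ∈-map⁺; ∈-map⁻; ∈-concatMap⁺; ∈-concatMap⁻; ∈-upTo⁺; ∈-upTo⁻; ∈-cartesianProductWith⁺; ∈-allFin; ∈-tabulate⁺; ∈-tabulate⁻; ∈-filter⁺; ∈-filter⁻)
open import Data.List.Membership.Propositional.Properties.WithK using (unique∧set⇒bag)
import Data.List.Properties as Listₚ
open import Data.List.Relation.Binary.BagAndSetEquality using (∼bag⇒↭)
import Data.List.Relation.Binary.Permutation.Propositional as ↭
open ↭ using (_↭_; ↭-refl; ↭-reflexive; ↭-sym; ↭-trans; prep; ↭⇒↭ₛ)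
open import Data.List.Relation.Binary.Permutation.Propositional.Properties using (∈-resp-↭; ↭-length; ↭-map-inv; drop-∷; shift; ++-comm; ++⁺; ↭-empty-inv) renaming (map⁺ to ↭-map⁺)
import Data.List.Relation.Binary.Permutation.Setoid.Properties as Permutationₚ
import Data.List.Relation.Binary.Sublist.Propositional as Sublist
open Sublist using (_⊆_; []; _∷_; _∷ʳ_; minimum; from∈)
open import Data.List.Relation.Binary.Sublist.Propositional.Properties using () renaming (++⁺ˡ to ⊆-++⁺ˡ; ++⁺ʳ to ⊆-++⁺ʳ; map⁺ to ⊆-map⁺; ++⁺ to ⊆-++⁺)
import Data.List.Relation.Unary.All as All
open All using ([]; _∷_)
open import Data.List.Relation.Unary.AllPairs using ([]; _∷_)
open import Data.List.Relation.Unary.Any using (here; there)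
open import Data.List.Relation.Unary.Unique.Propositional using (Unique)
import Data.List.Relation.Unary.Unique.Propositional.Properties as Uniqueₚ
open import Data.Nat.Base as ℕ using (ℕ; zero; suc; z≤n; s≤s; _≤_; _<_; _>_; _∸_; _⊔_; _≡ᵇ_; _<ᵇ_; _≤ᵇ_)
open import Data.Nat.Divisibility using (_∣_; _∣?_; divides; n∣m*n)
open import Data.Nat.DivMod using (_/_; m*n/n≡m; m/n≡1+[m∸n]/n)
open import Data.Nat.Induction using (<-rec)
open import Data.Nat.ListAction using (sum)
open import Data.Nat.ListAction.Properties using (sum-++)
import Data.Nat.Properties as ℕₚ
open import Data.Product.Base using (_×_; _,_; proj₁; proj₂; ∃; ∃₂; map₁)
open import Data.Sum.Base using (_⊎_; inj₁; inj₂)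
open import Data.Unit.Base using (tt)
open import Data.Vec.Base as Vec using (Vec; lookup)
import Data.Vec.Properties as Vecₚ
open import Function.Base using (_∘_; _∘′_; id)
open import Function.Bundles using (_⇔_; mk⇔; Equivalence)
import Relation.Binary.PropositionalEquality as ≡
open ≡ using (_≡_)
import Relation.Binary.Reasoning.Setoid
open import Relation.Nullary.Decidable using (Dec; yes; no; does; does-⇔; dec-true; dec-false)
open import Relation.Nullary.Negation using (¬_; contradiction)
open import Relation.Unary using (Decidable)

-- Formal power series

-- The refined series H is forced by 31-2: a maximum n in front of a nonempty R forms a `31` with
-- the first letter of R, and every later letter of R above that first letter serves as the `2`. The
-- recursion for G therefore involves this number, while the one for H closes up: in L n R with L
-- nonempty, everything from n on exceeds the first letter. For 13-2 the last letter of L and n form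
-- the `13`, and all of R lies between them. Both gains are powers of q that grow with the length of
-- R; this is the origin of σ.
--
-- Closed forms are verified rather than solved for: a candidate is shown to satisfy an equation X =
-- Φ(X) in which each coefficient on the right depends only on earlier coefficients of X. This
-- avoids inverses of series. The algebra is also free of subtraction: t stays a letter, and its
-- value enters only where a factor 1 + t or q + t has been isolated.

module PowerSeries {c ℓ} (R : CommutativeRing c ℓ) where
  open CommutativeRing R hiding (zero)
  open InRing R using (Series; one; _^_)
  private
    module ≈-Reasoning = Relation.Binary.Reasoning.Setoid setoid
    open module RS = Algebra.Solver.Ring.NaturalCoefficients.Default commutativeSemiring
      using (solve; _:=_; _:+_; _:*_; con)

  infix  4 _≋_
  infixl 7 _⊛_

  _≋_ : Series → Series → Set ℓ
  f ≋ g = ∀ n → f n ≈ g n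

  _⊕_ : Series → Series → Series
  (f ⊕ g) n = f n + g n

  -- The Cauchy product, peeled from the left factor: the same recursion as that of `dot` along
  -- `recipCoeffs` and of a sum over `antidiagonal`, so that both translate into products by plain
  -- induction.
  _⊛_ : Series → Series → Series
  (f ⊛ g) zero    = f 0 * g 0
  (f ⊛ g) (suc n) = f 0 * g (suc n) + ((f ∘′ suc) ⊛ g) n

  -- Coefficient n of a product sees only coefficients up to n. This locality is what the
  -- contraction arguments and the passage from convergents to the infinite fraction rest on.
  ⊛-cong-≤ : ∀ {f f′ g g′} n → (∀ m → m ≤ n → f m ≈ f′ m) → (∀ m → m ≤ n → g m ≈ g′ m) →
    (f ⊛ g) n ≈ (f′ ⊛ g′) n
  ⊛-cong-≤ zero    p r = *-cong (p 0 z≤n) (r 0 z≤n)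
  ⊛-cong-≤ (suc n) p r = +-cong (*-cong (p 0 z≤n) (r (suc n) ℕₚ.≤-refl))
    (⊛-cong-≤ n (λ m m≤n → p (suc m) (s≤s m≤n)) (λ m m≤n → r m (ℕₚ.m≤n⇒m≤1+n m≤n)))

  ⊛-cong : ∀ {f f′ g g′} → f ≋ f′ → g ≋ g′ → (f ⊛ g) ≋ (f′ ⊛ g′)
  ⊛-cong p r n = ⊛-cong-≤ n (λ m _ → p m) (λ m _ → r m)

  ⊛-distribʳ : ∀ f g h → ((f ⊕ g) ⊛ h) ≋ ((f ⊛ h) ⊕ (g ⊛ h))
  ⊛-distribʳ f g h zero    = distribʳ _ _ _
  ⊛-distribʳ f g h (suc n) = trans
    (+-cong (distribʳ _ _ _) (⊛-distribʳ (f ∘′ suc) (g ∘′ suc) h n))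
    (solve 4 (λ a b c d → (a :+ b) :+ (c :+ d) := (a :+ c) :+ (b :+ d)) refl _ _ _ _)

  ⊛-scalarˡ : ∀ a f g n → ((λ i → a * f i) ⊛ g) n ≈ a * (f ⊛ g) n
  ⊛-scalarˡ a f g zero    = *-assoc _ _ _
  ⊛-scalarˡ a f g (suc n) =
    trans (+-cong (*-assoc _ _ _) (⊛-scalarˡ a (f ∘′ suc) g n)) (sym (distribˡ _ _ _))

  ⊛-assoc : ∀ f g h → ((f ⊛ g) ⊛ h) ≋ (f ⊛ (g ⊛ h))
  ⊛-assoc f g h zero    = *-assoc _ _ _
  ⊛-assoc f g h (suc n) = begin
    f 0 * g 0 * h (suc n) + (((f ⊛ g) ∘′ suc) ⊛ h) n
      ≈⟨ +-congˡ (⊛-distribʳ (λ i → f 0 * g (suc i)) ((f ∘′ suc) ⊛ g) h n) ⟩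
    f 0 * g 0 * h (suc n) + (((λ i → f 0 * g (suc i)) ⊛ h) n + (((f ∘′ suc) ⊛ g) ⊛ h) n)
      ≈⟨ +-congˡ (+-cong (⊛-scalarˡ (f 0) (g ∘′ suc) h n) (⊛-assoc (f ∘′ suc) g h n)) ⟩
    f 0 * g 0 * h (suc n) + (f 0 * ((g ∘′ suc) ⊛ h) n + ((f ∘′ suc) ⊛ (g ⊛ h)) n)
      ≈⟨ solve 5 (λ a b c d e → a :* b :* c :+ (a :* d :+ e) := a :* (b :* c :+ d) :+ e) refl _ _ _ _ _ ⟩
    f 0 * (g 0 * h (suc n) + ((g ∘′ suc) ⊛ h) n) + ((f ∘′ suc) ⊛ (g ⊛ h)) n ∎
    where open ≈-Reasoning

  ⊛-sucʳ : ∀ f g n → (f ⊛ g) (suc n) ≈ f (suc n) * g 0 + (f ⊛ (g ∘′ suc)) n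
  ⊛-sucʳ f g zero    = +-comm _ _
  ⊛-sucʳ f g (suc n) = trans (+-congˡ (⊛-sucʳ (f ∘′ suc) g n))
    (solve 3 (λ a b c → a :+ (b :+ c) := b :+ (a :+ c)) refl _ _ _)

  ⊛-comm : ∀ f g → (f ⊛ g) ≋ (g ⊛ f)
  ⊛-comm f g zero    = *-comm _ _
  ⊛-comm f g (suc n) =
    trans (⊛-sucʳ f g n) (+-cong (*-comm _ _) (⊛-comm f (g ∘′ suc) n))

  ⊛-zeroˡ : ∀ g n → ((λ _ → 0#) ⊛ g) n ≈ 0#
  ⊛-zeroˡ g zero    = zeroˡ _
  ⊛-zeroˡ g (suc n) = trans (+-cong (zeroˡ _) (⊛-zeroˡ g n)) (+-identityˡ _)

  ⊛-identityˡ : ∀ g → (one ⊛ g) ≋ g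
  ⊛-identityˡ g zero    = *-identityˡ _
  ⊛-identityˡ g (suc n) = trans (+-cong (*-identityˡ _) (⊛-zeroˡ g n)) (+-identityʳ _)

  -- Series form a commutative ring again, so the ring solver and the congruence lemmas apply to
  -- whole functional equations instead of single coefficients.
  seriesRing : CommutativeRing c ℓ
  seriesRing = record
    { Carrier = Series
    ; _≈_ = _≋_
    ; _+_ = _⊕_
    ; _*_ = _⊛_
    ; -_ = λ f n → - f n
    ; 0# = λ _ → 0#
    ; 1# = one
    ; isCommutativeRing = record
      { isRing = record
        { +-isAbelianGroup = record
          { isGroup = record
            { isMonoid = record
              { isSemigroup = record
                { isMagma = record
                  { isEquivalence = record
                    { refl = λ _ → refl
                    ; sym = λ p n → sym (p n)
                    ; trans = λ p r n → trans (p n) (r n)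
                    }
                  ; ∙-cong = λ p r n → +-cong (p n) (r n)
                  }
                ; assoc = λ f g h n → +-assoc _ _ _
                }
              ; identity = (λ f n → +-identityˡ _) , (λ f n → +-identityʳ _)
              }
            ; inverse = (λ f n → -‿inverseˡ _) , (λ f n → -‿inverseʳ _)
            ; ⁻¹-cong = λ p n → -‿cong (p n)
            }
          ; comm = λ f g n → +-comm _ _
          }
        ; *-cong = ⊛-cong
        ; *-assoc = ⊛-assoc
        ; *-identity = ⊛-identityˡ , λ f n → trans (⊛-comm f one n) (⊛-identityˡ f n)
        ; distrib =
            (λ f g h n → trans (⊛-comm f (g ⊕ h) n)
              (trans (⊛-distribʳ g h f n) (+-cong (⊛-comm g f n) (⊛-comm h f n))))
          , (λ h f g → ⊛-distribʳ f g h)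
        }
      ; *-comm = ⊛-comm
      }
    }

  z : Series
  z zero    = 0#
  z (suc n) = one n

  κ : Carrier → Series
  κ a zero    = a
  κ a (suc n) = 0#

  z⊛-zero : ∀ f → (z ⊛ f) 0 ≈ 0#
  z⊛-zero f = zeroˡ _

  z⊛-suc : ∀ f n → (z ⊛ f) (suc n) ≈ f n
  z⊛-suc f n = trans (+-cong (zeroˡ _) (⊛-identityˡ f n)) (+-identityˡ _)

  z⊛-unfold : ∀ {f g} → f 0 ≈ 0# → (∀ n → f (suc n) ≈ g n) → f ≋ (z ⊛ g)
  z⊛-unfold {g = g} p r zero = trans p (sym (z⊛-zero g))
  z⊛-unfold p r (suc n)      = trans (r n) (sym (z⊛-suc _ n))

  κ⊛ : ∀ a f n → (κ a ⊛ f) n ≈ a * f n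
  κ⊛ a f zero    = refl
  κ⊛ a f (suc n) = trans (+-congˡ (⊛-zeroˡ f n)) (+-identityʳ _)

  κ-cong : ∀ {a b} → a ≈ b → κ a ≋ κ b
  κ-cong p zero    = p
  κ-cong p (suc n) = refl

  κ-* : ∀ a b → κ (a * b) ≋ (κ a ⊛ κ b)
  κ-* a b zero    = refl
  κ-* a b (suc n) = sym (trans (κ⊛ a (κ b) (suc n)) (zeroʳ _))

  κ-+≈0 : ∀ {a b} → a + b ≈ 0# → (κ a ⊕ κ b) ≋ (λ _ → 0#)
  κ-+≈0 p zero    = p
  κ-+≈0 p (suc n) = +-identityˡ _

  κ1≋one : κ 1# ≋ one
  κ1≋one zero    = refl
  κ1≋one (suc n) = refl

  scale : Carrier → Series → Series
  scale q f n = q ^ n * f n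

  scale-cong : ∀ q {f g} → f ≋ g → scale q f ≋ scale q g
  scale-cong q p n = *-congˡ (p n)

  scale-⊕ : ∀ q f g → scale q (f ⊕ g) ≋ (scale q f ⊕ scale q g)
  scale-⊕ q f g n = distribˡ _ _ _

  scale-⊛ : ∀ q f g → scale q (f ⊛ g) ≋ (scale q f ⊛ scale q g)
  scale-⊛ q f g zero    = solve 2 (λ a b → con 1 :* (a :* b) := (con 1 :* a) :* (con 1 :* b)) refl _ _
  scale-⊛ q f g (suc n) = begin
    (q * q ^ n) * (f 0 * g (suc n) + ((f ∘′ suc) ⊛ g) n)
      ≈⟨ solve 5 (λ q p a b c → (q :* p) :* (a :* b :+ c) := (con 1 :* a) :* ((q :* p) :* b) :+ q :* (p :* c)) refl _ _ _ _ _ ⟩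
    (1# * f 0) * (q ^ suc n * g (suc n)) + q * scale q ((f ∘′ suc) ⊛ g) n
      ≈⟨ +-congˡ (*-congˡ (scale-⊛ q (f ∘′ suc) g n)) ⟩
    (1# * f 0) * (q ^ suc n * g (suc n)) + q * (scale q (f ∘′ suc) ⊛ scale q g) n
      ≈⟨ +-congˡ (⊛-scalarˡ q _ _ n) ⟨
    (1# * f 0) * (q ^ suc n * g (suc n)) + ((λ i → q * scale q (f ∘′ suc) i) ⊛ scale q g) n
      ≈⟨ +-congˡ (⊛-cong (λ i → sym (*-assoc _ _ _)) (λ _ → refl) n) ⟩
    (1# * f 0) * (q ^ suc n * g (suc n)) + ((scale q f ∘′ suc) ⊛ scale q g) n ∎
    where open ≈-Reasoning

  scale-one : ∀ q → scale q one ≋ one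
  scale-one q zero    = *-identityˡ _
  scale-one q (suc n) = zeroʳ _

  scale-κ : ∀ q a → scale q (κ a) ≋ κ a
  scale-κ q a zero    = *-identityˡ _
  scale-κ q a (suc n) = zeroʳ _

  scale-z : ∀ q → scale q z ≋ (κ q ⊛ z)
  scale-z q zero          = trans (zeroʳ _) (sym (zeroʳ _))
  scale-z q (suc zero)    = trans (*-identityʳ _) (trans (*-identityʳ _)
    (sym (trans (κ⊛ q z 1) (*-identityʳ _))))
  scale-z q (suc (suc n)) = trans (zeroʳ _) (sym (trans (κ⊛ q z (2 ℕ.+ n)) (zeroʳ _)))

  scale-scale : ∀ q r f → scale q (scale r f) ≋ scale r (scale q f)
  scale-scale q r f n = solve 3 (λ a b c → a :* (b :* c) := b :* (a :* c)) refl _ _ _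

  -- dbl f is f(z²).
  dbl : Series → Series
  dbl f zero          = f 0
  dbl f (suc zero)    = 0#
  dbl f (suc (suc n)) = dbl (f ∘′ suc) n

  dbl-even : ∀ f m → dbl f (m ℕ.* 2) ≡ f m
  dbl-even f zero    = ≡.refl
  dbl-even f (suc m) = dbl-even (f ∘′ suc) m

  dbl-odd : ∀ f m → dbl f (suc (m ℕ.* 2)) ≡ 0#
  dbl-odd f zero    = ≡.refl
  dbl-odd f (suc m) = dbl-odd (f ∘′ suc) m

  dbl-cong : ∀ {f g} → f ≋ g → dbl f ≋ dbl g
  dbl-cong p zero          = p 0
  dbl-cong p (suc zero)    = refl
  dbl-cong p (suc (suc n)) = dbl-cong (λ m → p (suc m)) n

  dbl-⊕ : ∀ f g → dbl (f ⊕ g) ≋ (dbl f ⊕ dbl g)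
  dbl-⊕ f g zero          = refl
  dbl-⊕ f g (suc zero)    = sym (+-identityˡ _)
  dbl-⊕ f g (suc (suc n)) = dbl-⊕ (f ∘′ suc) (g ∘′ suc) n

  dbl-scalar : ∀ a f n → dbl (λ i → a * f i) n ≈ a * dbl f n
  dbl-scalar a f zero          = refl
  dbl-scalar a f (suc zero)    = sym (zeroʳ _)
  dbl-scalar a f (suc (suc n)) = dbl-scalar a (f ∘′ suc) n

  dbl-⊛ : ∀ f g → dbl (f ⊛ g) ≋ (dbl f ⊛ dbl g)
  dbl-⊛ f g zero          = refl
  dbl-⊛ f g (suc zero)    = sym (trans (+-cong (zeroʳ _) (zeroˡ _)) (+-identityˡ _))
  dbl-⊛ f g (suc (suc n)) = begin
    dbl ((f ⊛ g) ∘′ suc) n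
      ≈⟨ dbl-⊕ (λ i → f 0 * g (suc i)) ((f ∘′ suc) ⊛ g) n ⟩
    dbl (λ i → f 0 * g (suc i)) n + dbl ((f ∘′ suc) ⊛ g) n
      ≈⟨ +-cong (dbl-scalar (f 0) (g ∘′ suc) n) (dbl-⊛ (f ∘′ suc) g n) ⟩
    f 0 * dbl (g ∘′ suc) n + (dbl (f ∘′ suc) ⊛ dbl g) n
      ≈⟨ +-congˡ (trans (+-congʳ (zeroˡ _)) (+-identityˡ _)) ⟨
    f 0 * dbl (g ∘′ suc) n + (0# * dbl g (suc n) + (dbl (f ∘′ suc) ⊛ dbl g) n) ∎
    where open ≈-Reasoning

  dbl-zero : ∀ n → dbl (λ _ → 0#) n ≈ 0#
  dbl-zero zero          = refl
  dbl-zero (suc zero)    = refl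
  dbl-zero (suc (suc n)) = dbl-zero n

  dbl-κ : ∀ a → dbl (κ a) ≋ κ a
  dbl-κ a zero          = refl
  dbl-κ a (suc zero)    = refl
  dbl-κ a (suc (suc n)) = dbl-zero n

  dbl-one : dbl one ≋ one
  dbl-one zero          = refl
  dbl-one (suc zero)    = refl
  dbl-one (suc (suc n)) = dbl-zero n

  dbl-z : dbl z ≋ (z ⊛ z)
  dbl-z zero          = sym (zeroˡ _)
  dbl-z (suc zero)    = sym (z⊛-suc z 0)
  dbl-z (suc (suc n)) = trans (dbl-one n) (sym (z⊛-suc z (suc n)))

  scale-dbl : ∀ q f → scale q (dbl f) ≋ dbl (scale (q ^ 2) f)
  scale-dbl q f zero          = refl
  scale-dbl q f (suc zero)    = zeroʳ _
  scale-dbl q f (suc (suc n)) = begin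
    (q * (q * q ^ n)) * dbl (f ∘′ suc) n
      ≈⟨ solve 3 (λ q p x → (q :* (q :* p)) :* x := (q :* (q :* con 1)) :* (p :* x)) refl _ _ _ ⟩
    q ^ 2 * scale q (dbl (f ∘′ suc)) n
      ≈⟨ *-congˡ (scale-dbl q (f ∘′ suc) n) ⟩
    q ^ 2 * dbl (scale (q ^ 2) (f ∘′ suc)) n
      ≈⟨ dbl-scalar _ _ n ⟨
    dbl (λ i → q ^ 2 * scale (q ^ 2) (f ∘′ suc) i) n
      ≈⟨ dbl-cong (λ i → sym (*-assoc _ _ _)) n ⟩
    dbl (scale (q ^ 2) f ∘′ suc) n ∎
    where open ≈-Reasoning

  evens odds : Series → Series
  evens f m = f (m ℕ.* 2)
  odds  f m = f (suc (m ℕ.* 2))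

  dbl-parts : ∀ T → T ≋ (dbl (evens T) ⊕ (z ⊛ dbl (odds T)))
  dbl-parts T zero          = sym (trans (+-congˡ (z⊛-zero (dbl (odds T)))) (+-identityʳ _))
  dbl-parts T (suc zero)    = sym (trans (+-identityˡ _) (z⊛-suc (dbl (odds T)) 0))
  dbl-parts T (suc (suc n)) = trans (dbl-parts (λ i → T (2 ℕ.+ i)) n) (+-congˡ (lemma n))
    where
    lemma : ∀ n → (z ⊛ dbl (λ m → T (3 ℕ.+ m ℕ.* 2))) n
                ≈ (z ⊛ dbl (odds T)) (2 ℕ.+ n)
    lemma zero    = trans (z⊛-zero (dbl (λ m → T (3 ℕ.+ m ℕ.* 2))))
      (sym (z⊛-suc (dbl (odds T)) 1))
    lemma (suc n) = trans (z⊛-suc _ n) (sym (z⊛-suc _ (2 ℕ.+ n)))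

  -- With its odd counterpart: f and g are determined by f(z²) + z g(z²), so one equation between
  -- such sums splits into two.
  dbl⊕z-even : ∀ f g m → (dbl f ⊕ (z ⊛ dbl g)) (m ℕ.* 2) ≈ f m
  dbl⊕z-even f g zero    = trans (+-congˡ (z⊛-zero (dbl g))) (+-identityʳ _)
  dbl⊕z-even f g (suc m) = trans
    (+-cong (reflexive (dbl-even f (suc m))) (trans (z⊛-suc _ (suc (m ℕ.* 2))) (reflexive (dbl-odd g m))))
    (+-identityʳ _)

  dbl⊕z-odd : ∀ f g m → (dbl f ⊕ (z ⊛ dbl g)) (suc (m ℕ.* 2)) ≈ g m
  dbl⊕z-odd f g m = trans
    (+-cong (reflexive (dbl-odd f m)) (trans (z⊛-suc _ (m ℕ.* 2)) (reflexive (dbl-even g m))))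
    (+-identityˡ _)

  -- Two fixed points agree by strong induction on the coefficient, since coefficient n of Φ X
  -- depends only on the coefficients of X below n.
  contraction-unique : ∀ (Φ : Series → Series) →
    (∀ {X Y} n → (∀ m → m < n → X m ≈ Y m) → Φ X n ≈ Φ Y n) →
    ∀ {X Y} → X ≋ Φ X → Y ≋ Φ Y → X ≋ Y
  contraction-unique Φ contr p r = <-rec _ λ n ih →
    trans (p n) (trans (contr n (λ m → ih {m})) (sym (r n)))

  z⊛-contracts : ∀ {f g} n → (∀ m → m < n → f m ≈ g m) → (z ⊛ f) n ≈ (z ⊛ g) n
  z⊛-contracts {f} {g} zero p = trans (z⊛-zero f) (sym (z⊛-zero g))
  z⊛-contracts (suc n) p      = trans (z⊛-suc _ n) (trans (p n ℕₚ.≤-refl) (sym (z⊛-suc _ n)))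

  -- The factor z makes the right side a contraction. This stands in for writing the solution as u /
  -- (1 - z v).
  linear-unique : ∀ u v {X Y} → X ≋ (u ⊕ (z ⊛ (v ⊛ X))) → Y ≋ (u ⊕ (z ⊛ (v ⊛ Y))) → X ≋ Y
  linear-unique u v = contraction-unique (λ X → u ⊕ (z ⊛ (v ⊛ X))) λ n p →
    +-congˡ (z⊛-contracts n λ m m<n → ⊛-cong-≤ m (λ _ _ → refl)
      (λ i i≤m → p i (ℕₚ.≤-<-trans i≤m m<n)))

  -- For a = 1 this is the functional equation of the Carlitz-Riordan q-Catalan numbers. The
  -- coefficient a is a series because passing from z to z² leaves an extra z in it.
  Carlitz : Series → Carrier → Series → Set ℓ
  Carlitz a q X = X ≋ (one ⊕ (z ⊛ (a ⊛ (X ⊛ scale q X))))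

  Carlitz-unique : ∀ a q {X Y} → Carlitz a q X → Carlitz a q Y → X ≋ Y
  Carlitz-unique a q = contraction-unique (λ X → one ⊕ (z ⊛ (a ⊛ (X ⊛ scale q X)))) λ n p →
    +-congˡ (z⊛-contracts n λ m m<n → ⊛-cong-≤ m (λ _ _ → refl) λ i i≤m →
      ⊛-cong-≤ i (λ j j≤i → p j (ℕₚ.≤-<-trans (ℕₚ.≤-trans j≤i i≤m) m<n))
                 (λ j j≤i → *-congˡ (p j (ℕₚ.≤-<-trans (ℕₚ.≤-trans j≤i i≤m) m<n))))

-- Functional equations in the ring of power series

module FunctionalEquations {c ℓ} (R : CommutativeRing c ℓ) where
  private module R = CommutativeRing R
  open InRing R using (Series; _^_)
  open PowerSeries R
  open CommutativeRing seriesRing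
  open Relation.Binary.Reasoning.Setoid setoid
  private
    open module SS = Algebra.Solver.Ring.NaturalCoefficients.Default commutativeSemiring
      using (solve; _:=_; _:+_; _:*_; con)

  scale-1+z* : ∀ q f → scale q (1# + z * f) ≈ 1# + κ q * (z * scale q f)
  scale-1+z* q f = begin
    scale q (1# + z * f)             ≈⟨ scale-⊕ q 1# (z * f) ⟩
    scale q 1# + scale q (z * f)     ≈⟨ +-cong (scale-one q) (scale-⊛ q z f) ⟩
    1# + scale q z * scale q f       ≈⟨ +-congˡ (*-congʳ (scale-z q)) ⟩
    1# + κ q * z * scale q f         ≈⟨ +-congˡ (*-assoc (κ q) z (scale q f)) ⟩
    1# + κ q * (z * scale q f)       ∎

  dbl-1+z* : ∀ f → dbl (1# + z * f) ≈ 1# + z * (z * dbl f)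
  dbl-1+z* f = begin
    dbl (1# + z * f)             ≈⟨ dbl-⊕ 1# (z * f) ⟩
    dbl 1# + dbl (z * f)         ≈⟨ +-cong dbl-one (dbl-⊛ z f) ⟩
    1# + dbl z * dbl f           ≈⟨ +-congˡ (*-congʳ dbl-z) ⟩
    1# + z * z * dbl f           ≈⟨ +-congˡ (*-assoc z z (dbl f)) ⟩
    1# + z * (z * dbl f)         ∎

  -- Replacing z by a z multiplies the constant by a and leaves q alone, because the two dilations
  -- commute.
  Carlitz-scale : ∀ a b q {X} → Carlitz (κ b) q X → Carlitz (κ (a R.* b)) q (scale a X)
  Carlitz-scale a b q {X} eq = begin
    scale a X
      ≈⟨ scale-cong a eq ⟩
    scale a (1# + z * (κ b * (X * scale q X)))
      ≈⟨ scale-1+z* a (κ b * (X * scale q X)) ⟩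
    1# + κ a * (z * scale a (κ b * (X * scale q X)))
      ≈⟨ +-congˡ (*-congˡ (*-congˡ (trans (scale-⊛ a (κ b) (X * scale q X))
           (*-cong (scale-κ a b) (trans (scale-⊛ a X (scale q X)) (*-congˡ (scale-scale a q X))))))) ⟩
    1# + κ a * (z * (κ b * (scale a X * scale q (scale a X))))
      ≈⟨ +-congˡ (solve 4 (λ a z b x → a :* (z :* (b :* x)) := z :* ((a :* b) :* x)) refl (κ a) z (κ b) (scale a X * scale q (scale a X))) ⟩
    1# + z * (κ a * κ b * (scale a X * scale q (scale a X)))
      ≈⟨ +-congˡ (*-congˡ (*-congʳ (κ-* a b))) ⟨
    1# + z * (κ (a R.* b) * (scale a X * scale q (scale a X))) ∎

  -- Dilating f(z²) by q dilates f by q². This is where the parameter q² of the continued fraction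
  -- in the theorem comes from.
  Carlitz-dbl : ∀ a q {X} → Carlitz (κ a) (q ^ 2) X → Carlitz (z * κ a) q (dbl X)
  Carlitz-dbl a q {X} eq = begin
    dbl X
      ≈⟨ dbl-cong eq ⟩
    dbl (1# + z * (κ a * (X * scale (q ^ 2) X)))
      ≈⟨ dbl-1+z* (κ a * (X * scale (q ^ 2) X)) ⟩
    1# + z * (z * dbl (κ a * (X * scale (q ^ 2) X)))
      ≈⟨ +-congˡ (*-congˡ (*-congˡ (trans (dbl-⊛ (κ a) (X * scale (q ^ 2) X))
           (*-cong (dbl-κ a) (trans (dbl-⊛ X (scale (q ^ 2) X)) (*-congˡ (sym (scale-dbl q X)))))))) ⟩
    1# + z * (z * (κ a * (dbl X * scale q (dbl X))))
      ≈⟨ +-congˡ (*-congˡ (sym (*-assoc z (κ a) (dbl X * scale q (dbl X))))) ⟩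
    1# + z * (z * κ a * (dbl X * scale q (dbl X))) ∎

  Carlitz-cong : ∀ {a b} q {X} → a ≈ b → Carlitz a q X → Carlitz b q X
  Carlitz-cong q {X} a≈b eq = trans eq (+-congˡ (*-congˡ (*-congʳ {X * scale q X} a≈b)))

  scale-1+κ* : ∀ q t f → scale q (1# + κ t * f) ≈ 1# + κ t * scale q f
  scale-1+κ* q t f = begin
    scale q (1# + κ t * f)            ≈⟨ scale-⊕ q 1# (κ t * f) ⟩
    scale q 1# + scale q (κ t * f)    ≈⟨ +-cong (scale-one q) (scale-⊛ q (κ t) f) ⟩
    1# + scale q (κ t) * scale q f    ≈⟨ +-congˡ (*-congʳ (scale-κ q t)) ⟩
    1# + κ t * scale q f              ∎

  scale-z* : ∀ q f → scale q (z * f) ≈ κ q * (z * scale q f)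
  scale-z* q f = trans (scale-⊛ q z f) (trans (*-congʳ (scale-z q)) (*-assoc (κ q) z (scale q f)))

  scale-κz : ∀ q t f → scale q (1# + κ t * (z * f)) ≈ 1# + κ t * (κ q * (z * scale q f))
  scale-κz q t f = trans (scale-1+κ* q t (z * f)) (+-congˡ (*-congˡ (scale-z* q f)))

  drop-zero : ∀ {s y} w → s ≈ 0# → y + s * w ≈ y
  drop-zero {y = y} w s≈0 = trans (+-congˡ (trans (*-congʳ s≈0) (zeroˡ w))) (+-identityʳ y)

  module _ (q t : R.Carrier) where
    private
      Q = κ q
      τ = κ t
      σ = scale q

    -- Here B is A⁺/z. Inserting Ã = 1 + t z B leaves the linear terms (1 + t) z B, which vanish,
    -- and the quadratic term t q z² B σB.
    13-2-equation : R.1# R.+ t R.≈ R.0# → ∀ {B Ã} → Ã ≈ 1# + τ * (z * B) → B ≈ Ã + (z * B) * σ Ã →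
      Carlitz (z * κ (t R.* q)) q B
    13-2-equation 1+t≈0 {B} {Ã} Ã-eq B-eq = begin
      B
        ≈⟨ B-eq ⟩
      Ã + (z * B) * σ Ã
        ≈⟨ +-cong Ã-eq (*-congˡ (trans (scale-cong q Ã-eq) (scale-κz q t B))) ⟩
      (1# + τ * (z * B)) + (z * B) * (1# + τ * (Q * (z * σ B)))
        ≈⟨ solve 5 (λ z t q b s → (con 1 :+ t :* (z :* b)) :+ (z :* b) :* (con 1 :+ t :* (q :* (z :* s)))
             := (con 1 :+ z :* (z :* (t :* q) :* (b :* s))) :+ (con 1 :+ t) :* (z :* b)) refl z τ Q B (σ B) ⟩
      (1# + z * (z * (τ * Q) * (B * σ B))) + (1# + τ) * (z * B)
        ≈⟨ drop-zero (z * B) (trans (+-congʳ (sym κ1≋one)) (κ-+≈0 1+t≈0)) ⟩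
      1# + z * (z * (τ * Q) * (B * σ B))
        ≈⟨ +-congˡ (*-congˡ (*-congʳ (*-congˡ (sym (κ-* t q))))) ⟩
      1# + z * (z * κ (t R.* q) * (B * σ B)) ∎

    -- Both sides solve X = z H̃ + z q σH̃ X; for z H̃ σG this is the equation of G dilated by q.
    H⁺-equation : ∀ {G H⁺ H̃} → G ≈ 1# + z * (G * H̃) →
      H⁺ ≈ z * (H̃ + Q * (H⁺ * σ H̃)) → H⁺ ≈ z * (H̃ * σ G)
    H⁺-equation {G} {H⁺} {H̃} G-eq H⁺-eq = linear-unique (z * H̃) (Q * σ H̃)
      (trans H⁺-eq (solve 5 (λ z h q p s → z :* (h :+ q :* (p :* s)) := z :* h :+ z :* (q :* s :* p)) refl z H̃ Q H⁺ (σ H̃)))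
      (begin
        z * (H̃ * σ G)
          ≈⟨ *-congˡ (*-congˡ σG-eq) ⟩
        z * (H̃ * (1# + Q * (z * (σ G * σ H̃))))
          ≈⟨ solve 5 (λ z h q g s → z :* (h :* (con 1 :+ q :* (z :* (g :* s)))) := z :* h :+ z :* (q :* s :* (z :* (h :* g)))) refl z H̃ Q (σ G) (σ H̃) ⟩
        z * H̃ + z * (Q * σ H̃ * (z * (H̃ * σ G))) ∎)
      where
      σG-eq : σ G ≈ 1# + Q * (z * (σ G * σ H̃))
      σG-eq = trans (scale-cong q G-eq)
        (trans (scale-1+z* q (G * H̃)) (+-congˡ (*-congˡ (*-congˡ (scale-⊛ q G H̃)))))

    -- Here M is (G - 1)/z. The formula H⁺ = z H̃ σG gives M = G + t z M σG, and inserting G = 1 + z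
    -- M and σG = 1 + q z σM produces the same cancellation as for 13-2.
    31-2-equation : R.1# R.+ t R.≈ R.0# → ∀ {G M H⁺ H̃} → G ≈ 1# + z * M → M ≈ G * H̃ →
      H̃ ≈ 1# + τ * H⁺ → H⁺ ≈ z * (H̃ + Q * (H⁺ * σ H̃)) → Carlitz (z * κ (t R.* q)) q M
    31-2-equation 1+t≈0 {G} {M} {H⁺} {H̃} G-eq M-eq H̃-eq H⁺-eq = begin
      M
        ≈⟨ M-eq ⟩
      G * H̃
        ≈⟨ *-congˡ (trans H̃-eq (+-congˡ (*-congˡ H⁺-eq′))) ⟩
      G * (1# + τ * (z * (H̃ * σ G)))
        ≈⟨ solve 5 (λ g t z h s → g :* (con 1 :+ t :* (z :* (h :* s))) := g :+ t :* (z :* ((g :* h) :* s))) refl G τ z H̃ (σ G) ⟩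
      G + τ * (z * ((G * H̃) * σ G))
        ≈⟨ +-cong G-eq (*-congˡ (*-congˡ (*-cong (sym M-eq) (trans (scale-cong q G-eq) (scale-1+z* q M))))) ⟩
      (1# + z * M) + τ * (z * (M * (1# + Q * (z * σ M))))
        ≈⟨ solve 5 (λ z t q b s → (con 1 :+ z :* b) :+ t :* (z :* (b :* (con 1 :+ q :* (z :* s))))
             := (con 1 :+ z :* (z :* (t :* q) :* (b :* s))) :+ (con 1 :+ t) :* (z :* b)) refl z τ Q M (σ M) ⟩
      (1# + z * (z * (τ * Q) * (M * σ M))) + (1# + τ) * (z * M)
        ≈⟨ drop-zero (z * M) (trans (+-congʳ (sym κ1≋one)) (κ-+≈0 1+t≈0)) ⟩
      1# + z * (z * (τ * Q) * (M * σ M))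
        ≈⟨ +-congˡ (*-congˡ (*-congʳ (*-congˡ (sym (κ-* t q))))) ⟩
      1# + z * (z * κ (t R.* q) * (M * σ M)) ∎
      where
      H⁺-eq′ : H⁺ ≈ z * (H̃ * σ G)
      H⁺-eq′ = H⁺-equation (trans G-eq (+-congˡ (*-congˡ M-eq))) H⁺-eq

    -- By H⁺ = z N with N = H̃ σG, the equation of D becomes D = 1 + t z² D N, so everything hinges
    -- on N = σD. This is the point at which t = -q is forced.
    coderangement-31-2-equation : q R.+ t R.≈ R.0# → ∀ {G H⁺ H̃ D} → G ≈ 1# + z * (G * H̃) →
      H̃ ≈ 1# + τ * H⁺ → H⁺ ≈ z * (H̃ + Q * (H⁺ * σ H̃)) → D ≈ 1# + z * (D * (τ * H⁺)) →
      Carlitz (z * κ t) q D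
    coderangement-31-2-equation q+t≈0 {G} {H⁺} {H̃} {D} G-eq H̃-eq H⁺-eq D-eq =
      trans D-eq′ (+-congˡ (*-congˡ (*-congˡ (*-congˡ N≈σD))))
      where
      N : Series
      N = H̃ * σ G

      H⁺≈zN : H⁺ ≈ z * N
      H⁺≈zN = H⁺-equation G-eq H⁺-eq

      D-eq′ : D ≈ 1# + z * (z * τ * (D * N))
      D-eq′ = trans D-eq (+-congˡ (*-congˡ (trans (*-congˡ (*-congˡ H⁺≈zN))
        (solve 4 (λ d t z n → d :* (t :* (z :* n)) := z :* t :* (d :* n)) refl D τ z N))))

      -- D = G / (1 + z G), stated without a quotient: both sides solve X = (1 + z G) + t z² N X.
      D[1+zG]≈G : D * (1# + z * G) ≈ G
      D[1+zG]≈G = linear-unique (1# + z * G) (z * τ * N)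
        (begin
          D * (1# + z * G)
            ≈⟨ *-congʳ D-eq′ ⟩
          (1# + z * (z * τ * (D * N))) * (1# + z * G)
            ≈⟨ solve 5 (λ z t d n g → (con 1 :+ z :* (z :* t :* (d :* n))) :* (con 1 :+ z :* g)
                 := (con 1 :+ z :* g) :+ z :* (z :* t :* n :* (d :* (con 1 :+ z :* g)))) refl z τ D N G ⟩
          (1# + z * G) + z * (z * τ * N * (D * (1# + z * G))) ∎)
        (begin
          G
            ≈⟨ G-eq ⟩
          1# + z * (G * H̃)
            ≈⟨ +-congˡ (*-congˡ (*-congˡ (trans H̃-eq (+-congˡ (*-congˡ H⁺≈zN))))) ⟩
          1# + z * (G * (1# + τ * (z * N)))
            ≈⟨ solve 4 (λ z t n g → con 1 :+ z :* (g :* (con 1 :+ t :* (z :* n)))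
                 := (con 1 :+ z :* g) :+ z :* (z :* t :* n :* g)) refl z τ N G ⟩
          (1# + z * G) + z * (z * τ * N * G) ∎)

      -- Both solve X = σG + t z σG X. For σD this is the dilated quotient formula σG = σD (1 + q z
      -- σG), whose linear term matches because q + t = 0.
      N≈σD : N ≈ σ D
      N≈σD = linear-unique (σ G) (τ * σ G)
        (begin
          H̃ * σ G
            ≈⟨ *-congʳ (trans H̃-eq (+-congˡ (*-congˡ H⁺≈zN))) ⟩
          (1# + τ * (z * N)) * σ G
            ≈⟨ solve 4 (λ z t n g → (con 1 :+ t :* (z :* n)) :* g := g :+ z :* (t :* g :* n)) refl z τ N (σ G) ⟩
          σ G + z * (τ * σ G * N) ∎)
        (sym (begin
          σ G + z * (τ * σ G * σ D)
            ≈⟨ +-congʳ (trans (scale-cong q (sym D[1+zG]≈G)) (trans (scale-⊛ q D (1# + z * G)) (*-congˡ (scale-1+z* q G)))) ⟩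
          σ D * (1# + Q * (z * σ G)) + z * (τ * σ G * σ D)
            ≈⟨ solve 5 (λ z t d q g → d :* (con 1 :+ q :* (z :* g)) :+ z :* (t :* g :* d)
                 := d :+ (q :+ t) :* (z :* g :* d)) refl z τ (σ D) Q (σ G) ⟩
          σ D + (Q + τ) * (z * σ G * σ D)
            ≈⟨ drop-zero (z * σ G * σ D) (κ-+≈0 q+t≈0) ⟩
          σ D ∎))

    -- Expanding one factor B of t z² B² by its own quadratic equation reproduces the linear
    -- equation of D⁺, with t z² B² in place of D⁺.
    coderangement-13-2-equation : ∀ {B D⁺} → Carlitz (z * κ (t R.* q)) q B →
      D⁺ ≈ z * (τ * (z * B) + D⁺ * σ (τ * (z * B))) → D⁺ ≈ τ * (z * z * (B * B))
    coderangement-13-2-equation {B} {D⁺} B-eq D⁺-eq = linear-unique (τ * (z * z * B)) (z * (τ * Q) * σ B)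
      (begin
        D⁺
          ≈⟨ D⁺-eq ⟩
        z * (τ * (z * B) + D⁺ * σ (τ * (z * B)))
          ≈⟨ *-congˡ (+-congˡ (*-congˡ (trans (scale-⊛ q τ (z * B)) (*-cong (scale-κ q t) (scale-z* q B))))) ⟩
        z * (τ * (z * B) + D⁺ * (τ * (Q * (z * σ B))))
          ≈⟨ solve 6 (λ z t b d q s → z :* (t :* (z :* b) :+ d :* (t :* (q :* (z :* s))))
               := t :* (z :* z :* b) :+ z :* (z :* (t :* q) :* s :* d)) refl z τ B D⁺ Q (σ B) ⟩
        τ * (z * z * B) + z * (z * (τ * Q) * σ B * D⁺) ∎)
      (begin
        τ * (z * z * (B * B))
          ≈⟨ *-congˡ (*-congˡ (*-congˡ (trans B-eq (+-congˡ (*-congˡ (*-congʳ (*-congˡ (κ-* t q)))))))) ⟩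
        τ * (z * z * (B * (1# + z * (z * (τ * Q) * (B * σ B)))))
          ≈⟨ solve 5 (λ z t b q s → t :* (z :* z :* (b :* (con 1 :+ z :* (z :* (t :* q) :* (b :* s)))))
               := t :* (z :* z :* b) :+ z :* (z :* (t :* q) :* s :* (t :* (z :* z :* (b :* b))))) refl z τ B Q (σ B) ⟩
        τ * (z * z * B) + z * (z * (τ * Q) * σ B * (τ * (z * z * (B * B)))) ∎)

  module _ (q : R.Carrier) where
    private
      Q = κ q
      σ = scale q

    -- T⁺ stands for the series of nonempty up-down words, and z `dbl (odds T⁺)` for its odd part.
    -- The three summands belong to the one-letter word, to an empty R, and to a nonempty R.
    module Alternating {T⁺ : Series}
      (T⁺-eq : T⁺ ≈ z * (1# + (z * dbl (odds T⁺) + σ (z * dbl (odds T⁺)) * T⁺)))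
      where

      o u⁺ : Series
      o  = odds T⁺
      u⁺ = evens T⁺

      σ′ : Series → Series
      σ′ = scale (q ^ 2)

      evenPart oddPart : Series
      evenPart = z * (o + Q * σ′ o * u⁺)
      oddPart  = 1# + z * (Q * (o * σ′ o))

      -- Splitting the remaining T⁺ on the right by parity as well lets every term be written as a
      -- series in z² or as z times such a series.
      T⁺-parts : dbl u⁺ + z * dbl o ≈ dbl evenPart + z * dbl oddPart
      T⁺-parts = begin
        dbl u⁺ + z * dbl o
          ≈⟨ dbl-parts T⁺ ⟨
        T⁺
          ≈⟨ T⁺-eq ⟩
        z * (1# + (z * dbl o + σ (z * dbl o) * T⁺))
          ≈⟨ *-congˡ (+-congˡ (+-congˡ (*-cong (trans (scale-z* q (dbl o)) (*-congˡ (*-congˡ (scale-dbl q o)))) (dbl-parts T⁺)))) ⟩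
        z * (1# + (z * dbl o + Q * (z * dbl (σ′ o)) * (dbl u⁺ + z * dbl o)))
          ≈⟨ solve 5 (λ z o q s u → z :* (con 1 :+ (z :* o :+ q :* (z :* s) :* (u :+ z :* o)))
               := z :* z :* (o :+ q :* s :* u) :+ z :* (con 1 :+ z :* (z :* (q :* (o :* s))))) refl z (dbl o) Q (dbl (σ′ o)) (dbl u⁺) ⟩
        z * z * (dbl o + Q * dbl (σ′ o) * dbl u⁺) + z * (1# + z * (z * (Q * (dbl o * dbl (σ′ o)))))
          ≈⟨ +-cong even-eq (*-congˡ odd-eq) ⟨
        dbl evenPart + z * dbl oddPart ∎
        where
        even-eq : dbl evenPart ≈ z * z * (dbl o + Q * dbl (σ′ o) * dbl u⁺)
        even-eq = trans (dbl-⊛ z (o + Q * σ′ o * u⁺)) (*-cong dbl-z (trans (dbl-⊕ o (Q * σ′ o * u⁺))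
          (+-congˡ (trans (dbl-⊛ (Q * σ′ o) u⁺) (*-congʳ (trans (dbl-⊛ Q (σ′ o)) (*-congʳ (dbl-κ q))))))))
        odd-eq : dbl oddPart ≈ 1# + z * (z * (Q * (dbl o * dbl (σ′ o))))
        odd-eq = trans (dbl-1+z* (Q * (o * σ′ o))) (+-congˡ (*-congˡ (*-congˡ
          (trans (dbl-⊛ Q (o * σ′ o)) (*-cong (dbl-κ q) (dbl-⊛ o (σ′ o)))))))

      u⁺-eq : u⁺ ≈ evenPart
      u⁺-eq m = R.trans (R.sym (dbl⊕z-even u⁺ o m)) (R.trans (T⁺-parts (m ℕ.* 2)) (dbl⊕z-even evenPart oddPart m))

      o-Carlitz : Carlitz Q (q ^ 2) o
      o-Carlitz m = R.trans (R.sym (dbl⊕z-odd u⁺ o m)) (R.trans (T⁺-parts (suc (m ℕ.* 2))) (dbl⊕z-odd evenPart oddPart m))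

      -- The device used for D⁺ again: expanding one factor o of z o² by its Carlitz equation yields
      -- the linear equation of u⁺. This parallel is why coderangements and up-down words match.
      u⁺≈zo² : u⁺ ≈ z * (o * o)
      u⁺≈zo² = linear-unique (z * o) (Q * σ′ o)
        (trans u⁺-eq (distribˡ z o (Q * σ′ o * u⁺)))
        (trans (*-congˡ (*-congˡ o-Carlitz))
          (solve 4 (λ z o q s → z :* (o :* (con 1 :+ z :* (q :* (o :* s)))) := z :* o :+ z :* (q :* s :* (z :* (o :* o)))) refl z o Q (σ′ o)))

      -- The equation of o has constant q and parameter q²; dilating by t and passing to z² turns it
      -- into the equation of B, so B = o(t z²). Then t z² B² is z o² evaluated at t z².
      coderangements≈alternating : ∀ {t B D⁺} → Carlitz (z * κ (t R.* q)) q B → D⁺ ≈ κ t * (z * z * (B * B)) → D⁺ ≈ dbl (scale t u⁺)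
      coderangements≈alternating {t} {B} {D⁺} B-eq D⁺-eq = begin
        D⁺
          ≈⟨ D⁺-eq ⟩
        κ t * (z * z * (B * B))
          ≈⟨ *-congˡ (*-congˡ (*-cong B≈ B≈)) ⟩
        κ t * (z * z * (dbl b * dbl b))
          ≈⟨ *-cong (dbl-κ t) (*-cong dbl-z (dbl-⊛ b b)) ⟨
        dbl (κ t) * (dbl z * dbl (b * b))
          ≈⟨ *-congˡ (dbl-⊛ z (b * b)) ⟨
        dbl (κ t) * dbl (z * (b * b))
          ≈⟨ dbl-⊛ (κ t) (z * (b * b)) ⟨
        dbl (κ t * (z * (b * b)))
          ≈⟨ dbl-cong (trans (scale-z* t (o * o)) (*-congˡ (*-congˡ (scale-⊛ t o o)))) ⟨
        dbl (scale t (z * (o * o)))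
          ≈⟨ dbl-cong (scale-cong t u⁺≈zo²) ⟨
        dbl (scale t u⁺) ∎
        where
        b : Series
        b = scale t o
        B≈ : B ≈ dbl b
        B≈ = Carlitz-unique (z * κ (t R.* q)) q B-eq (Carlitz-dbl (t R.* q) q (Carlitz-scale t q (q ^ 2) o-Carlitz))

-- Continued fractions

data Parity : ℕ → Set where
  even : ∀ m → Parity (m ℕ.* 2)
  odd  : ∀ m → Parity (suc (m ℕ.* 2))

parity : ∀ n → Parity n
parity zero = even 0
parity (suc n) with parity n
... | even m = odd m
... | odd m  = even (suc m)

2∤odd : ∀ m → ¬ (2 ∣ suc (m ℕ.* 2))
2∤odd zero    (divides zero    ())
2∤odd zero    (divides (suc _) ())
2∤odd (suc m) (divides (suc k) eq) = 2∤odd m (divides k (ℕₚ.suc-injective (ℕₚ.suc-injective eq)))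

ifEven-even : ∀ {a} {A : Set a} m (x y : A) → (ifEven m ℕ.* 2 then x else y) ≡ x
ifEven-even m x y rewrite dec-true (2 ∣? (m ℕ.* 2)) (n∣m*n m) = ≡.refl

ifEven-odd : ∀ {a} {A : Set a} m (x y : A) → (ifEven suc (m ℕ.* 2) then x else y) ≡ y
ifEven-odd m x y rewrite dec-false (2 ∣? suc (m ℕ.* 2)) (2∤odd m) = ≡.refl

[1+m*2]/2≡m : ∀ m → suc (m ℕ.* 2) / 2 ≡ m
[1+m*2]/2≡m zero    = ≡.refl
[1+m*2]/2≡m (suc m) = ≡.trans (m/n≡1+[m∸n]/n {3 ℕ.+ m ℕ.* 2} {2} (s≤s (s≤s z≤n))) (≡.cong suc ([1+m*2]/2≡m m))

module ContinuedFraction {c ℓ} (R : CommutativeRing c ℓ) where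
  open CommutativeRing R hiding (zero)
  open InRing R
  open PowerSeries R
  private
    module Exp = Algebra.Properties.Semiring.Exp semiring
  open Algebra.Properties.Ring ring using (-‿distribˡ-*; -‿involutive)
  open Relation.Binary.Reasoning.Setoid setoid

  dot≈⊛ : ∀ f g n → dot f (recipCoeffs g n) ≈ (f ⊛ recip g) n
  dot≈⊛ f g zero    = +-identityʳ _
  dot≈⊛ f g (suc n) = +-congˡ (dot≈⊛ (f ∘′ suc) g n)

  -- The identity E = 1 + a z F E for E = 1/(1 - a z F), read off at z to the power n + 1.
  recip-suc : ∀ a F n → recip (1- a z· F) (suc n) ≈ a * (F ⊛ recip (1- a z· F)) n
  recip-suc a F n = begin
    - dot ((1- a z· F) ∘′ suc) (recipCoeffs (1- a z· F) n)
      ≈⟨ -‿cong (dot≈⊛ ((1- a z· F) ∘′ suc) (1- a z· F) n) ⟩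
    - ((λ i → - (a * F i)) ⊛ recip (1- a z· F)) n
      ≈⟨ -‿cong (⊛-cong (λ i → -‿distribˡ-* a (F i)) (λ _ → refl) n) ⟩
    - ((λ i → - a * F i) ⊛ recip (1- a z· F)) n
      ≈⟨ -‿cong (⊛-scalarˡ (- a) F _ n) ⟩
    - (- a * (F ⊛ recip (1- a z· F)) n)
      ≈⟨ -‿distribˡ-* _ _ ⟩
    - - a * (F ⊛ recip (1- a z· F)) n
      ≈⟨ *-congʳ (-‿involutive a) ⟩
    a * (F ⊛ recip (1- a z· F)) n ∎

  convergent-shift : ∀ c N j → convergent c N (suc j) ≡ convergent (c ∘′ suc) N j
  convergent-shift c zero    j = ≡.refl
  convergent-shift c (suc N) j = ≡.cong (λ F → recip (1- c (suc j) z· F)) (convergent-shift c N (suc j))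

  -- One level of the fraction is unfolded; what remains below it is the fraction of the shifted
  -- sequence. The finite depths occurring here suffice for all coefficients up to n, so stability
  -- replaces them by the limits.
  continuedFraction-suc : ∀ c n → continuedFraction c (suc n)
    ≈ c 1 * (continuedFraction (c ∘′ suc) ⊛ continuedFraction c) n
  continuedFraction-suc c n = trans (recip-suc (c 1) (convergent c n 2) n)
    (*-congˡ (⊛-cong-≤ n
      (λ m m≤n → trans (reflexive (≡.cong (λ F → F m) (convergent-shift c n 1)))
        (convergent-stable (c ∘′ suc) m n m≤n))
      (λ m m≤n → convergent-stable c m (suc n) (ℕₚ.m≤n⇒m≤1+n m≤n))))

  -- Each cⱼ comes with one z, so multiplying all of them by q is the dilation of z by q. Indices
  -- start at 1 because the value at 0 is only a filler.
  continuedFraction-scale : ∀ q n c d → (∀ j → d (suc j) ≈ q * c (suc j)) →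
    continuedFraction d n ≈ scale q (continuedFraction c) n
  continuedFraction-scale q n c d d≈qc = upTo-n n n ℕₚ.≤-refl c d d≈qc
    where
    -- The unfolded product involves all coefficients up to m, of the fraction and of its tail, so
    -- the induction runs on a bound and not on m.
    upTo-n : ∀ n m → m ≤ n → ∀ c d → (∀ j → d (suc j) ≈ q * c (suc j)) →
      continuedFraction d m ≈ scale q (continuedFraction c) m
    upTo-n n       zero    m≤n       c d d≈qc = sym (*-identityˡ _)
    upTo-n (suc n) (suc m) (s≤s m≤n) c d d≈qc = begin
      continuedFraction d (suc m)
        ≈⟨ continuedFraction-suc d m ⟩
      d 1 * (continuedFraction (d ∘′ suc) ⊛ continuedFraction d) m
        ≈⟨ *-cong (d≈qc 0) (⊛-cong-≤ m
             (λ i i≤m → upTo-n n i (ℕₚ.≤-trans i≤m m≤n) (c ∘′ suc) (d ∘′ suc) (λ j → d≈qc (suc j)))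
             (λ i i≤m → upTo-n n i (ℕₚ.≤-trans i≤m m≤n) c d d≈qc)) ⟩
      q * c 1 * (scale q (continuedFraction (c ∘′ suc)) ⊛ scale q (continuedFraction c)) m
        ≈⟨ *-congˡ (scale-⊛ q _ _ m) ⟨
      q * c 1 * (q ^ m * (continuedFraction (c ∘′ suc) ⊛ continuedFraction c) m)
        ≈⟨ RS.solve 4 (λ q c p x → q :* c :* (p :* x) := q :* p :* (c :* x)) refl _ _ _ _ ⟩
      q * q ^ m * (c 1 * (continuedFraction (c ∘′ suc) ⊛ continuedFraction c) m)
        ≈⟨ *-congˡ (continuedFraction-suc c m) ⟨
      scale q (continuedFraction c) (suc m) ∎
      where
      module RS = Algebra.Solver.Ring.NaturalCoefficients.Default commutativeSemiring
      open RS using (_:=_; _:*_)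

  cfCoeff-power : ∀ q j → cfCoeff q (q ^ 2) (suc j) ≈ q ^ j
  cfCoeff-power q j with parity j
  ... | even m = begin
    cfCoeff q (q ^ 2) (suc (m ℕ.* 2))  ≡⟨ ifEven-odd m _ _ ⟩
    (q ^ 2) ^ ((m ℕ.* 2) / 2)          ≡⟨ ≡.cong ((q ^ 2) ^_) (m*n/n≡m m 2) ⟩
    (q ^ 2) ^ m                        ≈⟨ Exp.^-assocʳ q 2 m ⟩
    q ^ (2 ℕ.* m)                      ≡⟨ ≡.cong (q ^_) (ℕₚ.*-comm 2 m) ⟩
    q ^ (m ℕ.* 2)                      ∎
  ... | odd m = begin
    cfCoeff q (q ^ 2) (suc m ℕ.* 2)          ≡⟨ ifEven-even (suc m) _ _ ⟩
    q * (q ^ 2) ^ (suc (m ℕ.* 2) / 2)        ≡⟨ ≡.cong (λ k → q * (q ^ 2) ^ k) ([1+m*2]/2≡m m) ⟩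
    q * (q ^ 2) ^ m                          ≈⟨ *-congˡ (Exp.^-assocʳ q 2 m) ⟩
    q * q ^ (2 ℕ.* m)                        ≡⟨ ≡.cong (λ k → q * q ^ k) (ℕₚ.*-comm 2 m) ⟩
    q ^ suc (m ℕ.* 2)                        ∎

  -- The coefficients of the fraction form a geometric sequence, so shifting them multiplies each by
  -- q: the tail of the fraction is the fraction itself at q z.
  C-Carlitz : ∀ q → Carlitz (κ 1#) q (λ n → C n q)
  C-Carlitz q zero    = sym (trans (+-congˡ (z⊛-zero rhs)) (+-identityʳ _))
    where
    rhs : Series
    rhs = κ 1# ⊛ ((λ n → C n q) ⊛ scale q (λ n → C n q))
  C-Carlitz q (suc n) = begin
    C (suc n) q
      ≈⟨ continuedFraction-suc (cfCoeff q (q ^ 2)) n ⟩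
    1# * (continuedFraction (cfCoeff q (q ^ 2) ∘′ suc) ⊛ (λ n → C n q)) n
      ≈⟨ *-congˡ (⊛-cong (λ i → continuedFraction-scale q i (cfCoeff q (q ^ 2)) (cfCoeff q (q ^ 2) ∘′ suc)
           (λ j → trans (cfCoeff-power q (suc j)) (*-congˡ (sym (cfCoeff-power q j))))) (λ _ → refl) n) ⟩
    1# * (scale q (λ n → C n q) ⊛ (λ n → C n q)) n
      ≈⟨ *-congˡ (⊛-comm (scale q (λ n → C n q)) (λ n → C n q) n) ⟩
    1# * ((λ n → C n q) ⊛ scale q (λ n → C n q)) n
      ≈⟨ κ⊛ 1# ((λ n → C n q) ⊛ scale q (λ n → C n q)) n ⟨
    (κ 1# ⊛ ((λ n → C n q) ⊛ scale q (λ n → C n q))) n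
      ≈⟨ z⊛-suc _ n ⟨
    (z ⊛ (κ 1# ⊛ ((λ n → C n q) ⊛ scale q (λ n → C n q)))) (suc n)
      ≈⟨ +-identityˡ _ ⟨
    0# + (z ⊛ (κ 1# ⊛ ((λ n → C n q) ⊛ scale q (λ n → C n q)))) (suc n) ∎

open ≡ using (refl)

-- Permutations of intervals

-- The tail is again an interval, with a larger start; the recursion of `separate` relies on this.
range : ℕ → ℕ → List ℕ
range a zero    = []
range a (suc n) = a ∷ range (suc a) n

map-+-upTo : ∀ a n → map (a ℕ.+_) (upTo n) ≡ range a n
map-+-upTo a n = ≡.trans (Listₚ.map-upTo (a ℕ.+_) n) (go n (a ℕ.+_) a λ _ → refl)
  where
  go : ∀ n f a → (∀ i → f i ≡ a ℕ.+ i) → applyUpTo f n ≡ range a n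
  go zero    f a eq = refl
  go (suc n) f a eq = ≡.cong₂ _∷_ (≡.trans (eq 0) (ℕₚ.+-identityʳ a))
    (go n (f ∘ suc) (suc a) λ i → ≡.trans (eq (suc i)) (ℕₚ.+-suc a i))

upTo≡range : ∀ n → upTo n ≡ range 0 n
upTo≡range n = ≡.trans (≡.sym (Listₚ.map-id (upTo n))) (map-+-upTo 0 n)

length-range : ∀ a n → length (range a n) ≡ n
length-range a zero    = refl
length-range a (suc n) = ≡.cong suc (length-range (suc a) n)

∈-range⇒≥ : ∀ {x} a n → x ∈ range a n → a ≤ x
∈-range⇒≥ a (suc n) (here refl) = ℕₚ.≤-refl
∈-range⇒≥ a (suc n) (there x∈)  = ℕₚ.<⇒≤ (∈-range⇒≥ (suc a) n x∈)

range-++ : ∀ a k m → range a k ++ range (a ℕ.+ k) m ≡ range a (k ℕ.+ m)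
range-++ a zero    m = ≡.cong (λ b → range b m) (ℕₚ.+-identityʳ a)
range-++ a (suc k) m = ≡.cong (a ∷_)
  (≡.trans (≡.cong (λ b → range (suc a) k ++ range b m) (ℕₚ.+-suc a k)) (range-++ (suc a) k m))

upTo-suc-↭ : ∀ n → upTo (suc n) ↭ n ∷ upTo n
upTo-suc-↭ n = ↭-trans (↭-reflexive (≡.sym (Listₚ.upTo-∷ʳ n)))
  (↭-trans (shift n (upTo n) []) (prep n (↭-reflexive (Listₚ.++-identityʳ (upTo n)))))

-- The least value a occurs in L as soon as L is nonempty; remove it and recurse.
separate : ∀ n a L R → L ++ R ↭ range a n → (∀ {x y} → x ∈ L → y ∈ R → ¬ (y < x)) →
  ∀ k → length L ≡ k → L ↭ range a k × R ↭ range (a ℕ.+ k) (length R)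
separate n a [] R R↭ L≤R zero refl = ↭-refl ,
  ↭-trans R↭ (↭-reflexive (≡.cong₂ range (≡.sym (ℕₚ.+-identityʳ a))
    (≡.trans (≡.sym (length-range a n)) (≡.sym (↭-length R↭)))))
separate zero a (x ∷ L) R L++R↭ L≤R k eq with () ← ↭-empty-inv L++R↭
separate (suc n) a (x ∷ L) R L++R↭ L≤R (suc k) eq =
  let a∈L = least (∈-++⁻ (x ∷ L) (∈-resp-↭ (↭-sym L++R↭) (here refl)))
      L₁ , L₂ , x∷L≡ = ∈-∃++ a∈L
      x∷L↭ : x ∷ L ↭ a ∷ L₁ ++ L₂
      x∷L↭ = ↭-trans (↭-reflexive x∷L≡) (shift a L₁ L₂)
      L′↭ , R↭ = separate n (suc a) (L₁ ++ L₂) R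
        (drop-∷ (↭-trans (↭-sym (++⁺ x∷L↭ ↭-refl)) L++R↭))
        (λ u∈ → L≤R (∈-resp-↭ (↭-sym x∷L↭) (there u∈)))
        k (ℕₚ.suc-injective (≡.trans (≡.sym (↭-length x∷L↭)) eq))
  in ↭-trans x∷L↭ (prep a L′↭) ,
     ↭-trans R↭ (↭-reflexive (≡.cong (λ b → range b (length R)) (≡.sym (ℕₚ.+-suc a k))))
  where
  least : a ∈ x ∷ L ⊎ a ∈ R → a ∈ x ∷ L
  least (inj₁ a∈L) = a∈L
  -- If a lies in R, the head x of L is not above a, and no letter is below a; hence x = a.
  least (inj₂ a∈R) = here (ℕₚ.≤-antisym (∈-range⇒≥ a (suc n) (∈-resp-↭ L++R↭ (here refl)))
    (ℕₚ.≮⇒≥ (L≤R (here refl) a∈R)))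

-- Pattern avoidance

⊆-++⁻ : ∀ {A : Set} (ys : List A) {xs zs} → xs ⊆ ys ++ zs →
  ∃₂ λ xs₁ xs₂ → xs ≡ xs₁ ++ xs₂ × xs₁ ⊆ ys × xs₂ ⊆ zs
⊆-++⁻ []       p          = [] , _ , refl , [] , p
⊆-++⁻ (y ∷ ys) (.y ∷ʳ p)  with xs₁ , xs₂ , eq , p₁ , p₂ ← ⊆-++⁻ ys p = xs₁ , xs₂ , eq , y ∷ʳ p₁ , p₂
⊆-++⁻ (y ∷ ys) (refl ∷ p) with xs₁ , xs₂ , refl , p₁ , p₂ ← ⊆-++⁻ ys p = y ∷ xs₁ , xs₂ , refl , refl ∷ p₁ , p₂

⊆-map⁻ : ∀ {A B : Set} (f : A → B) ys {xs} → xs ⊆ map f ys → ∃ λ xs′ → xs ≡ map f xs′ × xs′ ⊆ ys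
⊆-map⁻ f []       []         = [] , refl , []
⊆-map⁻ f (y ∷ ys) (._ ∷ʳ p)  with xs′ , eq , p′ ← ⊆-map⁻ f ys p = xs′ , eq , y ∷ʳ p′
⊆-map⁻ f (y ∷ ys) (refl ∷ p) with xs′ , refl , p′ ← ⊆-map⁻ f ys p = y ∷ xs′ , refl , refl ∷ p′

-- The patterns 231 and 132 have their largest letter in the middle and differ
-- in the relation ◁ between the outer letters.
Avoids : (ℕ → ℕ → Set) → List ℕ → Set
Avoids _◁_ w = ∀ {x y z} → x ∷ y ∷ z ∷ [] ⊆ w → x < y → z < y → ¬ (x ◁ z)

-- The middle letter of a forbidden triple is its largest, so n can only stand in the middle. Any
-- triple that is not contained in one part then has its outer letters on different sides of n.
Avoids-++-max : ∀ {_◁_ n L R} → (∀ {x} → x ∈ L → x < n) → (∀ {x} → x ∈ R → x < n) →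
  Avoids _◁_ L → Avoids _◁_ R → (∀ {x z} → x ∈ L → z ∈ R → ¬ (x ◁ z)) → Avoids _◁_ (L ++ n ∷ R)
Avoids-++-max {_◁_} {n} {L} {R} L<n R<n avL avR cross p with ⊆-++⁻ L p
... | [] , _ , refl , _ , (._ ∷ʳ q) = avR q
... | [] , _ , refl , _ , (refl ∷ q) = λ n<y _ → contradiction n<y (ℕₚ.<⇒≯ (R<n (Sublist.lookup q (here refl))))
... | _ ∷ [] , _ , refl , p₁ , (._ ∷ʳ q) = λ _ _ → cross (Sublist.lookup p₁ (here refl)) (Sublist.lookup q (there (here refl)))
... | _ ∷ [] , _ , refl , p₁ , (refl ∷ q) = λ _ _ → cross (Sublist.lookup p₁ (here refl)) (Sublist.lookup q (here refl))
... | _ ∷ _ ∷ [] , _ , refl , p₁ , (._ ∷ʳ q) = λ _ _ → cross (Sublist.lookup p₁ (here refl)) (Sublist.lookup q (here refl))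
... | _ ∷ _ ∷ [] , _ , refl , p₁ , (refl ∷ q) = λ _ n<y → contradiction n<y (ℕₚ.<⇒≯ (L<n (Sublist.lookup p₁ (there (here refl)))))
... | _ ∷ _ ∷ _ ∷ [] , _ , refl , p₁ , _ = avL p₁

-- Cutting at the maximum

glue : ℕ → ℕ → ℕ → List ℕ → List ℕ → List ℕ
glue a b n L R = map (a ℕ.+_) L ++ n ∷ map (b ℕ.+_) R

++∷-injective : ∀ {n : ℕ} xs xs′ {ys ys′} → n ∉ xs → n ∉ xs′ →
  xs ++ n ∷ ys ≡ xs′ ++ n ∷ ys′ → xs ≡ xs′ × ys ≡ ys′
++∷-injective []       []         n∉xs n∉xs′ eq = refl , Listₚ.∷-injectiveʳ eq
++∷-injective []       (x′ ∷ xs′) n∉xs n∉xs′ eq = contradiction (here (Listₚ.∷-injectiveˡ eq)) n∉xs′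
++∷-injective (x ∷ xs) []         n∉xs n∉xs′ eq = contradiction (here (≡.sym (Listₚ.∷-injectiveˡ eq))) n∉xs
++∷-injective (x ∷ xs) (x′ ∷ xs′) n∉xs n∉xs′ eq
  with refl , eq′ ← Listₚ.∷-injective eq
  with refl , eq″ ← ++∷-injective xs xs′ (n∉xs ∘ there) (n∉xs′ ∘ there) eq′ = refl , eq″

antidiagonal : ℕ → List (ℕ × ℕ)
antidiagonal zero    = (0 , 0) ∷ []
antidiagonal (suc n) = (0 , suc n) ∷ map (map₁ suc) (antidiagonal n)

∈-antidiagonal⁺ : ∀ k m → (k , m) ∈ antidiagonal (k ℕ.+ m)
∈-antidiagonal⁺ zero    zero    = here refl
∈-antidiagonal⁺ zero    (suc m) = here refl
∈-antidiagonal⁺ (suc k) m       = there (∈-map⁺ (map₁ suc) (∈-antidiagonal⁺ k m))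

∈-antidiagonal⁻ : ∀ n {k m} → (k , m) ∈ antidiagonal n → k ℕ.+ m ≡ n
∈-antidiagonal⁻ zero    (here refl) = refl
∈-antidiagonal⁻ (suc n) (here refl) = refl
∈-antidiagonal⁻ (suc n) (there p) with _ , q , refl ← ∈-map⁻ (map₁ suc) p = ≡.cong suc (∈-antidiagonal⁻ n q)

antidiagonal-unique : ∀ n → Unique (antidiagonal n)
antidiagonal-unique zero    = [] ∷ []
antidiagonal-unique (suc n) =
  All.tabulate (λ p → λ { refl → case-map (∈-map⁻ (map₁ suc) p) }) ∷
  Uniqueₚ.map⁺ (λ { refl → refl }) (antidiagonal-unique n)
  where
  case-map : ¬ (∃ λ km → km ∈ antidiagonal n × (0 , suc n) ≡ map₁ suc km)
  case-map (_ , _ , ())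

concatMap-unique : ∀ {A B : Set} {f : A → List B} {xs} → Unique xs → (∀ {x} → x ∈ xs → Unique (f x)) →
  (∀ {x y v} → x ∈ xs → y ∈ xs → v ∈ f x → v ∈ f y → x ≡ y) → Unique (concatMap f xs)
concatMap-unique {xs = []}     []         uf disj = []
concatMap-unique {f = f} {xs = x ∷ xs} (x∉ ∷ u) uf disj = Uniqueₚ.++⁺ (uf (here refl))
  (concatMap-unique u (uf ∘ there) (λ p q → disj (there p) (there q)))
  (λ (v∈fx , v∈) → let y , y∈xs , v∈fy = find (∈-concatMap⁻ f v∈) in
    All.lookup x∉ y∈xs (disj (here refl) (there y∈xs) v∈fx v∈fy))

-- Treats both patterns at once. In a word of k letters, the maximum and m letters, `left k m` and
-- `right k m` are the shifts that move the two parts to complementary intervals of values: 0 and k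
-- for 231, m and 0 for 132. `◁-split` says that avoidance across the maximum forces these shifts.
record Separation : Set₁ where
  field
    _◁_ : ℕ → ℕ → Set
    ◁-+ : ∀ a {x y} → x ◁ y → (a ℕ.+ x) ◁ (a ℕ.+ y)
    ◁-+⁻ : ∀ a {x y} → (a ℕ.+ x) ◁ (a ℕ.+ y) → x ◁ y
    left right : ℕ → ℕ → ℕ
    ◁-cross : ∀ {k m x y} → x < k → y < m → ¬ ((left k m ℕ.+ x) ◁ (right k m ℕ.+ y))
    ◁-join  : ∀ k m → map (left k m ℕ.+_) (upTo k) ++ map (right k m ℕ.+_) (upTo m) ↭ upTo (k ℕ.+ m)
    ◁-split : ∀ {n} L R → L ++ R ↭ upTo n → (∀ {x y} → x ∈ L → y ∈ R → ¬ (x ◁ y)) →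
      L ↭ map (left (length L) (length R) ℕ.+_) (upTo (length L)) ×
      R ↭ map (right (length L) (length R) ℕ.+_) (upTo (length R))

separation231 : Separation
separation231 = record
  { _◁_ = _>_
  ; ◁-+ = λ a → ℕₚ.+-monoʳ-< a
  ; ◁-+⁻ = λ a → ℕₚ.+-cancelˡ-< a _ _
  ; left = λ k m → 0
  ; right = λ k m → k
  ; ◁-cross = λ x<k y<m k+y<x → ℕₚ.<-irrefl refl (ℕₚ.<-trans (ℕₚ.≤-<-trans (ℕₚ.m≤m+n _ _) k+y<x) x<k)
  ; ◁-join = λ k m → ↭-reflexive (≡.trans (≡.cong₂ _++_ (map-+-upTo 0 k) (map-+-upTo k m))
      (≡.trans (range-++ 0 k m) (≡.sym (upTo≡range (k ℕ.+ m)))))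
  ; ◁-split = λ {n} L R p L≤R →
      let L↭ , R↭ = separate n 0 L R (↭-trans p (↭-reflexive (upTo≡range n))) L≤R (length L) refl
      in ↭-trans L↭ (↭-reflexive (≡.sym (map-+-upTo 0 _))) , ↭-trans R↭ (↭-reflexive (≡.sym (map-+-upTo _ _)))
  }

separation132 : Separation
separation132 = record
  { _◁_ = _<_
  ; ◁-+ = λ a → ℕₚ.+-monoʳ-< a
  ; ◁-+⁻ = λ a → ℕₚ.+-cancelˡ-< a _ _
  ; left = λ k m → m
  ; right = λ k m → 0
  ; ◁-cross = λ x<k y<m m+x<y → ℕₚ.<-irrefl refl (ℕₚ.<-trans (ℕₚ.≤-<-trans (ℕₚ.m≤m+n _ _) m+x<y) y<m)
  ; ◁-join = λ k m → ↭-trans (++-comm (map (m ℕ.+_) (upTo k)) _)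
      (↭-reflexive (≡.trans (≡.cong₂ _++_ (map-+-upTo 0 m) (map-+-upTo m k))
        (≡.trans (range-++ 0 m k) (≡.trans (≡.cong (range 0) (ℕₚ.+-comm m k)) (≡.sym (upTo≡range (k ℕ.+ m)))))))
  ; ◁-split = λ {n} L R p R≤L →
      let R↭ , L↭ = separate n 0 R L (↭-trans (++-comm R L) (↭-trans p (↭-reflexive (upTo≡range n))))
                      (λ x∈R y∈L → R≤L y∈L x∈R) (length R) refl
      in ↭-trans L↭ (↭-reflexive (≡.sym (map-+-upTo _ _))) , ↭-trans R↭ (↭-reflexive (≡.sym (map-+-upTo 0 _)))
  }

module Decomposition (S : Separation) where
  open Separation S

  -- Lists of numbers replace `Word`, since the parts of a word, cut and shifted, would otherwise
  -- change their type.
  Good : ℕ → List ℕ → Set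
  Good n w = w ↭ upTo n × Avoids _◁_ w

  Good-< : ∀ {n w x} → Good n w → x ∈ w → x < n
  Good-< (w↭ , _) x∈w = ∈-upTo⁻ (∈-resp-↭ w↭ x∈w)

  Good-length : ∀ {n w} → Good n w → length w ≡ n
  Good-length {n} (w↭ , _) = ≡.trans (↭-length w↭) (Listₚ.length-upTo n)

  join : ℕ → ℕ → List ℕ → List ℕ → List ℕ
  join k m = glue (left k m) (right k m) (k ℕ.+ m)

  Avoids-map⁺ : ∀ a {w} → Avoids _◁_ w → Avoids _◁_ (map (a ℕ.+_) w)
  Avoids-map⁺ a {w} av p with ⊆-map⁻ (a ℕ.+_) w p
  ... | _ ∷ _ ∷ _ ∷ [] , refl , q = λ x<y z<y x◁z →
    av q (ℕₚ.+-cancelˡ-< a _ _ x<y) (ℕₚ.+-cancelˡ-< a _ _ z<y) (◁-+⁻ a x◁z)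

  Avoids-map⁻ : ∀ a {w} → Avoids _◁_ (map (a ℕ.+_) w) → Avoids _◁_ w
  Avoids-map⁻ a av p x<y z<y x◁z =
    av (⊆-map⁺ (a ℕ.+_) p) (ℕₚ.+-monoʳ-< a x<y) (ℕₚ.+-monoʳ-< a z<y) (◁-+ a x◁z)

  join-parts-↭ : ∀ {k m L R} → Good k L → Good m R →
    map (left k m ℕ.+_) L ++ map (right k m ℕ.+_) R ↭ upTo (k ℕ.+ m)
  join-parts-↭ {k} {m} (L↭ , _) (R↭ , _) =
    ↭-trans (++⁺ (↭-map⁺ _ L↭) (↭-map⁺ _ R↭)) (◁-join k m)

  left-< : ∀ {k m L R x} → Good k L → Good m R → x ∈ map (left k m ℕ.+_) L → x < k ℕ.+ m
  left-< gL gR x∈ = ∈-upTo⁻ (∈-resp-↭ (join-parts-↭ gL gR) (∈-++⁺ˡ x∈))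

  right-< : ∀ {k m L R x} → Good k L → Good m R → x ∈ map (right k m ℕ.+_) R → x < k ℕ.+ m
  right-< {k} {m} {L} gL gR x∈ = ∈-upTo⁻ (∈-resp-↭ (join-parts-↭ gL gR) (∈-++⁺ʳ (map (left k m ℕ.+_) L) x∈))

  join-good : ∀ {k m L R} → Good k L → Good m R → Good (suc (k ℕ.+ m)) (join k m L R)
  join-good {k} {m} {L} {R} gL gR =
    ↭-trans (shift (k ℕ.+ m) (map (left k m ℕ.+_) L) (map (right k m ℕ.+_) R))
      (↭-trans (prep _ (join-parts-↭ gL gR)) (↭-sym (upTo-suc-↭ (k ℕ.+ m)))) ,
    Avoids-++-max (left-< gL gR) (right-< gL gR)
      (Avoids-map⁺ _ (proj₂ gL)) (Avoids-map⁺ _ (proj₂ gR)) cross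
    where
    cross : ∀ {x z} → x ∈ map (left k m ℕ.+_) L → z ∈ map (right k m ℕ.+_) R → ¬ (x ◁ z)
    cross x∈ z∈ with _ , x′∈ , refl ← ∈-map⁻ _ x∈ | _ , z′∈ , refl ← ∈-map⁻ _ z∈ =
      ◁-cross (Good-< gL x′∈) (Good-< gR z′∈)

  unjoin : ∀ {n w} → Good (suc n) w → ∃₂ λ k m → ∃₂ λ L R →
    k ℕ.+ m ≡ n × Good k L × Good m R × w ≡ join k m L R
  unjoin {n} {w} (w↭ , av)
    with L , R , refl ← ∈-∃++ (∈-resp-↭ (↭-sym (↭-trans w↭ (upTo-suc-↭ n))) (here refl)) =
    cut (↭-map-inv _ (↭-sym (proj₁ parts))) (↭-map-inv _ (↭-sym (proj₂ parts)))
    where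
    L++R↭ : L ++ R ↭ upTo n
    L++R↭ = drop-∷ (↭-trans (↭-sym (shift n L R)) (↭-trans w↭ (upTo-suc-↭ n)))

    <n : ∀ {x} → x ∈ L ++ R → x < n
    <n x∈ = ∈-upTo⁻ (∈-resp-↭ L++R↭ x∈)

    k m : ℕ
    k = length L
    m = length R

    k+m≡n : k ℕ.+ m ≡ n
    k+m≡n = ≡.trans (≡.sym (Listₚ.length-++ L)) (≡.trans (↭-length L++R↭) (Listₚ.length-upTo n))

    parts : L ↭ map (left k m ℕ.+_) (upTo k) × R ↭ map (right k m ℕ.+_) (upTo m)
    -- The letters x, n, z occur in this order with the largest in the middle, so avoidance excludes
    -- x ◁ z.
    parts = ◁-split L R L++R↭ λ x∈L z∈R →
      av (⊆-++⁺ (from∈ x∈L) (refl ∷ from∈ z∈R)) (<n (∈-++⁺ˡ x∈L)) (<n (∈-++⁺ʳ L z∈R))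

    cut : (∃ λ L′ → L ≡ map (left k m ℕ.+_) L′ × upTo k ↭ L′) →
          (∃ λ R′ → R ≡ map (right k m ℕ.+_) R′ × upTo m ↭ R′) →
          ∃₂ λ k m → ∃₂ λ L′ R′ → k ℕ.+ m ≡ n × Good k L′ × Good m R′ × L ++ n ∷ R ≡ join k m L′ R′
    cut (L′ , L≡ , L′↭) (R′ , R≡ , R′↭) = k , m , L′ , R′ , k+m≡n ,
      (↭-sym L′↭ , Avoids-map⁻ (left k m) (≡.subst (Avoids _◁_) L≡ (λ p → av (⊆-++⁺ʳ (n ∷ R) p)))) ,
      (↭-sym R′↭ , Avoids-map⁻ (right k m) (≡.subst (Avoids _◁_) R≡ (λ p → av (⊆-++⁺ˡ L (n ∷ʳ p))))) ,
      ≡.cong₂ _++_ L≡ (≡.cong₂ _∷_ (≡.sym k+m≡n) R≡)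

  -- Equal sums make the two maxima equal; a maximum occurs only once, so both words are cut at the
  -- same place, and the lengths of the parts give back k and m.
  join-injective : ∀ {k m k′ m′ L R L′ R′} → k ℕ.+ m ≡ k′ ℕ.+ m′ →
    Good k L → Good m R → Good k′ L′ → Good m′ R′ → join k m L R ≡ join k′ m′ L′ R′ →
    (k , m) ≡ (k′ , m′) × L ≡ L′ × R ≡ R′
  join-injective {k} {m} {k′} {m′} {L} {R} {L′} {R′} sum≡ gL gR gL′ gR′ eq =
    finish k≡k′ m≡m′ parts≡
    where
    eq′ : map (left k m ℕ.+_) L ++ (k ℕ.+ m) ∷ map (right k m ℕ.+_) R
        ≡ map (left k′ m′ ℕ.+_) L′ ++ (k ℕ.+ m) ∷ map (right k′ m′ ℕ.+_) R′
    eq′ = ≡.trans eq (≡.cong (λ n → map (left k′ m′ ℕ.+_) L′ ++ n ∷ map (right k′ m′ ℕ.+_) R′) (≡.sym sum≡))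

    parts≡ : map (left k m ℕ.+_) L ≡ map (left k′ m′ ℕ.+_) L′ × map (right k m ℕ.+_) R ≡ map (right k′ m′ ℕ.+_) R′
    parts≡ = ++∷-injective (map (left k m ℕ.+_) L) (map (left k′ m′ ℕ.+_) L′)
      (λ n∈ → ℕₚ.<-irrefl refl (left-< gL gR n∈))
      (λ n∈ → ℕₚ.<-irrefl sum≡ (left-< gL′ gR′ n∈)) eq′

    k≡k′ : k ≡ k′
    k≡k′ = ≡.trans (≡.sym (Good-length gL)) (≡.trans (≡.sym (Listₚ.length-map _ L))
      (≡.trans (≡.cong length (proj₁ parts≡)) (≡.trans (Listₚ.length-map _ L′) (Good-length gL′))))

    m≡m′ : m ≡ m′
    m≡m′ = ℕₚ.+-cancelˡ-≡ k m m′ (≡.trans sum≡ (≡.cong (ℕ._+ m′) (≡.sym k≡k′)))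

    finish : k ≡ k′ → m ≡ m′ →
      map (left k m ℕ.+_) L ≡ map (left k′ m′ ℕ.+_) L′ × map (right k m ℕ.+_) R ≡ map (right k′ m′ ℕ.+_) R′ →
      (k , m) ≡ (k′ , m′) × L ≡ L′ × R ≡ R′
    finish refl refl (p , q) = refl ,
      Listₚ.map-injective (ℕₚ.+-cancelˡ-≡ (left k m) _ _) p ,
      Listₚ.map-injective (ℕₚ.+-cancelˡ-≡ (right k m) _ _) q

  record Enumeration : Set where
    field
      list   : ℕ → List (List ℕ)
      unique : ∀ n → Unique (list n)
      sound  : ∀ {n w} → w ∈ list n → Good n w
      complete : ∀ {n w} → Good n w → w ∈ list n

    joins : ℕ × ℕ → List (List ℕ)
    joins (k , m) = concatMap (λ L → concatMap (λ R → join k m L R ∷ []) (list m)) (list k)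

    ∈-joins⁻ : ∀ {km w} → w ∈ joins km → ∃₂ λ L R → L ∈ list (proj₁ km) × R ∈ list (proj₂ km) ×
      w ≡ join (proj₁ km) (proj₂ km) L R
    ∈-joins⁻ {k , m} w∈
      with L , L∈ , w∈′ ← find (∈-concatMap⁻ (λ L → concatMap (λ R → join k m L R ∷ []) (list m)) w∈)
      with R , R∈ , here refl ← find (∈-concatMap⁻ (λ R → join k m L R ∷ []) w∈′) = L , R , L∈ , R∈ , refl

    ∈-joins⁺ : ∀ {k m L R} → L ∈ list k → R ∈ list m → join k m L R ∈ joins (k , m)
    ∈-joins⁺ {k} {m} {L} L∈ R∈ = ∈-concatMap⁺ (λ L → concatMap (λ R → join k m L R ∷ []) (list m))
      (lose L∈ (∈-concatMap⁺ (λ R → join k m L R ∷ []) (lose R∈ (here refl))))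

    joins-unique : ∀ km → Unique (joins km)
    joins-unique (k , m) = concatMap-unique (unique k)
      (λ L∈ → concatMap-unique (unique m) (λ _ → [] ∷ [])
        λ { R∈ R′∈ (here refl) (here eq) →
          proj₂ (proj₂ (join-injective refl (sound L∈) (sound R∈) (sound L∈) (sound R′∈) eq)) })
      λ {L} {L′} L∈ L′∈ v∈ v∈′ →
        let R , R∈ , eq = single (find (∈-concatMap⁻ (λ R → join k m L R ∷ []) v∈))
            R′ , R′∈ , eq′ = single (find (∈-concatMap⁻ (λ R → join k m L′ R ∷ []) v∈′))
        in proj₁ (proj₂ (join-injective refl (sound L∈) (sound R∈) (sound L′∈) (sound R′∈) (≡.trans (≡.sym eq) eq′)))
      where
      single : ∀ {L v} → (∃ λ R → R ∈ list m × v ∈ join k m L R ∷ []) → ∃ λ R → R ∈ list m × v ≡ join k m L R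
      single (R , R∈ , here eq) = R , R∈ , eq

    -- Two lists without repetitions and with the same members are rearrangements of each other. A
    -- sum over words of length n + 1 thus becomes a sum over the pairs of parts.
    list-suc-↭ : ∀ n → list (suc n) ↭ concatMap joins (antidiagonal n)
    list-suc-↭ n = ∼bag⇒↭ (unique∧set⇒bag (unique (suc n))
      (concatMap-unique (antidiagonal-unique n) (λ {km} _ → joins-unique km) disjoint) (mk⇔ to from))
      where
      disjoint : ∀ {km km′ v} → km ∈ antidiagonal n → km′ ∈ antidiagonal n → v ∈ joins km → v ∈ joins km′ → km ≡ km′
      disjoint km∈ km′∈ v∈ v∈′ =
        let L , R , L∈ , R∈ , eq = ∈-joins⁻ v∈
            L′ , R′ , L′∈ , R′∈ , eq′ = ∈-joins⁻ v∈′
        in proj₁ (join-injective (≡.trans (∈-antidiagonal⁻ n km∈) (≡.sym (∈-antidiagonal⁻ n km′∈)))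
             (sound L∈) (sound R∈) (sound L′∈) (sound R′∈) (≡.trans (≡.sym eq) eq′))

      to : ∀ {w} → w ∈ list (suc n) → w ∈ concatMap joins (antidiagonal n)
      to w∈ with k , m , L , R , refl , gL , gR , refl ← unjoin (sound w∈) =
        ∈-concatMap⁺ joins (lose (∈-antidiagonal⁺ k m) (∈-joins⁺ (complete gL) (complete gR)))

      from : ∀ {w} → w ∈ concatMap joins (antidiagonal n) → w ∈ list (suc n)
      from w∈ with (k , m) , km∈ , w∈′ ← find (∈-concatMap⁻ joins w∈)
        with refl ← ∈-antidiagonal⁻ n km∈
        with L , R , L∈ , R∈ , refl ← ∈-joins⁻ w∈′ = complete (join-good (sound L∈) (sound R∈))

-- Words as lists of numbers

letter : ∀ {m n} → Vec (Fin m) n → Fin n → ℕ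
letter π i = toℕ (lookup π i)

letters : ∀ {m n} → Vec (Fin m) n → List ℕ
letters π = tabulate (letter π)

letters-injective : ∀ {m n} {π ρ : Vec (Fin m) n} → letters π ≡ letters ρ → π ≡ ρ
letters-injective {π = Vec.[]}    {Vec.[]}    eq = refl
letters-injective {π = x Vec.∷ π} {y Vec.∷ ρ} eq = ≡.cong₂ Vec._∷_
  (Finₚ.toℕ-injective (Listₚ.∷-injectiveˡ eq)) (letters-injective (Listₚ.∷-injectiveʳ eq))

fromLetters : ∀ {m} (w : List ℕ) → (∀ {x} → x ∈ w → x < m) → ∃ λ (π : Vec (Fin m) (length w)) → letters π ≡ w
fromLetters []      w<m = Vec.[] , refl
fromLetters (x ∷ w) w<m with π , eq ← fromLetters w (w<m ∘ there) =
  fromℕ< (w<m (here refl)) Vec.∷ π , ≡.cong₂ _∷_ (Finₚ.toℕ-fromℕ< _) eq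

words-unique : ∀ n k → Unique (words n k)
words-unique n zero    = [] ∷ []
words-unique n (suc k) = Uniqueₚ.cartesianProductWith⁺ Vec._∷_ Vecₚ.∷-injective (Uniqueₚ.allFin⁺ n) (words-unique n k)

∈-words : ∀ {n k} (π : Vec (Fin n) k) → π ∈ words n k
∈-words Vec.[]      = here refl
∈-words (x Vec.∷ π) = ∈-cartesianProductWith⁺ Vec._∷_ (∈-allFin x) (∈-words π)

-- The pigeonhole principle: n distinct letters below n exhaust the numbers below n.
unique-⊆⇒↭ : ∀ {A : Set} {xs ys : List A} → Unique xs → (∀ {x} → x ∈ xs → x ∈ ys) →
  length ys ≤ length xs → xs ↭ ys
unique-⊆⇒↭ {xs = []}     {[]} u        xs⊆ys _ = ↭-refl
unique-⊆⇒↭ {xs = x ∷ xs} (x∉xs ∷ u) xs⊆ys len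
  with ys₁ , ys₂ , refl ← ∈-∃++ (xs⊆ys (here refl)) =
  ↭-trans (prep x (unique-⊆⇒↭ u xs⊆ (ℕₚ.≤-pred (ℕₚ.≤-trans (ℕₚ.≤-reflexive (≡.sym (↭-length ys↭))) len)))) (↭-sym ys↭)
  where
  ys↭ : ys₁ ++ x ∷ ys₂ ↭ x ∷ ys₁ ++ ys₂
  ys↭ = shift x ys₁ ys₂
  xs⊆ : ∀ {v} → v ∈ xs → v ∈ ys₁ ++ ys₂
  xs⊆ v∈ with ∈-resp-↭ ys↭ (xs⊆ys (there v∈))
  ... | here refl = contradiction refl (All.lookup x∉xs v∈)
  ... | there v∈′ = v∈′

permutation⇒↭ : ∀ {n} (π : Word n) → IsPermutation π → letters π ↭ upTo n
permutation⇒↭ {n} π perm = unique-⊆⇒↭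
  (Uniqueₚ.tabulate⁺ (λ {i} {j} eq → perm i j (Finₚ.toℕ-injective eq)))
  (λ x∈ → let i , eq = ∈-tabulate⁻ {f = letter π} x∈ in ∈-upTo⁺ (≡.subst (_< n) (≡.sym eq) (Finₚ.toℕ<n (lookup π i))))
  (ℕₚ.≤-reflexive (≡.trans (Listₚ.length-upTo n) (≡.sym (Listₚ.length-tabulate (letter π)))))

tabulate-unique⁻ : ∀ {n} {f : Fin n → ℕ} → Unique (tabulate f) → ∀ i j → f i ≡ f j → i ≡ j
tabulate-unique⁻ u        zero    zero    eq = refl
tabulate-unique⁻ {f = f} (p ∷ u) zero    (suc j) eq = contradiction eq (All.lookup p (∈-tabulate⁺ {f = f ∘ suc} j))
tabulate-unique⁻ {f = f} (p ∷ u) (suc i) zero    eq = contradiction (≡.sym eq) (All.lookup p (∈-tabulate⁺ {f = f ∘ suc} i))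
tabulate-unique⁻ (p ∷ u) (suc i) (suc j) eq = ≡.cong suc (tabulate-unique⁻ u i j eq)

↭⇒permutation : ∀ {n} (π : Word n) → letters π ↭ upTo n → IsPermutation π
↭⇒permutation {n} π p i j eq = tabulate-unique⁻
  (Permutationₚ.Unique-resp-↭ (≡.setoid ℕ) (↭⇒↭ₛ (↭-sym p)) (Uniqueₚ.upTo⁺ n)) i j (≡.cong toℕ eq)

⊆-tabulate¹ : ∀ {n} (f : Fin n → ℕ) i → f i ∷ [] ⊆ tabulate f
⊆-tabulate¹ f zero    = refl ∷ minimum _
⊆-tabulate¹ f (suc i) = f zero ∷ʳ ⊆-tabulate¹ (f ∘ suc) i

⊆-tabulate² : ∀ {n} (f : Fin n → ℕ) i j → i Fin.< j → f i ∷ f j ∷ [] ⊆ tabulate f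
⊆-tabulate² f zero    (suc j) _         = refl ∷ ⊆-tabulate¹ (f ∘ suc) j
⊆-tabulate² f (suc i) (suc j) (s≤s i<j) = f zero ∷ʳ ⊆-tabulate² (f ∘ suc) i j i<j

⊆-tabulate³ : ∀ {n} (f : Fin n → ℕ) i j k → i Fin.< j → j Fin.< k → f i ∷ f j ∷ f k ∷ [] ⊆ tabulate f
⊆-tabulate³ f zero    (suc j) (suc k) _         (s≤s j<k) = refl ∷ ⊆-tabulate² (f ∘ suc) j k j<k
⊆-tabulate³ f (suc i) (suc j) (suc k) (s≤s i<j) (s≤s j<k) = f zero ∷ʳ ⊆-tabulate³ (f ∘ suc) i j k i<j j<k

⊆-tabulate¹⁻ : ∀ {n} (f : Fin n → ℕ) {x} → x ∷ [] ⊆ tabulate f → ∃ λ i → x ≡ f i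
⊆-tabulate¹⁻ {suc n} f (_ ∷ʳ p) with i , eq ← ⊆-tabulate¹⁻ (f ∘ suc) p = suc i , eq
⊆-tabulate¹⁻ {suc n} f (eq ∷ p) = zero , eq

⊆-tabulate²⁻ : ∀ {n} (f : Fin n → ℕ) {x y} → x ∷ y ∷ [] ⊆ tabulate f →
  ∃₂ λ i j → i Fin.< j × x ≡ f i × y ≡ f j
⊆-tabulate²⁻ {suc n} f (_ ∷ʳ p) with i , j , i<j , eq , eq′ ← ⊆-tabulate²⁻ (f ∘ suc) p = suc i , suc j , s≤s i<j , eq , eq′
⊆-tabulate²⁻ {suc n} f (eq ∷ p) with j , eq′ ← ⊆-tabulate¹⁻ (f ∘ suc) p = zero , suc j , s≤s z≤n , eq , eq′

⊆-tabulate³⁻ : ∀ {n} (f : Fin n → ℕ) {x y z} → x ∷ y ∷ z ∷ [] ⊆ tabulate f →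
  ∃₂ λ i j → ∃ λ k → i Fin.< j × j Fin.< k × x ≡ f i × y ≡ f j × z ≡ f k
⊆-tabulate³⁻ {suc n} f (_ ∷ʳ p) with i , j , k , i<j , j<k , eqs ← ⊆-tabulate³⁻ (f ∘ suc) p =
  suc i , suc j , suc k , s≤s i<j , s≤s j<k , eqs
⊆-tabulate³⁻ {suc n} f (eq ∷ p) with j , k , j<k , eq′ , eq″ ← ⊆-tabulate²⁻ (f ∘ suc) p =
  zero , suc j , suc k , s≤s z≤n , s≤s j<k , eq , eq′ , eq″

avoids231⇔ : ∀ {n} (π : Word n) → Avoids231 π ⇔ Avoids _>_ (letters π)
avoids231⇔ π = mk⇔ to from
  where
  to : Avoids231 π → Avoids _>_ (letters π)
  to av p x<y _ z<x with i , j , k , i<j , j<k , refl , refl , refl ← ⊆-tabulate³⁻ (letter π) p =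
    av i j k i<j j<k (z<x , x<y)
  from : Avoids _>_ (letters π) → Avoids231 π
  from av i j k i<j j<k (z<x , x<y) = av (⊆-tabulate³ (letter π) i j k i<j j<k) x<y (ℕₚ.<-trans z<x x<y) z<x

avoids132⇔ : ∀ {n} (π : Word n) → Avoids132 π ⇔ Avoids _<_ (letters π)
avoids132⇔ π = mk⇔ to from
  where
  to : Avoids132 π → Avoids _<_ (letters π)
  to av p _ z<y x<z with i , j , k , i<j , j<k , refl , refl , refl ← ⊆-tabulate³⁻ (letter π) p =
    av i j k i<j j<k (x<z , z<y)
  from : Avoids _<_ (letters π) → Avoids132 π
  from av i j k i<j j<k (x<z , z<y) = av (⊆-tabulate³ (letter π) i j k i<j j<k) (ℕₚ.<-trans x<z z<y) z<y x<z

module _ (S : Separation) {P : ∀ {n} → Word n → Set} (P? : ∀ {n} (π : Word n) → Dec (P π))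
  (P⇔ : ∀ {n} (π : Word n) → P π ⇔ Avoids (Separation._◁_ S) (letters π)) where
  open Decomposition S

  enumeration : Enumeration
  enumeration = record
    { list = λ n → map letters (filter P? (𝔖 n))
    ; unique = λ n → Uniqueₚ.map⁺ letters-injective (Uniqueₚ.filter⁺ P? (Uniqueₚ.filter⁺ isPermutation? (words-unique n n)))
    ; sound = sound
    ; complete = complete
    }
    where
    sound : ∀ {n w} → w ∈ map letters (filter P? (𝔖 n)) → Good n w
    sound {n} w∈ with π , π∈ , refl ← ∈-map⁻ letters w∈
      with π∈𝔖 , av ← ∈-filter⁻ P? {xs = 𝔖 n} π∈
      with _ , perm ← ∈-filter⁻ isPermutation? {xs = words n n} π∈𝔖 =
      permutation⇒↭ π perm , Equivalence.to (P⇔ π) av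
    complete : ∀ {n w} → Good n w → w ∈ map letters (filter P? (𝔖 n))
    complete {n} {w} good with refl ← Good-length good
      with π , eq ← fromLetters w (Good-< good) =
      ≡.subst (_∈ map letters (filter P? (𝔖 (length w)))) eq
        (∈-map⁺ letters (∈-filter⁺ P? (∈-filter⁺ isPermutation? (∈-words π)
          (↭⇒permutation π (≡.subst (_↭ upTo (length w)) (≡.sym eq) (proj₁ good))))
          (Equivalence.from (P⇔ π) (≡.subst (Avoids (Separation._◁_ S)) (≡.sym eq) (proj₂ good)))))

-- Statistics

⟦_⟧ : Bool → ℕ
⟦ b ⟧ = if b then 1 else 0

Σᶠ : ∀ {n} → (Fin n → ℕ) → ℕ
Σᶠ {zero}  f = 0
Σᶠ {suc n} f = f zero ℕ.+ Σᶠ (f ∘ suc)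

Σᶠ-cong : ∀ {n} {f g : Fin n → ℕ} → (∀ i → f i ≡ g i) → Σᶠ f ≡ Σᶠ g
Σᶠ-cong {zero}  p = refl
Σᶠ-cong {suc n} p = ≡.cong₂ ℕ._+_ (p zero) (Σᶠ-cong (p ∘ suc))

Σᶠ-zero : ∀ n → Σᶠ {n} (λ _ → 0) ≡ 0
Σᶠ-zero zero    = refl
Σᶠ-zero (suc n) = Σᶠ-zero n

+-interchange : ∀ a b c d → (a ℕ.+ b) ℕ.+ (c ℕ.+ d) ≡ (a ℕ.+ c) ℕ.+ (b ℕ.+ d)
+-interchange a b c d = ≡.trans (ℕₚ.+-assoc a b (c ℕ.+ d)) (≡.trans
  (≡.cong (a ℕ.+_) (≡.trans (≡.sym (ℕₚ.+-assoc b c d)) (≡.trans (≡.cong (ℕ._+ d) (ℕₚ.+-comm b c)) (ℕₚ.+-assoc c b d))))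
  (≡.sym (ℕₚ.+-assoc a c (b ℕ.+ d))))

Σᶠ-+ : ∀ {n} (f g : Fin n → ℕ) → Σᶠ (λ i → f i ℕ.+ g i) ≡ Σᶠ f ℕ.+ Σᶠ g
Σᶠ-+ {zero}  f g = refl
Σᶠ-+ {suc n} f g = ≡.trans (≡.cong (f zero ℕ.+ g zero ℕ.+_) (Σᶠ-+ (f ∘ suc) (g ∘ suc)))
  (+-interchange (f zero) (g zero) (Σᶠ (f ∘ suc)) (Σᶠ (g ∘ suc)))

length-filter : ∀ {A : Set} {P : A → Set} (P? : Decidable P) xs →
  length (filter P? xs) ≡ sum (map (λ x → ⟦ does (P? x) ⟧) xs)
length-filter P? []       = refl
length-filter P? (x ∷ xs) with does (P? x)
... | true  = ≡.cong suc (length-filter P? xs)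
... | false = length-filter P? xs

sum-allFin : ∀ {n} (f : Fin n → ℕ) → sum (map f (allFin n)) ≡ Σᶠ f
sum-allFin {zero}  f = refl
sum-allFin {suc n} f = ≡.cong (f zero ℕ.+_) (≡.trans
  (≡.cong sum (≡.trans (Listₚ.map-tabulate suc f) (≡.sym (Listₚ.map-tabulate id (f ∘ suc)))))
  (sum-allFin (f ∘ suc)))

sum-cartesianProduct : ∀ {A B : Set} (f : A × B → ℕ) xs ys →
  sum (map f (cartesianProduct xs ys)) ≡ sum (map (λ x → sum (map (λ y → f (x , y)) ys)) xs)
sum-cartesianProduct f []       ys = refl
sum-cartesianProduct f (x ∷ xs) ys = begin
  sum (map f (map (x ,_) ys ++ cartesianProduct xs ys))
    ≡⟨ ≡.cong sum (Listₚ.map-++ f (map (x ,_) ys) (cartesianProduct xs ys)) ⟩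
  sum (map f (map (x ,_) ys) ++ map f (cartesianProduct xs ys))
    ≡⟨ sum-++ (map f (map (x ,_) ys)) _ ⟩
  sum (map f (map (x ,_) ys)) ℕ.+ sum (map f (cartesianProduct xs ys))
    ≡⟨ ≡.cong₂ ℕ._+_ (≡.cong sum (≡.sym (Listₚ.map-∘ ys))) (sum-cartesianProduct f xs ys) ⟩
  sum (map (λ y → f (x , y)) ys) ℕ.+ sum (map (λ x → sum (map (λ y → f (x , y)) ys)) xs) ∎
  where open ≡.≡-Reasoning

sum-positions² : ∀ {n} (f : Fin n × Fin n → ℕ) → sum (map f (positions² n)) ≡ Σᶠ λ i → Σᶠ λ j → f (i , j)
sum-positions² {n} f = ≡.trans (sum-cartesianProduct f (allFin n) (allFin n))
  (≡.trans (sum-allFin {n} _) (Σᶠ-cong λ i → sum-allFin (λ j → f (i , j))))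

sum-positions³ : ∀ {n} (f : Fin n × Fin n × Fin n → ℕ) →
  sum (map f (positions³ n)) ≡ Σᶠ λ i → Σᶠ λ j → Σᶠ λ k → f (i , j , k)
sum-positions³ {n} f = ≡.trans (sum-cartesianProduct f (allFin n) (positions² n))
  (≡.trans (sum-allFin {n} _) (Σᶠ-cong λ i → sum-positions² (λ jk → f (i , jk))))

-- The guard has the Boolean form to which `does` of `⋖?` reduces, which is why `refl` matches it
-- with the filters defining the statistics.
Σ⋖ : ∀ {n} → (Fin n → Fin n → ℕ) → ℕ
Σ⋖ g = Σᶠ λ i → Σᶠ λ i′ → if toℕ i′ ≡ᵇ suc (toℕ i) then g i i′ else 0

Σ⋖-suc : ∀ {n} (g : Fin (2 ℕ.+ n) → Fin (2 ℕ.+ n) → ℕ) →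
  Σ⋖ g ≡ g zero (suc zero) ℕ.+ Σ⋖ (λ i i′ → g (suc i) (suc i′))
Σ⋖-suc {n} g = ≡.cong (ℕ._+ Σ⋖ (λ i i′ → g (suc i) (suc i′)))
  (≡.trans (≡.cong (g zero (suc zero) ℕ.+_) (Σᶠ-zero n)) (ℕₚ.+-identityʳ _))

Σ⋖-+ : ∀ {n} (g h : Fin n → Fin n → ℕ) → Σ⋖ (λ i i′ → g i i′ ℕ.+ h i i′) ≡ Σ⋖ g ℕ.+ Σ⋖ h
Σ⋖-+ g h = ≡.trans (Σᶠ-cong λ i → ≡.trans (Σᶠ-cong λ i′ → split (toℕ i′ ≡ᵇ suc (toℕ i)) (g i i′) (h i i′))
  (Σᶠ-+ (λ i′ → if toℕ i′ ≡ᵇ suc (toℕ i) then g i i′ else 0) _)) (Σᶠ-+ (λ i → Σᶠ λ i′ → if toℕ i′ ≡ᵇ suc (toℕ i) then g i i′ else 0) _)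
  where
  split : ∀ b x y → (if b then x ℕ.+ y else 0) ≡ (if b then x else 0) ℕ.+ (if b then y else 0)
  split true  x y = refl
  split false x y = refl

count : (ℕ → Bool) → List ℕ → ℕ
count p []      = 0
count p (x ∷ w) = ⟦ p x ⟧ ℕ.+ count p w

count-tabulate : ∀ {n} p (f : Fin n → ℕ) → Σᶠ (λ i → ⟦ p (f i) ⟧) ≡ count p (tabulate f)
count-tabulate {zero}  p f = refl
count-tabulate {suc n} p f = ≡.cong (⟦ p (f zero) ⟧ ℕ.+_) (count-tabulate p (f ∘ suc))

-- The third argument of p is the rest of the word behind the pair, where the `2` of 31-2 and 13-2
-- is to be found.
adjacent : (ℕ → ℕ → List ℕ → ℕ) → List ℕ → ℕ
adjacent p []          = 0
adjacent p (x ∷ [])    = 0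
adjacent p (x ∷ y ∷ w) = p x y w ℕ.+ adjacent p (y ∷ w)

descents : List ℕ → ℕ
descents = adjacent λ x y _ → ⟦ y <ᵇ x ⟧

count31-2 : List ℕ → ℕ
count31-2 = adjacent λ x y → count λ j → (y <ᵇ j) ∧ (j <ᵇ x)

count13-2 : List ℕ → ℕ
count13-2 = adjacent λ x y → count λ j → (x <ᵇ j) ∧ (j <ᵇ y)

-- The occurrences of 2-31 in which x, standing before the word, plays the `2`.
straddles : ℕ → List ℕ → ℕ
straddles x = adjacent λ a b _ → ⟦ (b <ᵇ x) ∧ (x <ᵇ a) ⟧

count2-31 : List ℕ → ℕ
count2-31 []      = 0
count2-31 (x ∷ w) = straddles x w ℕ.+ count2-31 w

Σ⋖-pairs : ∀ {n} (p : ℕ → ℕ → ℕ) (f : Fin n → ℕ) →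
  Σ⋖ (λ i i′ → p (f i) (f i′)) ≡ adjacent (λ x y _ → p x y) (tabulate f)
Σ⋖-pairs {zero}        p f = refl
Σ⋖-pairs {suc zero}    p f = refl
Σ⋖-pairs {suc (suc n)} p f = ≡.trans (Σ⋖-suc (λ i i′ → p (f i) (f i′)))
  (≡.cong (p (f zero) (f (suc zero)) ℕ.+_) (Σ⋖-pairs p (f ∘ suc)))

Σ⋖-after : ∀ {n} (p : ℕ → ℕ → ℕ → Bool) (f : Fin n → ℕ) →
  Σ⋖ (λ i i′ → Σᶠ λ j → ⟦ (toℕ i′ <ᵇ toℕ j) ∧ p (f i) (f i′) (f j) ⟧)
    ≡ adjacent (λ x y → count (p x y)) (tabulate f)
Σ⋖-after {zero}        p f = refl
Σ⋖-after {suc zero}    p f = refl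
Σ⋖-after {suc (suc n)} p f = ≡.trans
  (Σ⋖-suc (λ i i′ → Σᶠ λ j → ⟦ (toℕ i′ <ᵇ toℕ j) ∧ p (f i) (f i′) (f j) ⟧))
  (≡.cong₂ ℕ._+_ (count-tabulate (p (f zero) (f (suc zero))) (λ i → f (suc (suc i)))) (Σ⋖-after p (f ∘ suc)))

-- The definition sums over the descent first, the list recursion over the letter playing the `2`.
-- Separating position 0 (`first`) from the later ones (`later`) exchanges the two orders.
Σ⋖-before : ∀ {n} (f : Fin n → ℕ) →
  Σ⋖ (λ i i′ → Σᶠ λ j → ⟦ (toℕ j <ᵇ toℕ i) ∧ (f i′ <ᵇ f j) ∧ (f j <ᵇ f i) ⟧) ≡ count2-31 (tabulate f)
Σ⋖-before {zero}        f = refl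
Σ⋖-before {suc zero}    f = refl
Σ⋖-before {suc (suc n)} f = begin
  Σ⋖ g                                         ≡⟨ Σ⋖-suc g ⟩
  g zero (suc zero) ℕ.+ Σ⋖ (λ i i′ → first i i′ ℕ.+ later i i′)
    ≡⟨ ≡.cong₂ ℕ._+_ (Σᶠ-zero n) (Σ⋖-+ first later) ⟩
  Σ⋖ first ℕ.+ Σ⋖ later
    ≡⟨ ≡.cong₂ ℕ._+_ (Σ⋖-pairs (λ a b → ⟦ (b <ᵇ f zero) ∧ (f zero <ᵇ a) ⟧) (f ∘ suc)) (Σ⋖-before (f ∘ suc)) ⟩
  count2-31 (tabulate f) ∎
  where
  open ≡.≡-Reasoning
  g : Fin (2 ℕ.+ n) → Fin (2 ℕ.+ n) → ℕ
  g i i′ = Σᶠ λ j → ⟦ (toℕ j <ᵇ toℕ i) ∧ (f i′ <ᵇ f j) ∧ (f j <ᵇ f i) ⟧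
  first later : Fin (suc n) → Fin (suc n) → ℕ
  first i i′ = ⟦ (f (suc i′) <ᵇ f zero) ∧ (f zero <ᵇ f (suc i)) ⟧
  later i i′ = Σᶠ λ j → ⟦ (toℕ j <ᵇ toℕ i) ∧ (f (suc i′) <ᵇ f (suc j)) ∧ (f (suc j) <ᵇ f (suc i)) ⟧

⟦∧⟧ : ∀ b c → ⟦ b ∧ c ⟧ ≡ (if b then ⟦ c ⟧ else 0)
⟦∧⟧ true  c = refl
⟦∧⟧ false c = refl

Σᶠ-guard : ∀ {n} b (c : Fin n → Bool) → Σᶠ (λ j → ⟦ b ∧ c j ⟧) ≡ (if b then Σᶠ (λ j → ⟦ c j ⟧) else 0)
Σᶠ-guard     true  c = refl
Σᶠ-guard {n} false c = Σᶠ-zero n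

count-positions² : ∀ {n} {P : Fin n × Fin n → Set} (P? : Decidable P) (c : Fin n → Fin n → Bool) →
  (∀ i i′ → does (P? (i , i′)) ≡ (toℕ i′ ≡ᵇ suc (toℕ i)) ∧ c i i′) →
  length (filter P? (positions² n)) ≡ Σ⋖ (λ i i′ → ⟦ c i i′ ⟧)
count-positions² {n} P? c eq = ≡.trans (length-filter P? (positions² n)) (≡.trans
  (sum-positions² {n} λ ii′ → ⟦ does (P? ii′) ⟧)
  (Σᶠ-cong {n} λ i → Σᶠ-cong {n} λ i′ →
    ≡.trans (≡.cong ⟦_⟧ (eq i i′)) (⟦∧⟧ (toℕ i′ ≡ᵇ suc (toℕ i)) (c i i′))))

count-positions³ : ∀ {n} {P : Fin n × Fin n × Fin n → Set} (P? : Decidable P) (c : Fin n → Fin n → Fin n → Bool) →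
  (∀ i i′ j → does (P? (i , i′ , j)) ≡ (toℕ i′ ≡ᵇ suc (toℕ i)) ∧ c i i′ j) →
  length (filter P? (positions³ n)) ≡ Σ⋖ (λ i i′ → Σᶠ λ j → ⟦ c i i′ j ⟧)
count-positions³ {n} P? c eq = ≡.trans (length-filter P? (positions³ n)) (≡.trans
  (sum-positions³ {n} λ ii′j → ⟦ does (P? ii′j) ⟧)
  (Σᶠ-cong {n} λ i → Σᶠ-cong {n} λ i′ →
    ≡.trans (Σᶠ-cong {n} λ j → ≡.cong ⟦_⟧ (eq i i′ j)) (Σᶠ-guard (toℕ i′ ≡ᵇ suc (toℕ i)) (c i i′))))

des≡ : ∀ {n} (π : Word n) → des π ≡ descents (letters π)
des≡ π = ≡.trans (count-positions² _ (λ i i′ → letter π i′ <ᵇ letter π i) (λ _ _ → refl))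
  (Σ⋖-pairs (λ x y → ⟦ y <ᵇ x ⟧) (letter π))

⟨31-2⟩≡ : ∀ {n} (π : Word n) → ⟨31-2⟩ π ≡ count31-2 (letters π)
⟨31-2⟩≡ π = ≡.trans (count-positions³ _
  (λ i i′ j → (toℕ i′ <ᵇ toℕ j) ∧ (letter π i′ <ᵇ letter π j) ∧ (letter π j <ᵇ letter π i)) (λ _ _ _ → refl))
  (Σ⋖-after (λ x y j → (y <ᵇ j) ∧ (j <ᵇ x)) (letter π))

⟨13-2⟩≡ : ∀ {n} (π : Word n) → ⟨13-2⟩ π ≡ count13-2 (letters π)
⟨13-2⟩≡ π = ≡.trans (count-positions³ _
  (λ i i′ j → (toℕ i′ <ᵇ toℕ j) ∧ (letter π i <ᵇ letter π j) ∧ (letter π j <ᵇ letter π i′)) (λ _ _ _ → refl))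
  (Σ⋖-after (λ x y j → (x <ᵇ j) ∧ (j <ᵇ y)) (letter π))

⟨2-31⟩≡ : ∀ {n} (π : Word n) → ⟨2-31⟩ π ≡ count2-31 (letters π)
⟨2-31⟩≡ π = ≡.trans (count-positions³ _
  (λ i i′ j → (toℕ j <ᵇ toℕ i) ∧ (letter π i′ <ᵇ letter π j) ∧ (letter π j <ᵇ letter π i)) (λ _ _ _ → refl))
  (Σ⋖-before (letter π))

-- Coderangements and alternating words

-- The value on the empty list is the convention π(n+1) = n+1: behind the last letter comes a larger
-- one.
startsAbove : ℕ → List ℕ → Bool
startsAbove x []      = true
startsAbove x (y ∷ w) = x <ᵇ y

-- M is the largest letter read so far.
foremaximumFree : ℕ → List ℕ → Bool
foremaximumFree M []      = true
foremaximumFree M (x ∷ w) = not ((M ≤ᵇ x) ∧ startsAbove x w) ∧ foremaximumFree (M ⊔ x) w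

module _ where
  open Equivalence

  -- The form of a foremaximum that survives removing the first letter: M remembers the maximum of
  -- the letters removed, and g is the word with the conventional last letter appended.
  ForemaximumAbove : ∀ {n} → ℕ → (Fin n → ℕ) → (Fin (suc n) → ℕ) → Fin n → Set
  ForemaximumAbove M f g i = f i < g (suc i) × M ≤ f i × (∀ j → j Fin.≤ i → f j ≤ f i)

  startsAbove⇔ : ∀ {n} (f : Fin (suc n) → ℕ) (g : Fin (2 ℕ.+ n) → ℕ) → (∀ i → g (inject₁ i) ≡ f i) →
    (∀ i → f i < g (fromℕ (suc n))) → T (startsAbove (f zero) (tabulate (f ∘ suc))) ⇔ (f zero < g (suc zero))
  startsAbove⇔ {zero}  f g eq f<g = mk⇔ (λ _ → f<g zero) (λ _ → tt)
  startsAbove⇔ {suc n} f g eq f<g = mk⇔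
    (λ t → ≡.subst (f zero <_) (≡.sym (eq (suc zero))) (ℕₚ.<ᵇ⇒< _ _ t))
    (λ lt → ℕₚ.<⇒<ᵇ (≡.subst (f zero <_) (eq (suc zero)) lt))

  T-not⁺ : ∀ {b} → ¬ T b → T (not b)
  T-not⁺ {true}  ¬b = ¬b tt
  T-not⁺ {false} ¬b = tt

  T-not⁻ : ∀ {b} → T (not b) → ¬ T b
  T-not⁻ {false} _ ()

  foremaximumFree⇔ : ∀ {n} M (f : Fin n → ℕ) (g : Fin (suc n) → ℕ) → (∀ i → g (inject₁ i) ≡ f i) →
    (∀ i → f i < g (fromℕ n)) → (¬ ∃ (ForemaximumAbove M f g)) ⇔ T (foremaximumFree M (tabulate f))
  foremaximumFree⇔ {zero}  M f g eq f<g = mk⇔ (λ _ → tt) (λ { _ (() , _) })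
  foremaximumFree⇔ {suc n} M f g eq f<g = mk⇔ forth back
    where
    rest = foremaximumFree⇔ (M ⊔ f zero) (f ∘ suc) (g ∘ suc) (eq ∘ suc) (f<g ∘ suc)
    first = startsAbove⇔ f g eq f<g

    forth : (¬ ∃ (ForemaximumAbove M f g)) → T (foremaximumFree M (tabulate f))
    forth none = from T-∧
      ( T-not⁺ (λ t → let M≤x , above = to T-∧ t in
          none (zero , to first above , ℕₚ.≤ᵇ⇒≤ _ _ M≤x , λ { zero _ → ℕₚ.≤-refl }))
      , to rest λ (i , asc , M⊔x≤ , max) → none (suc i , asc , ℕₚ.m⊔n≤o⇒m≤o M (f zero) M⊔x≤ ,
          λ { zero _ → ℕₚ.m⊔n≤o⇒n≤o M (f zero) M⊔x≤ ; (suc j) (s≤s j≤i) → max j j≤i }))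

    back : T (foremaximumFree M (tabulate f)) → ¬ ∃ (ForemaximumAbove M f g)
    back t (zero , asc , M≤x , _) = T-not⁻ (proj₁ (to T-∧ t)) (from T-∧ (ℕₚ.≤⇒≤ᵇ M≤x , from first asc))
    back t (suc i , asc , M≤x , max) = from rest (proj₂ (to (T-∧ {not ((M ≤ᵇ f zero) ∧ startsAbove (f zero) (tabulate (f ∘ suc)))}) t))
      (i , asc , ℕₚ.⊔-lub M≤x (max zero z≤n) , λ j j≤i → max (suc j) (s≤s j≤i))

  lookup-extend : ∀ {m n} (v : Vec (Fin m) n) x i →
    lookup (Vec.map inject₁ v Vec.∷ʳ x) (inject₁ i) ≡ inject₁ (lookup v i)
  lookup-extend (y Vec.∷ v) x zero    = refl
  lookup-extend (y Vec.∷ v) x (suc i) = lookup-extend v x i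

  lookup-last : ∀ {m n} (v : Vec (Fin m) n) x → lookup (v Vec.∷ʳ x) (fromℕ n) ≡ x
  lookup-last Vec.[]      x = refl
  lookup-last (y Vec.∷ v) x = lookup-last v x

  coderangement⇔ : ∀ {n} (π : Word n) → Coderangement π ⇔ T (foremaximumFree 0 (letters π))
  coderangement⇔ {n} π = mk⇔ forth back
    where
    g : Fin (suc n) → ℕ
    g i = toℕ (lookup (extend π) i)
    eq : ∀ i → g (inject₁ i) ≡ letter π i
    eq i = ≡.trans (≡.cong toℕ (lookup-extend π (fromℕ n) i)) (Finₚ.toℕ-inject₁ (lookup π i))
    last≡ : g (fromℕ n) ≡ n
    last≡ = ≡.trans (≡.cong toℕ (lookup-last (Vec.map inject₁ π) (fromℕ n))) (Finₚ.toℕ-fromℕ n)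
    free = foremaximumFree⇔ 0 (letter π) g eq
      (λ i → ≡.subst (letter π i <_) (≡.sym last≡) (Finₚ.toℕ<n (lookup π i)))
    forth : Coderangement π → T (foremaximumFree 0 (letters π))
    forth cod = to free λ (i , asc , _ , max) → cod (i , ≡.subst (_< g (suc i)) (≡.sym (eq i)) asc , max)
    back : T (foremaximumFree 0 (letters π)) → Coderangement π
    back t (i , asc , max) = from free t (i , ≡.subst (_< g (suc i)) (eq i) asc , z≤n , max)

coderangement≡ : ∀ {n} (π : Word n) → does (coderangement? π) ≡ foremaximumFree 0 (letters π)
coderangement≡ π = does-⇔ (coderangement⇔ π) (coderangement? π) (T? _)

step : Bool → ℕ → ℕ → Bool
step true  x y = x <ᵇ y
step false x y = y <ᵇ x

alternating : Bool → List ℕ → Bool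
alternating b []          = true
alternating b (x ∷ [])    = true
alternating b (x ∷ y ∷ w) = step b x y ∧ alternating (not b) (y ∷ w)

-- `flip true n` is the truth value of `2 ∣ n`, computed along the recursion of `alternating`.
flip : Bool → ℕ → Bool
flip b zero    = b
flip b (suc n) = flip (not b) n

not-not : ∀ b → not (not b) ≡ b
not-not true  = refl
not-not false = refl

flip-even : ∀ b m → flip b (m ℕ.* 2) ≡ b
flip-even b zero    = refl
flip-even b (suc m) = ≡.trans (≡.cong (λ c → flip c (m ℕ.* 2)) (not-not b)) (flip-even b m)

flip-2∣ : ∀ {n} → 2 ∣ n → flip true n ≡ true
flip-2∣ (divides m refl) = flip-even true m

flip-2∤ : ∀ n → ¬ (2 ∣ n) → flip true n ≡ false
flip-2∤ n 2∤n with parity n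
... | even m = contradiction (n∣m*n m) 2∤n
... | odd m  = flip-even false m

Steps : ∀ {n} → Bool → (Fin n → ℕ) → Set
Steps b f = ∀ i i′ → i ⋖ i′ → T (step (flip b (toℕ i)) (f i) (f i′))

module _ where
  open Equivalence

  steps⇔ : ∀ {n} b (f : Fin n → ℕ) → Steps b f ⇔ T (alternating b (tabulate f))
  steps⇔ {zero}        b f = mk⇔ (λ _ → tt) (λ _ ())
  steps⇔ {suc zero}    b f = mk⇔ (λ _ → tt) (λ { _ zero zero () })
  steps⇔ {suc (suc n)} b f = steps-suc⇔ (steps⇔ (not b) (f ∘ suc))
    where
    steps-suc⇔ : Steps (not b) (f ∘ suc) ⇔ T (alternating (not b) (tabulate (f ∘ suc))) →
      Steps b f ⇔ T (alternating b (tabulate f))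
    steps-suc⇔ rest = mk⇔ forth back
      where
      forth : Steps b f → T (alternating b (tabulate f))
      forth st = from T-∧ (st zero (suc zero) refl ,
        to rest λ i i′ i⋖i′ → st (suc i) (suc i′) (≡.cong suc i⋖i′))
      back : T (alternating b (tabulate f)) → Steps b f
      back t zero    (suc zero) eq = proj₁ (to T-∧ t)
      back t (suc i) (suc i′)   eq =
        from rest (proj₂ (to (T-∧ {step b (f zero) (f (suc zero))}) t)) i i′ (ℕₚ.suc-injective eq)

  alternating⇔ : ∀ {n} (π : Word n) → Alternating π ⇔ T (alternating true (letters π))
  alternating⇔ π = mk⇔ (λ alt → to (steps⇔ true f) λ i i′ i⋖i′ → forth i i′ (alt i i′ i⋖i′))
    (λ t i i′ i⋖i′ → back i i′ (from (steps⇔ true f) t i i′ i⋖i′))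
    where
    f = letter π
    forth : ∀ i i′ → (2 ∣ toℕ i → f i < f i′) × (¬ (2 ∣ toℕ i) → f i > f i′) → T (step (flip true (toℕ i)) (f i) (f i′))
    forth i i′ (up , down) with 2 ∣? toℕ i
    ... | yes 2∣i rewrite flip-2∣ 2∣i = ℕₚ.<⇒<ᵇ (up 2∣i)
    ... | no 2∤i rewrite flip-2∤ (toℕ i) 2∤i = ℕₚ.<⇒<ᵇ (down 2∤i)
    back : ∀ i i′ → T (step (flip true (toℕ i)) (f i) (f i′)) → (2 ∣ toℕ i → f i < f i′) × (¬ (2 ∣ toℕ i) → f i > f i′)
    back i i′ t =
      (λ 2∣i → ℕₚ.<ᵇ⇒< _ _ (≡.subst (λ b → T (step b (f i) (f i′))) (flip-2∣ 2∣i) t)) ,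
      (λ 2∤i → ℕₚ.<ᵇ⇒< _ _ (≡.subst (λ b → T (step b (f i) (f i′))) (flip-2∤ (toℕ i) 2∤i) t))

alternating≡ : ∀ {n} (π : Word n) → does (alternating? π) ≡ alternating true (letters π)
alternating≡ π = does-⇔ (alternating⇔ π) (alternating? π) (T? _)

-- Statistics of words cut at their maximum

<ᵇ-true : ∀ {x y} → x < y → (x <ᵇ y) ≡ true
<ᵇ-true {zero}  {suc y} _         = refl
<ᵇ-true {suc x} {suc y} (s≤s x<y) = <ᵇ-true x<y

<ᵇ-false : ∀ {x y} → y ≤ x → (x <ᵇ y) ≡ false
<ᵇ-false {x}     {zero}  _         = refl
<ᵇ-false {suc x} {suc y} (s≤s y≤x) = <ᵇ-false y≤x

<ᵇ-+ : ∀ a x y → (a ℕ.+ x <ᵇ a ℕ.+ y) ≡ (x <ᵇ y)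
<ᵇ-+ zero    x y = refl
<ᵇ-+ (suc a) x y = <ᵇ-+ a x y

∧-falseʳ : ∀ b {c} → c ≡ false → b ∧ c ≡ false
∧-falseʳ true  refl = refl
∧-falseʳ false refl = refl

∧-falseˡ : ∀ {b} c → b ≡ false → b ∧ c ≡ false
∧-falseˡ c refl = refl

count-++ : ∀ p v w → count p (v ++ w) ≡ count p v ℕ.+ count p w
count-++ p []      w = refl
count-++ p (x ∷ v) w = ≡.trans (≡.cong (⟦ p x ⟧ ℕ.+_) (count-++ p v w)) (≡.sym (ℕₚ.+-assoc ⟦ p x ⟧ _ _))

count-none : ∀ p w → (∀ {x} → x ∈ w → p x ≡ false) → count p w ≡ 0
count-none p []      none = refl
count-none p (x ∷ w) none rewrite none (here refl) = count-none p w (none ∘ there)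

count-all : ∀ p w → (∀ {x} → x ∈ w → p x ≡ true) → count p w ≡ length w
count-all p []      all = refl
count-all p (x ∷ w) all rewrite all (here refl) = ≡.cong suc (count-all p w (all ∘ there))

count-cong : ∀ {p r} w → (∀ {x} → x ∈ w → p x ≡ r x) → count p w ≡ count r w
count-cong []      eq = refl
count-cong (x ∷ w) eq = ≡.cong₂ ℕ._+_ (≡.cong ⟦_⟧ (eq (here refl))) (count-cong w (eq ∘ there))

count-map : ∀ p (f : ℕ → ℕ) w → count p (map f w) ≡ count (p ∘ f) w
count-map p f []      = refl
count-map p f (x ∷ w) = ≡.cong (⟦ p (f x) ⟧ ℕ.+_) (count-map p f w)

nonempty : List ℕ → ℕ
nonempty []      = 0
nonempty (_ ∷ _) = 1

isEmpty : List ℕ → Bool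
isEmpty []      = true
isEmpty (_ ∷ _) = false

nonempty-map : ∀ (f : ℕ → ℕ) w → nonempty (map f w) ≡ nonempty w
nonempty-map f []      = refl
nonempty-map f (x ∷ w) = refl

isEmpty-map : ∀ (f : ℕ → ℕ) w → isEmpty (map f w) ≡ isEmpty w
isEmpty-map f []      = refl
isEmpty-map f (x ∷ w) = refl

-- What a maximum put in front of the word adds to 31-2.
rises : List ℕ → ℕ
rises []      = 0
rises (x ∷ w) = count (x <ᵇ_) w

-- The first hypothesis says that the letters from n on never count for a pair inside x ∷ L, the
-- second that the pair ending in n contributes c whatever letter precedes n.
adjacent-++ : ∀ p x L n R c →
  (∀ {a b} w → a ∈ x ∷ L → b ∈ x ∷ L → p a b (w ++ n ∷ R) ≡ p a b w) →
  (∀ {a} → a ∈ x ∷ L → p a n R ≡ c) →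
  adjacent p (x ∷ L ++ n ∷ R) ≡ adjacent p (x ∷ L) ℕ.+ (c ℕ.+ adjacent p (n ∷ R))
adjacent-++ p x []      n R c inside boundary = ≡.cong (ℕ._+ adjacent p (n ∷ R)) (boundary (here refl))
adjacent-++ p x (y ∷ L) n R c inside boundary = ≡.trans
  (≡.cong₂ ℕ._+_ (inside L (here refl) (there (here refl)))
    (adjacent-++ p y L n R c (λ w a∈ b∈ → inside w (there a∈) (there b∈)) (boundary ∘ there)))
  (≡.sym (ℕₚ.+-assoc (p x y L) _ _))

adjacent-map : ∀ {p r} a w → (∀ x y v → p (a ℕ.+ x) (a ℕ.+ y) (map (a ℕ.+_) v) ≡ r x y v) →
  adjacent p (map (a ℕ.+_) w) ≡ adjacent r w
adjacent-map a []          eq = refl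
adjacent-map a (x ∷ [])    eq = refl
adjacent-map a (x ∷ y ∷ w) eq = ≡.cong₂ ℕ._+_ (eq x y w) (adjacent-map a (y ∷ w) eq)

descents-map : ∀ a w → descents (map (a ℕ.+_) w) ≡ descents w
descents-map a w = adjacent-map a w λ x y _ → ≡.cong ⟦_⟧ (<ᵇ-+ a y x)

count-between-map : ∀ a x y w →
  count (λ j → (a ℕ.+ x <ᵇ j) ∧ (j <ᵇ a ℕ.+ y)) (map (a ℕ.+_) w) ≡ count (λ j → (x <ᵇ j) ∧ (j <ᵇ y)) w
count-between-map a x y w = ≡.trans (count-map _ (a ℕ.+_) w)
  (count-cong w λ {j} _ → ≡.cong₂ _∧_ (<ᵇ-+ a x j) (<ᵇ-+ a j y))

count31-2-map : ∀ a w → count31-2 (map (a ℕ.+_) w) ≡ count31-2 w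
count31-2-map a w = adjacent-map a w λ x y v → count-between-map a y x v

count13-2-map : ∀ a w → count13-2 (map (a ℕ.+_) w) ≡ count13-2 w
count13-2-map a w = adjacent-map a w λ x y v → count-between-map a x y v

rises-map : ∀ a w → rises (map (a ℕ.+_) w) ≡ rises w
rises-map a []      = refl
rises-map a (x ∷ w) = ≡.trans (count-map _ (a ℕ.+_) w) (count-cong w λ {y} _ → <ᵇ-+ a x y)

count2-31-map : ∀ a w → count2-31 (map (a ℕ.+_) w) ≡ count2-31 w
count2-31-map a []      = refl
count2-31-map a (x ∷ w) = ≡.cong₂ ℕ._+_
  (adjacent-map a w λ u v _ → ≡.cong ⟦_⟧ (≡.cong₂ _∧_ (<ᵇ-+ a v x) (<ᵇ-+ a x u)))
  (count2-31-map a w)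

step-+ : ∀ b a x y → step b (a ℕ.+ x) (a ℕ.+ y) ≡ step b x y
step-+ true  a x y = <ᵇ-+ a x y
step-+ false a x y = <ᵇ-+ a y x

alternating-map : ∀ b a w → alternating b (map (a ℕ.+_) w) ≡ alternating b w
alternating-map b a []          = refl
alternating-map b a (x ∷ [])    = refl
alternating-map b a (x ∷ y ∷ w) = ≡.cong₂ _∧_ (step-+ b a x y) (alternating-map (not b) a (y ∷ w))

straddles-none : ∀ x R → (∀ {y} → y ∈ R → y ≤ x) → straddles x R ≡ 0
straddles-none x []          R≤x = refl
straddles-none x (y ∷ [])    R≤x = refl
straddles-none x (y ∷ z ∷ R) R≤x = ≡.cong₂ ℕ._+_
  (≡.cong ⟦_⟧ (∧-falseʳ (z <ᵇ x) (<ᵇ-false (R≤x (here refl))))) (straddles-none x (z ∷ R) (R≤x ∘ there))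

module _ {n : ℕ} where

  descents-max : ∀ {R} → (∀ {y} → y ∈ R → y < n) → descents (n ∷ R) ≡ nonempty R ℕ.+ descents R
  descents-max {[]}    R<n = refl
  descents-max {y ∷ R} R<n rewrite <ᵇ-true (R<n (here refl)) = refl

  descents-++ : ∀ L {R} → (∀ {x} → x ∈ L → x < n) → (∀ {y} → y ∈ R → y < n) →
    descents (L ++ n ∷ R) ≡ descents L ℕ.+ (nonempty R ℕ.+ descents R)
  descents-++ []      L<n R<n = descents-max R<n
  descents-++ (x ∷ L) {R} L<n R<n = ≡.trans
    (adjacent-++ _ x L n R 0 (λ _ _ _ → refl) (λ a∈ → ≡.cong ⟦_⟧ (<ᵇ-false (ℕₚ.<⇒≤ (L<n a∈)))))
    (≡.cong (descents (x ∷ L) ℕ.+_) (descents-max R<n))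

  count31-2-max : ∀ {R} → (∀ {y} → y ∈ R → y < n) → count31-2 (n ∷ R) ≡ rises R ℕ.+ count31-2 R
  count31-2-max {[]}    R<n = refl
  count31-2-max {y ∷ R} R<n = ≡.cong (ℕ._+ count31-2 (y ∷ R)) (count-cong R λ {j} j∈ →
    ≡.trans (≡.cong ((y <ᵇ j) ∧_) (<ᵇ-true (R<n (there j∈)))) (∧-identityʳ (y <ᵇ j)))

  count13-2-max : ∀ {R} → (∀ {y} → y ∈ R → y < n) → count13-2 (n ∷ R) ≡ count13-2 R
  count13-2-max {[]}    R<n = refl
  count13-2-max {y ∷ R} R<n = ≡.cong (ℕ._+ count13-2 (y ∷ R)) (count-none _ R λ {j} j∈ →
    ∧-falseˡ (j <ᵇ y) (<ᵇ-false (ℕₚ.<⇒≤ (R<n (there j∈)))))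

  module _ {R : List ℕ} (R<n : ∀ {y} → y ∈ R → y < n) where

    count-between-++ : ∀ {a b} → (∀ {y} → y ∈ n ∷ R → b < y) → ∀ w →
      count (λ j → (a <ᵇ j) ∧ (j <ᵇ b)) (w ++ n ∷ R) ≡ count (λ j → (a <ᵇ j) ∧ (j <ᵇ b)) w
    count-between-++ {a} {b} b<n∷R w = ≡.trans (count-++ _ w (n ∷ R)) (≡.trans
      (≡.cong (count (λ j → (a <ᵇ j) ∧ (j <ᵇ b)) w ℕ.+_) (count-none _ (n ∷ R) λ {j} j∈ →
        ∧-falseʳ (a <ᵇ j) (<ᵇ-false (ℕₚ.<⇒≤ (b<n∷R j∈)))))
      (ℕₚ.+-identityʳ _))

    -- The letters from n on exceed every pair inside L, and the pair formed by the last letter of L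
    -- and n is an ascent; so nothing in L interacts with the rest.
    count31-2-++ : ∀ L → (∀ {x y} → x ∈ L → y ∈ n ∷ R → x < y) →
      count31-2 (L ++ n ∷ R) ≡ count31-2 L ℕ.+ (rises R ℕ.+ count31-2 R)
    count31-2-++ []      L<n∷R = count31-2-max R<n
    count31-2-++ (x ∷ L) L<n∷R = ≡.trans
      (adjacent-++ _ x L n R 0 (λ w a∈ _ → count-between-++ (L<n∷R a∈) w)
        (λ {a} _ → count-none _ R λ {j} j∈ → ∧-falseˡ (j <ᵇ a) (<ᵇ-false (ℕₚ.<⇒≤ (R<n j∈)))))
      (≡.cong (count31-2 (x ∷ L) ℕ.+_) (count31-2-max R<n))

    -- Every letter of R lies between the last letter of L and n, whence `length R` as soon as L is
    -- nonempty.
    count13-2-++ : ∀ L → (∀ {x y} → x ∈ L → y ∈ n ∷ R → x < y) →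
      count13-2 (L ++ n ∷ R) ≡ count13-2 L ℕ.+ (nonempty L ℕ.* length R ℕ.+ count13-2 R)
    count13-2-++ []      L<n∷R = count13-2-max R<n
    count13-2-++ (x ∷ L) L<n∷R = ≡.trans
      (adjacent-++ _ x L n R (length R) (λ w _ b∈ → count-between-++ (L<n∷R b∈) w)
        (λ a∈ → count-all _ R λ {j} j∈ → ≡.cong₂ _∧_ (<ᵇ-true (L<n∷R a∈ (there j∈))) (<ᵇ-true (R<n j∈))))
      (≡.cong (count13-2 (x ∷ L) ℕ.+_) (≡.cong₂ ℕ._+_ (≡.sym (ℕₚ.+-identityʳ (length R))) (count13-2-max R<n)))

    -- All of n ∷ R exceeds the first letter of a nonempty L. The `suc` counts n itself and causes
    -- the extra q in the equation of H⁺.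
    rises-++ : ∀ L → (∀ {x y} → x ∈ L → y ∈ n ∷ R → x < y) →
      rises (L ++ n ∷ R) ≡ rises L ℕ.+ nonempty L ℕ.* suc (length R)
    rises-++ []      L<n∷R = count-none _ R λ y∈ → <ᵇ-false (ℕₚ.<⇒≤ (R<n y∈))
    rises-++ (x ∷ L) L<n∷R = ≡.trans (count-++ _ L (n ∷ R)) (≡.cong (count (x <ᵇ_) L ℕ.+_)
      (≡.trans (count-all _ (n ∷ R) λ y∈ → <ᵇ-true (L<n∷R (here refl) y∈)) (≡.sym (ℕₚ.+-identityʳ _))))

  foremaximumFree-below : ∀ {M} R → (∀ {y} → y ∈ R → y < n) → n ≤ M → foremaximumFree M R ≡ true
  foremaximumFree-below []      R<n n≤M = refl
  foremaximumFree-below {M} (y ∷ R) R<n n≤M =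
    ≡.cong₂ _∧_ (≡.cong (λ b → not (b ∧ startsAbove y R)) (≤ᵇ-false (ℕₚ.<-≤-trans (R<n (here refl)) n≤M)))
      (foremaximumFree-below R (R<n ∘ there) (ℕₚ.≤-trans n≤M (ℕₚ.m≤m⊔n M y)))
    where
    ≤ᵇ-false : ∀ {x y} → y < x → (x ≤ᵇ y) ≡ false
    ≤ᵇ-false {suc x} (s≤s y≤x) = <ᵇ-false y≤x

  -- For the last letter of L, n plays the role of the conventional larger letter; n itself is a
  -- foremaximum exactly when it comes last; behind n there is no left-to-right maximum.
  foremaximumFree-++ : ∀ {M} L R → (∀ {x} → x ∈ L → x < n) → (∀ {y} → y ∈ R → y < n) → M ≤ n →
    foremaximumFree M (L ++ n ∷ R) ≡ foremaximumFree M L ∧ not (isEmpty R)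
  foremaximumFree-++ {M} [] R L<n R<n M≤n = ≡.trans
    (≡.cong₂ _∧_ (≡.cong₂ (λ b c → not (b ∧ c)) (≤ᵇ-true M≤n) (startsAbove-max R R<n))
      (foremaximumFree-below R R<n (ℕₚ.m≤n⊔m M n)))
    (∧-identityʳ _)
    where
    ≤ᵇ-true : ∀ {x y} → x ≤ y → (x ≤ᵇ y) ≡ true
    ≤ᵇ-true {zero}  _   = refl
    ≤ᵇ-true {suc x} x<y = <ᵇ-true x<y
    startsAbove-max : ∀ R → (∀ {y} → y ∈ R → y < n) → startsAbove n R ≡ isEmpty R
    startsAbove-max []      R<n = refl
    startsAbove-max (y ∷ R) R<n = <ᵇ-false (ℕₚ.<⇒≤ (R<n (here refl)))
  foremaximumFree-++ {M} (x ∷ L) R L<n R<n M≤n = ≡.trans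
    (≡.cong₂ _∧_ (≡.cong (λ b → not ((M ≤ᵇ x) ∧ b)) (startsAbove-++ L))
      (foremaximumFree-++ L R (L<n ∘ there) R<n (ℕₚ.⊔-lub M≤n (ℕₚ.<⇒≤ (L<n (here refl))))))
    (≡.sym (∧-assoc (not ((M ≤ᵇ x) ∧ startsAbove x L)) _ _))
    where
    startsAbove-++ : ∀ L → startsAbove x (L ++ n ∷ R) ≡ startsAbove x L
    startsAbove-++ []      = <ᵇ-true (L<n (here refl))
    startsAbove-++ (y ∷ L) = refl

  alternating-max : ∀ {R} → (∀ {y} → y ∈ R → y < n) → alternating false (n ∷ R) ≡ alternating true R
  alternating-max {[]}    R<n = refl
  alternating-max {y ∷ R} R<n rewrite <ᵇ-true (R<n (here refl)) = refl

  alternating-max-first : ∀ {R} → (∀ {y} → y ∈ R → y < n) → alternating true (n ∷ R) ≡ isEmpty R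
  alternating-max-first {[]}    R<n = refl
  alternating-max-first {y ∷ R} R<n rewrite <ᵇ-false (ℕₚ.<⇒≤ (R<n (here refl))) = refl

  straddles-max : ∀ x R → x < n → (∀ {y} → y ∈ R → y < x) → straddles x (n ∷ R) ≡ nonempty R
  straddles-max x []      x<n R<x = refl
  straddles-max x (y ∷ R) x<n R<x = ≡.cong₂ ℕ._+_
    (≡.cong ⟦_⟧ (≡.cong₂ _∧_ (<ᵇ-true (R<x (here refl))) (<ᵇ-true x<n)))
    (straddles-none x (y ∷ R) (ℕₚ.<⇒≤ ∘ R<x))

  module _ {R : List ℕ} (R<n : ∀ {y} → y ∈ R → y < n) where

    -- The step into n has to be an ascent; for b = `true` this makes the length of x ∷ L odd. The
    -- step out of n is then a descent of its own accord, and R begins with an ascent again.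
    alternating-++ : ∀ b x L → (∀ {u} → u ∈ x ∷ L → u < n) →
      alternating b (x ∷ L ++ n ∷ R) ≡ alternating b (x ∷ L) ∧ (flip b (length L) ∧ alternating true R)
    alternating-++ true  x []      L<n = ≡.cong₂ _∧_ (<ᵇ-true (L<n (here refl))) (alternating-max R<n)
    alternating-++ false x []      L<n = ≡.cong (_∧ alternating true (n ∷ R)) (<ᵇ-false (ℕₚ.<⇒≤ (L<n (here refl))))
    alternating-++ b     x (y ∷ L) L<n = ≡.trans
      (≡.cong (step b x y ∧_) (alternating-++ (not b) y L (L<n ∘ there)))
      (≡.sym (∧-assoc (step b x y) _ _))

    -- All of L lies between n and the first letter of R, so each letter of L gains one occurrence
    -- if R is nonempty. Descents inside R lie entirely below L.
    count2-31-++ : ∀ L → (∀ {x} → x ∈ L → x < n) → (∀ {x y} → x ∈ L → y ∈ R → y < x) →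
      count2-31 (L ++ n ∷ R) ≡ count2-31 L ℕ.+ (nonempty R ℕ.* length L ℕ.+ count2-31 R)
    count2-31-++ []      L<n R<L = ≡.cong₂ ℕ._+_
      (≡.trans (straddles-none n R (ℕₚ.<⇒≤ ∘ R<n)) (≡.sym (ℕₚ.*-zeroʳ (nonempty R)))) refl
    count2-31-++ (x ∷ L) L<n R<L = ≡.trans
      (≡.cong₂ ℕ._+_ (straddles-++ L (L<n ∘ there)) (count2-31-++ L (L<n ∘ there) (R<L ∘ there)))
      (≡.trans (+-interchange (straddles x L) (nonempty R) (count2-31 L) _)
        (≡.cong (straddles x L ℕ.+ count2-31 L ℕ.+_)
          (≡.trans (≡.sym (ℕₚ.+-assoc (nonempty R) (nonempty R ℕ.* length L) (count2-31 R)))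
            (≡.cong (ℕ._+ count2-31 R) (≡.sym (ℕₚ.*-suc (nonempty R) (length L)))))))
      where
      straddles-++ : ∀ L → (∀ {u} → u ∈ L → u < n) → straddles x (L ++ n ∷ R) ≡ straddles x L ℕ.+ nonempty R
      straddles-++ []      _    = straddles-max x R (L<n (here refl)) (R<L (here refl))
      straddles-++ (u ∷ L) L′<n = ≡.trans
        (adjacent-++ _ u L n R 0 (λ _ _ _ → refl)
          (λ {a} _ → ≡.cong ⟦_⟧ (∧-falseˡ (x <ᵇ a) (<ᵇ-false (ℕₚ.<⇒≤ (L<n (here refl)))))))
        (≡.cong (straddles x (u ∷ L) ℕ.+_) (straddles-max x R (L<n (here refl)) (R<L (here refl))))

module 231-Avoiding {k m : ℕ} {L R : List ℕ}
  (L-good : Decomposition.Good separation231 k L) (R-good : Decomposition.Good separation231 m R) where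
  open Decomposition separation231

  private
    R′ : List ℕ
    R′ = map (k ℕ.+_) R

    J≡ : join k m L R ≡ L ++ (k ℕ.+ m) ∷ R′
    J≡ = ≡.cong (_++ (k ℕ.+ m) ∷ R′) (Listₚ.map-id L)

    L<n : ∀ {x} → x ∈ L → x < k ℕ.+ m
    L<n x∈ = ℕₚ.<-≤-trans (Good-< L-good x∈) (ℕₚ.m≤m+n k m)

    R<n : ∀ {y} → y ∈ R′ → y < k ℕ.+ m
    R<n = right-< L-good R-good

    L<n∷R : ∀ {x y} → x ∈ L → y ∈ (k ℕ.+ m) ∷ R′ → x < y
    L<n∷R x∈ (here refl) = L<n x∈
    L<n∷R x∈ (there y∈) with _ , _ , refl ← ∈-map⁻ (k ℕ.+_) y∈ = ℕₚ.<-≤-trans (Good-< L-good x∈) (ℕₚ.m≤m+n k _)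

  descents-join : descents (join k m L R) ≡ descents L ℕ.+ (nonempty R ℕ.+ descents R)
  descents-join = ≡.trans (≡.cong descents J≡) (≡.trans (descents-++ L L<n R<n)
    (≡.cong (descents L ℕ.+_) (≡.cong₂ ℕ._+_ (nonempty-map (k ℕ.+_) R) (descents-map k R))))

  count31-2-join : count31-2 (join k m L R) ≡ count31-2 L ℕ.+ (rises R ℕ.+ count31-2 R)
  count31-2-join = ≡.trans (≡.cong count31-2 J≡) (≡.trans (count31-2-++ R<n L L<n∷R)
    (≡.cong (count31-2 L ℕ.+_) (≡.cong₂ ℕ._+_ (rises-map k R) (count31-2-map k R))))

  count13-2-join : count13-2 (join k m L R) ≡ count13-2 L ℕ.+ (nonempty L ℕ.* length R ℕ.+ count13-2 R)
  count13-2-join = ≡.trans (≡.cong count13-2 J≡) (≡.trans (count13-2-++ R<n L L<n∷R)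
    (≡.cong (count13-2 L ℕ.+_) (≡.cong₂ ℕ._+_ (≡.cong (nonempty L ℕ.*_) (Listₚ.length-map (k ℕ.+_) R)) (count13-2-map k R))))

  rises-join : rises (join k m L R) ≡ rises L ℕ.+ nonempty L ℕ.* suc (length R)
  rises-join = ≡.trans (≡.cong rises J≡) (≡.trans (rises-++ R<n L L<n∷R)
    (≡.cong (λ r → rises L ℕ.+ nonempty L ℕ.* suc r) (Listₚ.length-map (k ℕ.+_) R)))

  foremaximumFree-join : foremaximumFree 0 (join k m L R) ≡ foremaximumFree 0 L ∧ not (isEmpty R)
  foremaximumFree-join = ≡.trans (≡.cong (foremaximumFree 0) J≡) (≡.trans (foremaximumFree-++ L R′ L<n R<n z≤n)
    (≡.cong (λ b → foremaximumFree 0 L ∧ not b) (isEmpty-map (k ℕ.+_) R)))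

module 132-Avoiding {k m : ℕ} {L R : List ℕ}
  (L-good : Decomposition.Good separation132 k L) (R-good : Decomposition.Good separation132 m R) where
  open Decomposition separation132

  private
    L′ : List ℕ
    L′ = map (m ℕ.+_) L

    J≡ : join k m L R ≡ L′ ++ (k ℕ.+ m) ∷ R
    J≡ = ≡.cong (λ v → L′ ++ (k ℕ.+ m) ∷ v) (Listₚ.map-id R)

    L<n : ∀ {x} → x ∈ L′ → x < k ℕ.+ m
    L<n = left-< L-good R-good

    R<n : ∀ {y} → y ∈ R → y < k ℕ.+ m
    R<n y∈ = ℕₚ.<-≤-trans (Good-< R-good y∈) (ℕₚ.m≤n+m m k)

    R<L : ∀ {x y} → x ∈ L′ → y ∈ R → y < x
    R<L x∈ y∈ with _ , _ , refl ← ∈-map⁻ (m ℕ.+_) x∈ = ℕₚ.<-≤-trans (Good-< R-good y∈) (ℕₚ.m≤m+n m _)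

  count2-31-join : count2-31 (join k m L R) ≡ count2-31 L ℕ.+ (nonempty R ℕ.* length L ℕ.+ count2-31 R)
  count2-31-join = ≡.trans (≡.cong count2-31 J≡) (≡.trans (count2-31-++ R<n L′ L<n R<L)
    (≡.cong₂ (λ a b → a ℕ.+ (nonempty R ℕ.* b ℕ.+ count2-31 R)) (count2-31-map m L) (Listₚ.length-map (m ℕ.+_) L)))

  -- If L is empty, the word starts with its maximum and cannot ascend, so R has to be empty too.
  alternating-join : alternating true (join k m L R) ≡
    (if isEmpty L then isEmpty R else alternating true L ∧ (flip false (length L) ∧ alternating true R))
  alternating-join = ≡.trans (≡.cong (alternating true) J≡) (go L L<n)
    where
    go : ∀ L → (∀ {x} → x ∈ map (m ℕ.+_) L → x < k ℕ.+ m) → alternating true (map (m ℕ.+_) L ++ (k ℕ.+ m) ∷ R) ≡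
      (if isEmpty L then isEmpty R else alternating true L ∧ (flip false (length L) ∧ alternating true R))
    go []      L<n = alternating-max-first R<n
    go (x ∷ L) L<n = ≡.trans (alternating-++ R<n true (m ℕ.+ x) (map (m ℕ.+_) L) L<n)
      (≡.cong₂ (λ a b → a ∧ (flip true b ∧ alternating true R)) (alternating-map true m (x ∷ L)) (Listₚ.length-map (m ℕ.+_) L))

-- Generating functions

module Sums {c ℓ} (R : CommutativeRing c ℓ) where
  open CommutativeRing R hiding (zero; refl) renaming (sym to ≈-sym; trans to ≈-trans)
  open InRing R
  open PowerSeries R
  private
    ≈-refl : ∀ {x} → x ≈ x
    ≈-refl = CommutativeRing.refl R
    open module RS = Algebra.Solver.Ring.NaturalCoefficients.Default commutativeSemiring
      using (solve; _:=_; _:+_; _:*_; con)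

  ∑-cong : ∀ {a} {A : Set a} (xs : List A) {f g : A → Carrier} → (∀ {x} → x ∈ xs → f x ≈ g x) → ∑ xs f ≈ ∑ xs g
  ∑-cong []       eq = ≈-refl
  ∑-cong (x ∷ xs) eq = +-cong (eq (here refl)) (∑-cong xs (eq ∘ there))

  ∑-zero : ∀ {a} {A : Set a} (xs : List A) {f : A → Carrier} → (∀ {x} → x ∈ xs → f x ≈ 0#) → ∑ xs f ≈ 0#
  ∑-zero []       eq = ≈-refl
  ∑-zero (x ∷ xs) eq = ≈-trans (+-cong (eq (here refl)) (∑-zero xs (eq ∘ there))) (+-identityˡ _)

  ∑-+ : ∀ {a} {A : Set a} (xs : List A) (f g : A → Carrier) → ∑ xs (λ x → f x + g x) ≈ ∑ xs f + ∑ xs g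
  ∑-+ []       f g = ≈-sym (+-identityˡ _)
  ∑-+ (x ∷ xs) f g = ≈-trans (+-congˡ (∑-+ xs f g))
    (solve 4 (λ a b c d → (a :+ b) :+ (c :+ d) := (a :+ c) :+ (b :+ d)) ≈-refl _ _ _ _)

  ∑-*ˡ : ∀ {a} {A : Set a} (xs : List A) r (f : A → Carrier) → ∑ xs (λ x → r * f x) ≈ r * ∑ xs f
  ∑-*ˡ []       r f = ≈-sym (zeroʳ _)
  ∑-*ˡ (x ∷ xs) r f = ≈-trans (+-congˡ (∑-*ˡ xs r f)) (≈-sym (distribˡ _ _ _))

  ∑-*ʳ : ∀ {a} {A : Set a} (xs : List A) r (f : A → Carrier) → ∑ xs (λ x → f x * r) ≈ ∑ xs f * r
  ∑-*ʳ xs r f = ≈-trans (∑-cong xs λ _ → *-comm _ _) (≈-trans (∑-*ˡ xs r f) (*-comm _ _))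

  ∑-++ : ∀ {a} {A : Set a} (xs ys : List A) (f : A → Carrier) → ∑ (xs ++ ys) f ≈ ∑ xs f + ∑ ys f
  ∑-++ []       ys f = ≈-sym (+-identityˡ _)
  ∑-++ (x ∷ xs) ys f = ≈-trans (+-congˡ (∑-++ xs ys f)) (≈-sym (+-assoc _ _ _))

  ∑-concatMap : ∀ {a b} {A : Set a} {B : Set b} (g : A → List B) xs (f : B → Carrier) →
    ∑ (concatMap g xs) f ≈ ∑ xs (λ x → ∑ (g x) f)
  ∑-concatMap g []       f = ≈-refl
  ∑-concatMap g (x ∷ xs) f = ≈-trans (∑-++ (g x) (concatMap g xs) f) (+-congˡ (∑-concatMap g xs f))

  ∑-map : ∀ {a b} {A : Set a} {B : Set b} (g : A → B) xs (f : B → Carrier) → ∑ (map g xs) f ≈ ∑ xs (f ∘ g)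
  ∑-map g []       f = ≈-refl
  ∑-map g (x ∷ xs) f = +-congˡ (∑-map g xs f)

  ∑-↭ : ∀ {a} {A : Set a} {xs ys : List A} (f : A → Carrier) → xs ↭ ys → ∑ xs f ≈ ∑ ys f
  ∑-↭ f ↭.refl         = ≈-refl
  ∑-↭ f (↭.prep x p)   = +-congˡ (∑-↭ f p)
  ∑-↭ f (↭.swap x y p) = ≈-trans (+-congˡ (+-congˡ (∑-↭ f p)))
    (solve 3 (λ a b c → a :+ (b :+ c) := b :+ (a :+ c)) ≈-refl _ _ _)
  ∑-↭ f (↭.trans p r)  = ≈-trans (∑-↭ f p) (∑-↭ f r)

  ∑-filter : ∀ {a p} {A : Set a} {P : A → Set p} (P? : Decidable P) xs (f : A → Carrier) →
    ∑ (filter P? xs) f ≈ ∑ xs (λ x → if does (P? x) then f x else 0#)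
  ∑-filter P? []       f = ≈-refl
  ∑-filter P? (x ∷ xs) f with does (P? x)
  ... | true  = +-congˡ (∑-filter P? xs f)
  ... | false = ≈-trans (∑-filter P? xs f) (≈-sym (+-identityˡ _))

  ∑-antidiagonal : ∀ (f g : Series) n → ∑ (antidiagonal n) (λ (k , m) → f k * g m) ≈ (f ⊛ g) n
  ∑-antidiagonal f g zero    = +-identityʳ _
  ∑-antidiagonal f g (suc n) = +-congˡ (≈-trans (∑-map (map₁ suc) (antidiagonal n) (λ (k , m) → f k * g m))
    (∑-antidiagonal (f ∘ suc) g n))

  ε : List ℕ → Carrier
  ε w = if isEmpty w then 1# else 0#

  onNonempty : (List ℕ → Carrier) → List ℕ → Carrier
  onNonempty f w = if isEmpty w then 0# else f w

  module GeneratingFunction (S : Separation) (E : Decomposition.Enumeration S) where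
    open Decomposition S
    open Decomposition.Enumeration E

    list-zero : list 0 ≡ [] ∷ []
    list-zero = go (list 0) (unique 0) (λ w∈ → ↭-empty-inv (proj₁ (sound w∈))) (complete (↭-refl , λ ()))
      where
      go : ∀ ws → Unique ws → (∀ {w} → w ∈ ws → w ≡ []) → [] ∈ ws → ws ≡ [] ∷ []
      go (w ∷ [])     _             eq _ = ≡.cong (_∷ []) (eq (here refl))
      go (w ∷ v ∷ ws) ((w≢v ∷ _) ∷ _) eq _ = contradiction (≡.trans (eq (here refl)) (≡.sym (eq (there (here refl))))) w≢v

    gf : (List ℕ → Carrier) → Series
    gf f n = ∑ (list n) f

    gf-cong : ∀ {f g} → (∀ {n w} → Good n w → f w ≈ g w) → gf f ≋ gf g
    gf-cong eq n = ∑-cong (list n) λ w∈ → eq (sound w∈)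

    gf-zero : ∀ f → gf f 0 ≈ f []
    gf-zero f = ≈-trans (reflexive (≡.cong (λ ws → ∑ ws f) list-zero)) (+-identityʳ _)

    gf-+ : ∀ f g → gf (λ w → f w + g w) ≋ (gf f ⊕ gf g)
    gf-+ f g n = ∑-+ (list n) f g

    gf-κ : ∀ a f → gf (λ w → a * f w) ≋ (κ a ⊛ gf f)
    gf-κ a f n = ≈-trans (∑-*ˡ (list n) a f) (≈-sym (κ⊛ a (gf f) n))

    gf-scale : ∀ q f → gf (λ w → q ^ length w * f w) ≋ scale q (gf f)
    gf-scale q f n = ≈-trans (∑-cong (list n) λ {w} w∈ →
      *-congʳ (reflexive (≡.cong (q ^_) (Good-length (sound w∈))))) (∑-*ˡ (list n) (q ^ n) f)

    isEmpty-suc : ∀ {n w} → w ∈ list (suc n) → isEmpty w ≡ false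
    isEmpty-suc {w = []}    w∈ with () ← Good-length (sound w∈)
    isEmpty-suc {w = _ ∷ _} w∈ = refl

    gf-ε : gf ε ≋ one
    gf-ε zero    = gf-zero ε
    gf-ε (suc n) = ∑-zero (list (suc n)) λ w∈ → reflexive (≡.cong (if_then 1# else 0#) (isEmpty-suc w∈))

    gf-onNonempty-suc : ∀ f n → gf (onNonempty f) (suc n) ≈ gf f (suc n)
    gf-onNonempty-suc f n = ∑-cong (list (suc n)) λ {w} w∈ →
      reflexive (≡.cong (if_then 0# else f w) (isEmpty-suc w∈))

    gf-onNonempty : ∀ f → gf (onNonempty f) ≋ (z ⊛ (gf f ∘ suc))
    gf-onNonempty f = z⊛-unfold (gf-zero (onNonempty f)) (gf-onNonempty-suc f)

    gf-split : ∀ f → f [] ≈ 1# → gf f ≋ (one ⊕ (z ⊛ (gf f ∘ suc)))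
    gf-split f f[]≈1 zero    = ≈-trans (≈-trans (gf-zero f) f[]≈1)
      (≈-sym (≈-trans (+-congˡ (z⊛-zero (gf f ∘ suc))) (+-identityʳ _)))
    gf-split f f[]≈1 (suc n) = ≈-sym (≈-trans (+-identityˡ _) (z⊛-suc (gf f ∘ suc) n))

    ⨁ : (List ℕ → List ℕ → Carrier) → Series
    ⨁ F n = ∑ (antidiagonal n) λ (k , m) → ∑ (list k) λ L → ∑ (list m) λ R → F L R

    ⨁-+ : ∀ F G → ⨁ (λ L R → F L R + G L R) ≋ (⨁ F ⊕ ⨁ G)
    ⨁-+ F G n = ≈-trans (∑-cong (antidiagonal n) λ {(k , m)} _ →
      ≈-trans (∑-cong (list k) λ {L} _ → ∑-+ (list m) (F L) (G L)) (∑-+ (list k) _ _)) (∑-+ (antidiagonal n) _ _)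

    ⨁-* : ∀ g h → ⨁ (λ L R → g L * h R) ≋ (gf g ⊛ gf h)
    ⨁-* g h n = ≈-trans (∑-cong (antidiagonal n) λ {(k , m)} _ →
      ≈-trans (∑-cong (list k) λ {L} _ → ∑-*ˡ (list m) (g L) h) (∑-*ʳ (list k) (∑ (list m) h) g))
      (∑-antidiagonal (gf g) (gf h) n)

    -- Turns a formula for the weight of a cut word into an equation of series; the shift by `suc`
    -- accounts for the maximum, which belongs to neither part.
    gf-join : ∀ f F → (∀ {k m L R} → Good k L → Good m R → f (join k m L R) ≈ F L R) → (gf f ∘ suc) ≋ ⨁ F
    gf-join f F eq n = begin
      ∑ (list (suc n)) f
        ≈⟨ ∑-↭ f (list-suc-↭ n) ⟩
      ∑ (concatMap joins (antidiagonal n)) f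
        ≈⟨ ∑-concatMap joins (antidiagonal n) f ⟩
      ∑ (antidiagonal n) (λ km → ∑ (joins km) f)
        ≈⟨ ∑-cong (antidiagonal n) (λ { {k , m} _ → ≈-trans (∑-concatMap _ (list k) f) (∑-cong (list k) λ {L} L∈ →
             ≈-trans (∑-concatMap _ (list m) f) (∑-cong (list m) λ {R} R∈ →
               ≈-trans (+-identityʳ _) (eq (sound L∈) (sound R∈)))) }) ⟩
      ⨁ F n ∎
      where open Relation.Binary.Reasoning.Setoid setoid

-- From the cut at the maximum to functional equations

module WeightedSums {c ℓ} (R : CommutativeRing c ℓ) where
  open CommutativeRing R hiding (zero; refl) renaming (sym to ≈-sym; trans to ≈-trans)
  open InRing R
  open PowerSeries R
  open Sums R
  private
    ≈-refl : ∀ {x} → x ≈ x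
    ≈-refl = CommutativeRing.refl R
    open module RS = Algebra.Solver.Ring.NaturalCoefficients.Default commutativeSemiring
      using (solve; _:=_; _:+_; _:*_; con)
    module S = CommutativeRing seriesRing
    module Exp = Algebra.Properties.Semiring.Exp semiring

  power³ : ∀ x {e} a b c → e ≡ a ℕ.+ (b ℕ.+ c) → x ^ e ≈ x ^ a * (x ^ b * x ^ c)
  power³ x a b c refl = ≈-trans (Exp.^-homo-* x a (b ℕ.+ c)) (*-congˡ (Exp.^-homo-* x b c))

  power² : ∀ x {e} a b → e ≡ a ℕ.+ b → x ^ e ≈ x ^ a * x ^ b
  power² x a b refl = Exp.^-homo-* x a b

  module Weights231 (q t : Carrier) where
    open Decomposition separation231
    open GeneratingFunction separation231 (enumeration separation231 avoids231? avoids231⇔) public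
    open 231-Avoiding

    a g h : List ℕ → Carrier
    a w = t ^ descents w * q ^ count13-2 w
    g w = t ^ descents w * q ^ count31-2 w
    h w = g w * q ^ rises w

    -- The descent created by the maximum in front of a nonempty word.
    afterMax : (List ℕ → Carrier) → List ℕ → Carrier
    afterMax f w = t ^ nonempty w * f w

    onCoderangements : (List ℕ → Carrier) → List ℕ → Carrier
    onCoderangements f w = if foremaximumFree 0 w then f w else 0#

    gf-afterMax : ∀ f → f [] ≈ 1# → gf (afterMax f) ≋ (one ⊕ (κ t ⊛ (z ⊛ (gf f ∘ suc))))
    gf-afterMax f f[]≈1 = S.trans (gf-cong λ {_} {w} _ → split w) (S.trans (gf-+ ε (λ w → t * onNonempty f w))
      (S.+-cong gf-ε (S.trans (gf-κ t (onNonempty f)) (S.*-congˡ (gf-onNonempty f)))))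
      where
      split : ∀ w → afterMax f w ≈ ε w + t * onNonempty f w
      split []      = ≈-trans (*-cong ≈-refl f[]≈1) (solve 1 (λ t → con 1 :* con 1 := con 1 :+ t :* con 0) ≈-refl t)
      split (x ∷ w) = solve 2 (λ t f → (t :* con 1) :* f := con 0 :+ t :* f) ≈-refl t _

    a[]≈1 : a [] ≈ 1#
    a[]≈1 = *-identityˡ _

    h[]≈1 : h [] ≈ 1#
    h[]≈1 = ≈-trans (*-identityʳ _) (*-identityˡ _)

    a-join : ∀ {k m L R} → Good k L → Good m R →
      a (join k m L R) ≈ a L * (q ^ (nonempty L ℕ.* length R) * afterMax a R)
    a-join {L = L} {R} gL gR = ≈-trans
      (*-cong (power³ t (descents L) (nonempty R) (descents R) (descents-join gL gR))
              (power³ q (count13-2 L) (nonempty L ℕ.* length R) (count13-2 R) (count13-2-join gL gR)))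
      (solve 6 (λ dL nR dR cL e cR → (dL :* (nR :* dR)) :* (cL :* (e :* cR)) := (dL :* cL) :* (e :* (nR :* (dR :* cR))))
        ≈-refl _ _ _ _ _ _)

    g-join : ∀ {k m L R} → Good k L → Good m R → g (join k m L R) ≈ g L * afterMax h R
    g-join {L = L} {R} gL gR = ≈-trans
      (*-cong (power³ t (descents L) (nonempty R) (descents R) (descents-join gL gR))
              (power³ q (count31-2 L) (rises R) (count31-2 R) (count31-2-join gL gR)))
      (solve 6 (λ dL nR dR cL r cR → (dL :* (nR :* dR)) :* (cL :* (r :* cR)) := (dL :* cL) :* (nR :* ((dR :* cR) :* r)))
        ≈-refl _ _ _ _ _ _)

    h-join : ∀ {k m L R} → Good k L → Good m R →
      h (join k m L R) ≈ h L * (q ^ (nonempty L ℕ.* suc (length R)) * afterMax h R)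
    h-join {L = L} {R} gL gR = ≈-trans
      (*-cong (g-join gL gR) (power² q (rises L) _ (rises-join gL gR)))
      (solve 4 (λ g h r e → (g :* h) :* (r :* e) := (g :* r) :* (e :* h)) ≈-refl _ _ _ _)

    A G H Ã H̃ : Series
    A = gf a
    G = gf g
    H = gf h
    Ã = gf (afterMax a)
    H̃ = gf (afterMax h)

    -- The exponent `nonempty L * length R` couples the two parts. Separating the case of an empty L
    -- leaves two terms, each a product of a weight of L and a weight of R.
    A-equation : (A ∘ suc) ≋ (Ã ⊕ ((z ⊛ (A ∘ suc)) ⊛ scale q Ã))
    A-equation = S.trans
      (gf-join a (λ L R → ε L * afterMax a R + onNonempty a L * (q ^ length R * afterMax a R)) λ {_} {_} {L} {R} gL gR →
        ≈-trans (a-join gL gR) (split L R))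
      (S.trans (⨁-+ (λ L R → ε L * afterMax a R) _)
        (S.+-cong (S.trans (⨁-* ε (afterMax a)) (S.trans (S.*-congʳ gf-ε) (S.*-identityˡ Ã)))
          (S.trans (⨁-* (onNonempty a) _) (S.*-cong (gf-onNonempty a) (gf-scale q (afterMax a))))))
      where
      split : ∀ L R → a L * (q ^ (nonempty L ℕ.* length R) * afterMax a R)
        ≈ ε L * afterMax a R + onNonempty a L * (q ^ length R * afterMax a R)
      split []      R = solve 2 (λ x p → (con 1 :* con 1) :* (con 1 :* x) := con 1 :* x :+ con 0 :* (p :* x)) ≈-refl _ _
      split (x ∷ L) R = ≈-trans (*-congˡ (*-congʳ (reflexive (≡.cong (q ^_) (ℕₚ.+-identityʳ (length R))))))
        (solve 3 (λ y p x → y :* (p :* x) := con 0 :* x :+ y :* (p :* x)) ≈-refl _ _ _)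

    G-equation : (G ∘ suc) ≋ (G ⊛ H̃)
    G-equation = S.trans (gf-join g (λ L R → g L * afterMax h R) g-join) (⨁-* g (afterMax h))

    H-equation : (H ∘ suc) ≋ (H̃ ⊕ (κ q ⊛ ((z ⊛ (H ∘ suc)) ⊛ scale q H̃)))
    H-equation = S.trans
      (gf-join h (λ L R → ε L * afterMax h R + (q * onNonempty h L) * (q ^ length R * afterMax h R)) λ {_} {_} {L} {R} gL gR →
        ≈-trans (h-join gL gR) (split L R))
      (S.trans (⨁-+ (λ L R → ε L * afterMax h R) _)
        (S.+-cong (S.trans (⨁-* ε (afterMax h)) (S.trans (S.*-congʳ gf-ε) (S.*-identityˡ H̃)))
          (S.trans (⨁-* (λ L → q * onNonempty h L) _)
            (S.trans (S.*-cong (S.trans (gf-κ q (onNonempty h)) (S.*-congˡ (gf-onNonempty h))) (gf-scale q (afterMax h)))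
              (S.*-assoc (κ q) (z ⊛ (H ∘ suc)) (scale q H̃))))))
      where
      split : ∀ L R → h L * (q ^ (nonempty L ℕ.* suc (length R)) * afterMax h R)
        ≈ ε L * afterMax h R + (q * onNonempty h L) * (q ^ length R * afterMax h R)
      split []      R = solve 3 (λ q x p → (con 1 :* con 1 :* con 1) :* (con 1 :* x) := con 1 :* x :+ (q :* con 0) :* (p :* x)) ≈-refl _ _ _
      split (x ∷ L) R = ≈-trans (*-congˡ (*-congʳ (reflexive (≡.cong (q ^_) (ℕₚ.+-identityʳ (suc (length R)))))))
        (solve 4 (λ q y p x → y :* ((q :* p) :* x) := con 0 :* x :+ (q :* y) :* (p :* x)) ≈-refl _ _ _ _)

    coderangement-join : ∀ f {k m L R y} → Good k L → Good m R → f (join k m L R) ≈ f L * y →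
      onCoderangements f (join k m L R) ≈ onCoderangements f L * (if isEmpty R then 0# else y)
    coderangement-join f {k} {m} {L} {R} {y} gL gR eq = ≈-trans
      (reflexive (≡.cong (if_then f (join k m L R) else 0#) (foremaximumFree-join gL gR)))
      (go (foremaximumFree 0 L) (isEmpty R))
      where
      go : ∀ b c → (if b ∧ not c then f (join k m L R) else 0#) ≈ (if b then f L else 0#) * (if c then 0# else y)
      go true  true  = ≈-sym (zeroʳ _)
      go true  false = eq
      go false c     = ≈-sym (zeroˡ _)

    D-equation : (gf (onCoderangements g) ∘ suc) ≋ (gf (onCoderangements g) ⊛ (κ t ⊛ (z ⊛ (H ∘ suc))))
    D-equation = S.trans
      (gf-join (onCoderangements g) (λ L R → onCoderangements g L * (t * onNonempty h R)) λ {_} {_} {L} {R} gL gR →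
        ≈-trans (coderangement-join g gL gR (g-join gL gR)) (*-congˡ (nonempty-part R)))
      (S.trans (⨁-* (onCoderangements g) _) (S.*-congˡ (S.trans (gf-κ t (onNonempty h)) (S.*-congˡ (gf-onNonempty h)))))
      where
      nonempty-part : ∀ R → (if isEmpty R then 0# else afterMax h R) ≈ t * onNonempty h R
      nonempty-part []      = ≈-sym (zeroʳ _)
      nonempty-part (x ∷ R) = *-congʳ (*-identityʳ _)

    D* : Series
    D* = gf (onCoderangements a)

    -- The exponent is separated as for A; since R must be nonempty, Ã is cut down to t A⁺.
    D*-equation : (D* ∘ suc) ≋ ((κ t ⊛ (z ⊛ (A ∘ suc))) ⊕ ((z ⊛ (D* ∘ suc)) ⊛ scale q (κ t ⊛ (z ⊛ (A ∘ suc)))))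
    D*-equation = S.trans
      (gf-join (onCoderangements a)
        (λ L R → ε L * tail R + onNonempty (onCoderangements a) L * (q ^ length R * tail R)) λ {_} {_} {L} {R} gL gR →
        ≈-trans (coderangement-join a gL gR (a-join gL gR)) (split L R))
      (S.trans (⨁-+ (λ L R → ε L * tail R) _)
        (S.+-cong (S.trans (⨁-* ε tail) (S.trans (S.*-congʳ gf-ε) (S.trans (S.*-identityˡ (gf tail)) gf-tail)))
          (S.trans (⨁-* (onNonempty (onCoderangements a)) _)
            (S.*-cong (gf-onNonempty (onCoderangements a)) (S.trans (gf-scale q tail) (scale-cong q gf-tail))))))
      where
      tail : List ℕ → Carrier
      tail R = t * onNonempty a R
      gf-tail : gf tail ≋ (κ t ⊛ (z ⊛ (A ∘ suc)))
      gf-tail = S.trans (gf-κ t (onNonempty a)) (S.*-congˡ (gf-onNonempty a))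
      split : ∀ L R → onCoderangements a L * (if isEmpty R then 0# else (q ^ (nonempty L ℕ.* length R) * afterMax a R))
        ≈ ε L * tail R + onNonempty (onCoderangements a) L * (q ^ length R * tail R)
      split []      []      = solve 2 (λ t p → (con 1 :* con 1) :* con 0 := con 1 :* (t :* con 0) :+ con 0 :* (p :* (t :* con 0))) ≈-refl _ _
      split []      (y ∷ R) = solve 3 (λ t x p → (con 1 :* con 1) :* (con 1 :* ((t :* con 1) :* x))
        := con 1 :* (t :* x) :+ con 0 :* (p :* (t :* x))) ≈-refl _ _ _
      split (x ∷ L) []      = solve 3 (λ d t p → d :* con 0 := con 0 :* (t :* con 0) :+ d :* (p :* (t :* con 0))) ≈-refl _ _ _
      split (x ∷ L) (y ∷ R) = ≈-trans (*-congˡ (*-congʳ (reflexive (≡.cong (q ^_) (ℕₚ.+-identityʳ (suc (length R)))))))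
        (solve 4 (λ d t x p → d :* (p :* ((t :* con 1) :* x)) := con 0 :* (t :* x) :+ d :* (p :* (t :* x))) ≈-refl _ _ _ _)

  module Weights132 (q : Carrier) where
    open Decomposition separation132
    open GeneratingFunction separation132 (enumeration separation132 avoids132? avoids132⇔) public
    open 132-Avoiding

    u oddLength : List ℕ → Carrier
    u w = if alternating true w then q ^ count2-31 w else 0#
    oddLength w = if flip false (length w) then u w else 0#

    U : Series
    U = gf u

    gf-oddLength : gf oddLength ≋ (z ⊛ dbl (odds (z ⊛ (U ∘ suc))))
    gf-oddLength = z⊛-unfold (gf-zero oddLength) λ n → ≈-trans
      (∑-cong (list (suc n)) {oddLength} {λ w → if flip true n then u w else 0#} λ {w} w∈ →
        reflexive (≡.cong (λ l → if flip false l then u w else 0#) (Good-length (sound {suc n} w∈))))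
      (go n (parity n))
      where
      open Enumeration (enumeration separation132 avoids132? avoids132⇔) using (list; sound)
      go : ∀ n → Parity n → ∑ (list (suc n)) (λ w → if flip true n then u w else 0#) ≈ dbl (odds (z ⊛ (U ∘ suc))) n
      go _ (even m) rewrite flip-even true m = ≈-trans (≈-sym (z⊛-suc (U ∘ suc) (m ℕ.* 2)))
        (reflexive (≡.sym (dbl-even (odds (z ⊛ (U ∘ suc))) m)))
      go _ (odd m) rewrite flip-even false m = ≈-trans (∑-zero (list (2 ℕ.+ m ℕ.* 2)) λ _ → ≈-refl)
        (reflexive (≡.sym (dbl-odd (odds (z ⊛ (U ∘ suc))) m)))

    -- The summands are: both parts empty; L of odd length with R empty; L of odd length with R
    -- nonempty. In the last case each letter of L gains a 2-31, hence the dilation of the odd part.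
    U-equation : (U ∘ suc) ≋
      (one ⊕ ((z ⊛ dbl (odds (z ⊛ (U ∘ suc)))) ⊕ (scale q (z ⊛ dbl (odds (z ⊛ (U ∘ suc)))) ⊛ (z ⊛ (U ∘ suc)))))
    U-equation = S.trans
      (gf-join u (λ L R → ε L * ε R + (oddLength L * ε R + (q ^ length L * oddLength L) * onNonempty u R)) λ {_} {_} {L} {R} gL gR →
        ≈-trans (u-join gL gR) (split L R))
      (S.trans (⨁-+ (λ L R → ε L * ε R) _)
        (S.+-cong (S.trans (⨁-* ε ε) (S.trans (S.*-cong gf-ε gf-ε) (S.*-identityˡ one)))
          (S.trans (⨁-+ (λ L R → oddLength L * ε R) _)
            (S.+-cong (S.trans (⨁-* oddLength ε) (S.trans (S.*-cong gf-oddLength gf-ε) (S.*-identityʳ _)))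
              (S.trans (⨁-* (λ L → q ^ length L * oddLength L) (onNonempty u))
                (S.*-cong (S.trans (gf-scale q oddLength) (scale-cong q gf-oddLength)) (gf-onNonempty u)))))))
      where
      weight : List ℕ → List ℕ → Carrier
      weight L R = if (if isEmpty L then isEmpty R else alternating true L ∧ (flip false (length L) ∧ alternating true R))
        then q ^ count2-31 L * (q ^ (nonempty R ℕ.* length L) * q ^ count2-31 R) else 0#

      u-join : ∀ {k m L R} → Good k L → Good m R → u (join k m L R) ≈ weight L R
      u-join {k} {m} {L} {R} gL gR = ≈-trans
        (reflexive (≡.cong (if_then q ^ count2-31 (join k m L R) else 0#) (alternating-join gL gR)))
        (if-cong (if isEmpty L then isEmpty R else alternating true L ∧ (flip false (length L) ∧ alternating true R))
          (power³ q (count2-31 L) (nonempty R ℕ.* length L) (count2-31 R) (count2-31-join gL gR)))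
        where
        if-cong : ∀ b {x y} → x ≈ y → (if b then x else 0#) ≈ (if b then y else 0#)
        if-cong true  eq = eq
        if-cong false eq = ≈-refl

      cons : ∀ b c d (x e y : Carrier) → (if b ∧ (c ∧ d) then x * (e * y) else 0#)
        ≈ (e * (if c then (if b then x else 0#) else 0#)) * (if d then y else 0#)
      cons true  true  true  x e y = solve 3 (λ x e y → x :* (e :* y) := (e :* x) :* y) ≈-refl _ _ _
      cons true  true  false x e y = ≈-sym (zeroʳ _)
      cons true  false d     x e y = ≈-sym (≈-trans (*-congʳ (zeroʳ e)) (zeroˡ _))
      cons false true  d     x e y = ≈-sym (≈-trans (*-congʳ (zeroʳ e)) (zeroˡ _))
      cons false false d     x e y = ≈-sym (≈-trans (*-congʳ (zeroʳ e)) (zeroˡ _))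

      split : ∀ L R → weight L R ≈ ε L * ε R + (oddLength L * ε R + (q ^ length L * oddLength L) * onNonempty u R)
      split []      []      = solve 0 (con 1 :* (con 1 :* con 1) := con 1 :* con 1 :+ (con 0 :* con 1 :+ (con 1 :* con 0) :* con 0)) ≈-refl
      split []      (y ∷ R) = solve 1 (λ x → con 0 := con 1 :* con 0 :+ (con 0 :* con 0 :+ (con 1 :* con 0) :* x)) ≈-refl _
      split (x ∷ L) []      = ≈-trans (cons (alternating true (x ∷ L)) (flip false (suc (length L))) true _ _ _)
        (solve 2 (λ o p → (con 1 :* o) :* con 1 := con 0 :* con 1 :+ (o :* con 1 :+ (p :* o) :* con 0)) ≈-refl _ _)
      split (x ∷ L) (y ∷ R) = ≈-trans (cons (alternating true (x ∷ L)) (flip false (suc (length L))) (alternating true (y ∷ R)) _ _ _)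
        (≈-trans (*-congʳ (*-congʳ (reflexive (≡.cong (q ^_) (ℕₚ.+-identityʳ (suc (length L)))))))
          (solve 3 (λ o p u → (p :* o) :* u := con 0 :* con 0 :+ (o :* con 0 :+ (p :* o) :* u)) ≈-refl _ _ _))

-- Evaluation at t = -1 and t = -q

module Evaluation {c ℓ} (R : CommutativeRing c ℓ) (q : CommutativeRing.Carrier R) where
  open CommutativeRing R hiding (zero; refl) renaming (sym to ≈-sym; trans to ≈-trans)
  open InRing R
  open PowerSeries R
  open FunctionalEquations R
  open ContinuedFraction R
  open Sums R
  open WeightedSums R
  open Algebra.Properties.Ring ring using (-‿distribˡ-*)
  private
    ≈-refl : ∀ {x} → x ≈ x
    ≈-refl = CommutativeRing.refl R
    module S = CommutativeRing seriesRing
    module W₁ = Weights231 q (- 1#)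
    module W₂ = Weights231 q (- q)
    module V = Weights132 q

  K K± : Series
  K n = C n (q ^ 2)
  K±  = dbl (scale (- q) K)

  -1*q≈-q : - 1# * q ≈ - q
  -1*q≈-q = ≈-trans (≈-sym (-‿distribˡ-* 1# q)) (-‿cong (*-identityˡ q))

  -- Starting from parameter q² and constant 1, the dilation by -q changes the constant to -q, and
  -- passing to z² changes the parameter to q.
  K±-Carlitz : Carlitz (z ⊛ κ (- q)) q K±
  K±-Carlitz = Carlitz-cong q (S.*-congˡ (κ-cong (*-identityʳ (- q))))
    (Carlitz-dbl (- q * 1#) q (Carlitz-scale (- q) 1# (q ^ 2) (C-Carlitz (q ^ 2))))

  A-Carlitz : Carlitz (z ⊛ κ (- 1# * q)) q (W₁.A ∘ suc)
  A-Carlitz = 13-2-equation q (- 1#) (-‿inverseʳ 1#) (W₁.gf-afterMax W₁.a W₁.a[]≈1) W₁.A-equation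

  A≋K± : (W₁.A ∘ suc) ≋ K±
  A≋K± = Carlitz-unique (z ⊛ κ (- q)) q (Carlitz-cong q (S.*-congˡ (κ-cong -1*q≈-q)) A-Carlitz) K±-Carlitz

  G≋K± : (W₁.G ∘ suc) ≋ K±
  G≋K± = Carlitz-unique (z ⊛ κ (- q)) q
    (Carlitz-cong q (S.*-congˡ (κ-cong -1*q≈-q))
      (31-2-equation q (- 1#) (-‿inverseʳ 1#) (W₁.gf-split W₁.g (*-identityˡ _)) W₁.G-equation
        (W₁.gf-afterMax W₁.h W₁.h[]≈1) (S.*-congˡ W₁.H-equation)))
    K±-Carlitz

  D≋K± : W₂.gf (W₂.onCoderangements W₂.g) ≋ K±
  D≋K± = Carlitz-unique (z ⊛ κ (- q)) q
    (coderangement-31-2-equation q (- q) (-‿inverseʳ q)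
      (S.trans (W₂.gf-split W₂.g (*-identityˡ _)) (S.+-congˡ (S.*-congˡ W₂.G-equation)))
      (W₂.gf-afterMax W₂.h W₂.h[]≈1) (S.*-congˡ W₂.H-equation)
      (S.trans (W₂.gf-split (W₂.onCoderangements W₂.g) (*-identityˡ _)) (S.+-congˡ (S.*-congˡ W₂.D-equation))))
    K±-Carlitz

  -- The constant terms are removed on both sides: the empty word is outside the recursions for D*⁺
  -- and u⁺, and only n ≥ 1 is claimed.
  D*≋U : (z ⊛ (W₁.D* ∘ suc)) ≋ dbl (scale (- 1#) (evens (z ⊛ (V.U ∘ suc))))
  D*≋U = Alternating.coderangements≈alternating q (S.*-congˡ V.U-equation) A-Carlitz
    (coderangement-13-2-equation q (- 1#) A-Carlitz (S.*-congˡ W₁.D*-equation))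

  K±-even : ∀ m → K± (m ℕ.* 2) ≈ (- q) ^ m * K m
  K±-even m = reflexive (dbl-even (scale (- q) K) m)

  K±-odd : ∀ m → K± (suc (m ℕ.* 2)) ≈ 0#
  K±-odd m = reflexive (dbl-odd (scale (- q) K) m)

  K±-at : ∀ n → K± n ≈ (ifEven n then ((- q) ^ (n / 2) * C (n / 2) (q ^ 2)) else 0#)
  K±-at n with parity n
  ... | even m = ≈-trans (K±-even m) (≈-trans
    (reflexive (≡.cong (λ k → (- q) ^ k * K k) (≡.sym (m*n/n≡m m 2)))) (reflexive (≡.sym (ifEven-even m _ _))))
  ... | odd m  = ≈-trans (K±-odd m) (reflexive (≡.sym (ifEven-odd m _ _)))

  -- Coefficient n of `A ∘ suc` and `G ∘ suc` belongs to permutations of length n + 1, so the parity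
  -- is reversed compared with `K±-at`.
  K±-before : ∀ n → K± n ≈ (ifEven suc n then 0# else ((- q) ^ (n / 2) * C (n / 2) (q ^ 2)))
  K±-before n with parity n
  ... | even m = ≈-trans (K±-even m) (≈-trans
    (reflexive (≡.cong (λ k → (- q) ^ k * K k) (≡.sym (m*n/n≡m m 2)))) (reflexive (≡.sym (ifEven-odd m _ _))))
  ... | odd m  = ≈-trans (K±-odd m) (reflexive (≡.sym (ifEven-even (suc m) _ _)))

  ∑-31-2 : ∀ t n → ∑ (𝔖231 n) (λ π → t ^ des π * q ^ ⟨31-2⟩ π) ≈ Weights231.G q t n
  ∑-31-2 t n = ≈-trans
    (∑-cong (𝔖231 n) λ {π} _ → reflexive (≡.cong₂ (λ d e → t ^ d * q ^ e) (des≡ π) (⟨31-2⟩≡ π)))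
    (≈-sym (∑-map letters (𝔖231 n) (Weights231.g q t)))

  ∑-13-2 : ∀ t n → ∑ (𝔖231 n) (λ π → t ^ des π * q ^ ⟨13-2⟩ π) ≈ Weights231.A q t n
  ∑-13-2 t n = ≈-trans
    (∑-cong (𝔖231 n) λ {π} _ → reflexive (≡.cong₂ (λ d e → t ^ d * q ^ e) (des≡ π) (⟨13-2⟩≡ π)))
    (≈-sym (∑-map letters (𝔖231 n) (Weights231.a q t)))

  ∑-coderangements : ∀ t n (stat : Word n → ℕ) (w : List ℕ → Carrier) →
    (∀ π → t ^ des π * q ^ stat π ≈ w (letters π)) →
    ∑ (𝔇*231 n) (λ π → t ^ des π * q ^ stat π) ≈ Weights231.gf q t (Weights231.onCoderangements q t w) n
  ∑-coderangements t n stat w eq = ≈-trans (∑-filter coderangement? (𝔖231 n) _) (≈-trans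
    (∑-cong (𝔖231 n) λ {π} _ → ≈-trans
      (reflexive (≡.cong (if_then t ^ des π * q ^ stat π else 0#) (coderangement≡ π)))
      (if-cong (foremaximumFree 0 (letters π)) (eq π)))
    (≈-sym (∑-map letters (𝔖231 n) (Weights231.onCoderangements q t w))))
    where
    if-cong : ∀ b {x y} → x ≈ y → (if b then x else 0#) ≈ (if b then y else 0#)
    if-cong true  eq = eq
    if-cong false eq = ≈-refl

  C*≈ : ∀ m → C* m q ≈ V.U (m ℕ.* 2)
  C*≈ m = ≈-trans (∑-filter alternating? (filter avoids132? (𝔖 (2 ℕ.* m))) _) (≈-trans
    (∑-cong (filter avoids132? (𝔖 (2 ℕ.* m))) λ {π} _ → reflexive
      (≡.cong₂ (λ b e → if b then q ^ e else 0#) (alternating≡ π) (⟨2-31⟩≡ π)))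
    (≈-trans (≈-sym (∑-map letters (filter avoids132? (𝔖 (2 ℕ.* m))) V.u))
      (reflexive (≡.cong V.U (ℕₚ.*-comm 2 m)))))

  D*-at : ∀ n → W₁.D* (suc n) ≈ (ifEven suc n then ((- 1#) ^ (suc n / 2) * C* (suc n / 2) q) else 0#)
  D*-at n = ≈-trans (≈-sym (z⊛-suc (W₁.D* ∘ suc) n)) (≈-trans (D*≋U (suc n)) (go n (parity n)))
    where
    u⁺ : Series
    u⁺ = evens (z ⊛ (V.U ∘ suc))
    go : ∀ n → Parity n → dbl (scale (- 1#) u⁺) (suc n)
      ≈ (ifEven suc n then ((- 1#) ^ (suc n / 2) * C* (suc n / 2) q) else 0#)
    go _ (even m) = ≈-trans (reflexive (dbl-odd (scale (- 1#) u⁺) m)) (reflexive (≡.sym (ifEven-odd m _ _)))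
    go _ (odd m)  = ≈-trans (reflexive (dbl-even (scale (- 1#) u⁺) (suc m))) (≈-trans
      (*-congˡ (≈-trans (z⊛-suc (V.U ∘ suc) (suc (m ℕ.* 2))) (≈-sym (C*≈ (suc m)))))
      (≈-trans (reflexive (≡.cong (λ k → (- 1#) ^ k * C* k q) (≡.sym (m*n/n≡m (suc m) 2))))
        (reflexive (≡.sym (ifEven-even (suc m) _ _)))))

theorem5p2 : ∀ {c ℓ} (R : CommutativeRing c ℓ) →
    let open CommutativeRing R
        open InRing R
    in
    ∀ (q : Carrier) (n : ℕ) → 1 ≤ n →
      (∑ (𝔖231 n) (λ π → (- 1#) ^ des π * q ^ ⟨31-2⟩ π)
        ≈ ∑ (𝔖231 n) (λ π → (- 1#) ^ des π * q ^ ⟨13-2⟩ π))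
      × (∑ (𝔖231 n) (λ π → (- 1#) ^ des π * q ^ ⟨13-2⟩ π)
        ≈ (ifEven n then 0# else ((- q) ^ ((n ∸ 1) / 2) * C ((n ∸ 1) / 2) (q ^ 2))))
      × (∑ (𝔇*231 n) (λ π → (- q) ^ des π * q ^ ⟨31-2⟩ π)
        ≈ (ifEven n then ((- q) ^ (n / 2) * C (n / 2) (q ^ 2)) else 0#))
      × (∑ (𝔇*231 n) (λ π → (- 1#) ^ des π * q ^ ⟨13-2⟩ π)
        ≈ (ifEven n then ((- 1#) ^ (n / 2) * C* (n / 2) q) else 0#))
theorem5p2 R q (suc n) _ =
    trans (∑-31-2 (- 1#) (suc n)) (trans (G≋K± n) (trans (sym (A≋K± n)) (sym (∑-13-2 (- 1#) (suc n)))))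
  , trans (∑-13-2 (- 1#) (suc n)) (trans (A≋K± n) (K±-before n))
  , trans (∑-coderangements (- q) (suc n) ⟨31-2⟩ (WeightedSums.Weights231.g R q (- q))
      (λ π → reflexive (≡.cong₂ (λ d e → (- q) ^ d * q ^ e) (des≡ π) (⟨31-2⟩≡ π))))
      (trans (D≋K± (suc n)) (K±-at (suc n)))
  , trans (∑-coderangements (- 1#) (suc n) ⟨13-2⟩ (WeightedSums.Weights231.a R q (- 1#))
      (λ π → reflexive (≡.cong₂ (λ d e → (- 1#) ^ d * q ^ e) (des≡ π) (⟨13-2⟩≡ π))))
      (D*-at n)
  where
  open CommutativeRing R using (Carrier; -_; 1#; _*_; trans; sym; reflexive)
  open InRing R using (_^_)
  open Evaluation R q
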